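{- Let $p$ be an odd prime with $p\equiv 2\pmod 3$. Then for $M=(2p-1)/3$ and also for $M=p-1$, $$\sum_{k=0}^{M}(-1)^k(6k+1)\frac{(\frac13)_k^3}{k!^3}\equiv -2p+\frac{8p^3}{9}E_{p-3}\left(\tfrac13\right)\pmod{p^4}.$$
   Context: $(x)_k=x(x+1)\cdots(x+k-1)$ is the Pochhammer symbol, with $(x)_0=1$. The Euler polynomials $E_n(x)$ are defined by $\sum_{n\ge 0}E_n(x)\frac{t^n}{n!}=\frac{2e^{xt}}{e^t+1}$. A congruence modulo $p^4$ between rational numbers whose denominators are prime to $p$ means that the difference lies in $p^4\mathbb{Z}_p$, where $\mathbb{Z}_p$ is the ring of $p$-adic integers. -}

module Defs where

open import Algebra.Bundles using (CommutativeRing)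
open import Data.Fin.Base using (toℕ; zero; suc)
open import Data.Integer.Base using (+_)
open import Data.Nat.Base as ℕ using (ℕ; zero; suc; _∸_; _!)
open import Data.Nat.Coprimality using (Coprime)
open import Data.Nat.Properties using (_!≢0; m^n≢0)
open import Data.Product.Base using (_×_; ∃-syntax)
open import Data.Rational.Base
open import Data.Rational.Literals using (fromℤ)
open import Data.Rational.Properties
open import Relation.Binary.PropositionalEquality

open import Algebra.Properties.Semiring.Exp (CommutativeRing.semiring +-*-commutativeRing) public using (_^_)
open import Algebra.Properties.CommutativeMonoid.Sum +-0-commutativeMonoid public using (sum; sum⁺-syntax)

open ≡-Reasoning

fromℕ : ℕ → ℚ
fromℕ n = fromℤ (+ n)

pochhammer : ℚ → ℕ → ℚ
pochhammer x zero    = 1ℚ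
pochhammer x (suc k) = pochhammer x k * (x + fromℕ k)

-- Formal power series in t over ℚ, given by their coefficients.
PowerSeries : Set
PowerSeries = ℕ → ℚ

infixl 6 _⊕_
infixl 7 _⊛_ _⊘_

_⊕_ : PowerSeries → PowerSeries → PowerSeries
(f ⊕ g) n = f n + g n

_⊛_ : PowerSeries → PowerSeries → PowerSeries
(f ⊛ g) n = ∑[ i ≤ n ] (f (toℕ i) * g (n ∸ toℕ i))

constant : ℚ → PowerSeries
constant c zero    = c
constant c (suc n) = 0ℚ

-- Long division: with q = f 0 / g 0, f / g = q + t · (((f − q g) / t) / g).
_⊘_ : (f g : PowerSeries) → .{{_ : NonZero (g 0)}} → PowerSeries
(f ⊘ g) zero    = f 0 ÷ g 0
(f ⊘ g) (suc n) = ((λ m → f (suc m) - (f 0 ÷ g 0) * g (suc m)) ⊘ g) n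

÷-*-cancel : ∀ a b .{{_ : NonZero b}} → (a ÷ b) * b ≡ a
÷-*-cancel a b = begin
  (a * 1/ b) * b  ≡⟨ *-assoc a (1/ b) b ⟩
  a * (1/ b * b)  ≡⟨ cong (a *_) (*-inverseˡ b) ⟩
  a * 1ℚ          ≡⟨ *-identityʳ a ⟩
  a               ∎

⊘-⊛-cancel : ∀ f g .{{_ : NonZero (g 0)}} → (f ⊘ g) ⊛ g ≗ f
⊘-⊛-cancel f g zero    = trans (+-identityʳ _) (÷-*-cancel (f 0) (g 0))
⊘-⊛-cancel f g (suc n) = begin
  c + (f′ ⊘ g ⊛ g) n    ≡⟨ cong (λ y → c + y) (⊘-⊛-cancel f′ g n) ⟩
  c + (f (suc n) - c)   ≡⟨ cong (λ y → c + y) (+-comm (f (suc n)) (- c)) ⟩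
  c + (- c + f (suc n)) ≡⟨ +-assoc c (- c) (f (suc n)) ⟨
  (c - c) + f (suc n)   ≡⟨ cong (_+ f (suc n)) (+-inverseʳ c) ⟩
  0ℚ + f (suc n)        ≡⟨ +-identityˡ (f (suc n)) ⟩
  f (suc n)             ∎
  where
  c = (f 0 ÷ g 0) * g (suc n)
  f′ : PowerSeries
  f′ m = f (suc m) - (f 0 ÷ g 0) * g (suc m)

-- The series of e^{xt}.
exp : ℚ → PowerSeries
exp x n = x ^ n ÷ fromℕ (n !)
  where instance _ = n !≢0

-- The series 2 e^{xt} / (e^t + 1).
eulerSeries : ℚ → PowerSeries
eulerSeries x = (constant (fromℕ 2) ⊛ exp x) ⊘ (exp 1ℚ ⊕ constant 1ℚ)

eulerSeries-spec : ∀ x → eulerSeries x ⊛ (exp 1ℚ ⊕ constant 1ℚ) ≗ constant (fromℕ 2) ⊛ exp x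
eulerSeries-spec x = ⊘-⊛-cancel (constant (fromℕ 2) ⊛ exp x) (exp 1ℚ ⊕ constant 1ℚ)

-- The value E_n(x) of the n-th Euler polynomial.
euler : ℕ → ℚ → ℚ
euler n x = fromℕ (n !) * eulerSeries x n

summand : ℕ → ℚ
summand k = (- 1ℚ) ^ k * fromℕ (6 ℕ.* k ℕ.+ 1) * (pochhammer (+ 1 / 3) k ^ 3 ÷ fromℕ ((k !) ℕ.^ 3))
  where instance _ = m^n≢0 (k !) 3 {{k !≢0}}

-- a − b ∈ pⁿ ℤ_p.  For p prime, a rational z lies in ℤ_p exactly when its
-- reduced denominator ↧ₙ z is prime to p.
infix 4 _≈_[mod_^_]
_≈_[mod_^_] : ℚ → ℚ → ℕ → ℕ → Set
a ≈ b [mod p ^ n ] = ∃[ z ] (Coprime p (↧ₙ z) × a - b ≡ fromℕ p ^ n * z)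

module Submission where

-- Let a = 1/3, p = 6l + 5, n = (2p−1)/3 and y = n + a = 2p/3, and consider
--   F(x) = ∑_{k≤n} (−1)ᵏ (a+2k) (a)ₖ (a+x)ₖ (a−x)ₖ / (k! (1+x)ₖ (1−x)ₖ),
-- so that the sum in question is 3 F(0).  F is known at x = a + m for m ≤ n, where the series
-- terminates, and interpolating F(x) ∏_{j≤n} (j² − x²) in x² at these n + 1 points gives F(0) as
-- a sum of n + 1 products.  The product at x = a + n = y is −y mod p⁴.  The others are p³ times
-- multiples of the terms of an alternating sum of inverse squares, which Euler polynomials
-- evaluate mod p.  The terms with n < k < p sum to 0 mod p⁴, since up to a factor p³ they are
-- antisymmetric mod p about the midpoint of that range.

open import Defs
open import Algebra.Bundles using (CommutativeRing)
import Data.Rational.Properties as ℚ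
open import Algebra.Properties.Semiring.Exp (CommutativeRing.semiring ℚ.+-*-commutativeRing) using (^-assocʳ; ^-homo-*)
open import Data.Fin.Base using (toℕ)
open import Data.Integer.Base as ℤ using (ℤ; -[1+_])
import Data.Integer.Properties as ℤ
open import Data.Nat.Base as ℕ using (ℕ; zero; suc; _∸_; _!)
open import Data.Nat.Coprimality as Coprimality using (Coprime; coprime-divisor)
open import Data.Nat.Divisibility using (_∣_; _∣?_; divides; ∣⇒≤; ∣-trans; ∣-refl; _∣0; ∣1⇒≡1; ∣m+n∣m⇒∣n)
open import Data.Nat.DivMod using (_%_; m*n/n≡m; m≡m%n+[m/n]*n; m%n<n; [m+kn]%n≡m%n)
open import Data.Nat.Induction using (<-rec)
open import Data.Nat.Primality using (Prime; euclidsLemma; prime⇒irreducible; prime⇒nonTrivial; prime⇒nonZero)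
import Data.Nat.Properties as ℕ
open import Data.Nat.Solver using (module +-*-Solver)
open import Data.Product.Base using (_,_; ∃-syntax)
open import Data.Rational.Base
open import Data.Rational.Literals using (fromℤ)
open import Data.Rational.Properties
import Data.Rational.Unnormalised.Base as ℚᵘ
import Data.Rational.Unnormalised.Properties as ℚᵘ
open import Data.Sum.Base using (_⊎_; inj₁; inj₂; [_,_]′)
open import Function.Base using (_∘_; flip)
open import Relation.Binary.PropositionalEquality hiding (J)
open import Relation.Nullary.Decidable using (dec⇒maybe; yes; no)
open import Relation.Nullary.Negation using (¬_; contradiction)
open import Tactic.RingSolver using (solve-∀)
open import Tactic.RingSolver.Core.AlmostCommutativeRing using (AlmostCommutativeRing; fromCommutativeRing)

open +-*-Solver using (solve; _:+_; _:*_; con; _:=_)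

open ≡-Reasoning

-- No rational function of x is ever formed: the interpolated value at x = 0 is proved by induction
-- on n. A terminating well-poised sum spreads the k-th term over the nodes m ≤ k, and for a fixed
-- node these shares telescope in k to one product.
--
-- The factor p³ arises in a single step: going from the product at x = y to its neighbour brings in
-- the factors y and 2y, which makes 2y³ in all. After that, neighbouring products have modulo p the
-- ratio -(j+1)²/(j+2)², the source of the inverse squares. Fermat turns these into powers with
-- exponent p - 3, hence the index of the Euler polynomial.
--
-- The obstacle is one place on the way where numerator and denominator of this ratio are both
-- divisible by p. They are equal there, so they cancel exactly, but the sign flips. The products
-- beyond that place cancel in pairs modulo p⁴. What remains is an alternating sum over 1, ..., (p -
-- 2)/3, and the next integer (p + 1)/3 is congruent to 1/3, the argument in the theorem.

ringℚ : AlmostCommutativeRing _ _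
ringℚ = fromCommutativeRing +-*-commutativeRing (λ x → dec⇒maybe (0ℚ ≟ x))

-- Embeddings into ℚ and a total reciprocal.

fromℤ-+ : ∀ i j → fromℤ (i ℤ.+ j) ≡ fromℤ i + fromℤ j
fromℤ-+ i j = toℚᵘ-injective (ℚᵘ.≃-trans
  (ℚᵘ.≃-reflexive (cong (λ k → ℚᵘ.mkℚᵘ k 0) (sym (cong₂ ℤ._+_ (ℤ.*-identityʳ i) (ℤ.*-identityʳ j)))))
  (ℚᵘ.≃-sym (toℚᵘ-homo-+ (fromℤ i) (fromℤ j))))

fromℤ-* : ∀ i j → fromℤ (i ℤ.* j) ≡ fromℤ i * fromℤ j
fromℤ-* i j = toℚᵘ-injective (ℚᵘ.≃-sym (toℚᵘ-homo-* (fromℤ i) (fromℤ j)))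

fromℤ-neg : ∀ i → fromℤ (ℤ.- i) ≡ - fromℤ i
fromℤ-neg (ℤ.+ 0)       = refl
fromℤ-neg (ℤ.+ (suc n)) = refl
fromℤ-neg -[1+ n ]    = refl

fromℤ-injective : ∀ {i j} → fromℤ i ≡ fromℤ j → i ≡ j
fromℤ-injective = cong ↥_

fromℕ-+ : ∀ m n → fromℕ (m ℕ.+ n) ≡ fromℕ m + fromℕ n
fromℕ-+ m n = fromℤ-+ (ℤ.+ m) (ℤ.+ n)

fromℕ-* : ∀ m n → fromℕ (m ℕ.* n) ≡ fromℕ m * fromℕ n
fromℕ-* m n = trans (cong fromℤ (ℤ.pos-* m n)) (fromℤ-* (ℤ.+ m) (ℤ.+ n))

fromℕ-suc : ∀ n → fromℕ (suc n) ≡ 1ℚ + fromℕ n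
fromℕ-suc = fromℕ-+ 1

fromℕ-shift : ∀ x m → x + 1ℚ + fromℕ m ≡ x + fromℕ (suc m)
fromℕ-shift x m = trans (+-assoc x 1ℚ (fromℕ m)) (cong (x +_) (sym (fromℕ-suc m)))

fromℕ≢0 : ∀ n .{{_ : ℕ.NonZero n}} → fromℕ n ≢ 0ℚ
fromℕ≢0 (suc n) ()

abstract
  -- Total, with value 0 at 0, so that quotients of long products can be rewritten with a
  -- nonvanishing proof only for the factor that is being cancelled.
  recip : ℚ → ℚ
  recip x with x ≟ 0ℚ
  ... | yes _  = 0ℚ
  ... | no x≢0 = 1/_ x {{≢-nonZero x≢0}}

  recip-zero : recip 0ℚ ≡ 0ℚ
  recip-zero = refl

  recip-inverseʳ : ∀ {x} → x ≢ 0ℚ → x * recip x ≡ 1ℚ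
  recip-inverseʳ {x} x≢0 with x ≟ 0ℚ
  ... | yes x≡0 = contradiction x≡0 x≢0
  ... | no x≢0′ = *-inverseʳ x {{≢-nonZero x≢0′}}

*-cancelˡ-≡ : ∀ {z} → z ≢ 0ℚ → ∀ {x y} → z * x ≡ z * y → x ≡ y
*-cancelˡ-≡ {z} z≢0 {x} {y} zx≡zy = begin
  x                  ≡⟨ scale x ⟨
  recip z * (z * x)  ≡⟨ cong (recip z *_) zx≡zy ⟩
  recip z * (z * y)  ≡⟨ scale y ⟩
  y                  ∎
  where
  scale : ∀ t → recip z * (z * t) ≡ t
  scale t = begin
    recip z * (z * t)  ≡⟨ *-assoc (recip z) z t ⟨
    recip z * z * t    ≡⟨ cong (_* t) (trans (*-comm (recip z) z) (recip-inverseʳ z≢0)) ⟩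
    1ℚ * t             ≡⟨ *-identityˡ t ⟩
    t                  ∎

*-≢0 : ∀ {x y} → x ≢ 0ℚ → y ≢ 0ℚ → x * y ≢ 0ℚ
*-≢0 {x} x≢0 y≢0 xy≡0 = y≢0 (*-cancelˡ-≡ x≢0 (trans xy≡0 (sym (*-zeroʳ x))))

recip-unique : ∀ {x y} → x * y ≡ 1ℚ → y ≡ recip x
recip-unique {x} {y} xy≡1 = *-cancelˡ-≡ {x} x≢0 (trans xy≡1 (sym (recip-inverseʳ x≢0)))
  where
  x≢0 : x ≢ 0ℚ
  x≢0 refl = contradiction (trans (sym xy≡1) (*-zeroˡ y)) 1≢0

-- For `x` = 0 both sides are 0, so nothing has to be assumed about `x`. All step rules for
-- `invFact` and `invPoch` are instances.
recip-cancel : ∀ x {y} → y ≢ 0ℚ → recip x ≡ y * recip (x * y)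
recip-cancel x {y} y≢0 with x ≟ 0ℚ
... | yes refl = begin
  recip 0ℚ            ≡⟨ recip-zero ⟩
  0ℚ                  ≡⟨ *-zeroʳ y ⟨
  y * 0ℚ              ≡⟨ cong (y *_) recip-zero ⟨
  y * recip 0ℚ        ≡⟨ cong (λ t → y * recip t) (*-zeroˡ y) ⟨
  y * recip (0ℚ * y)  ∎
... | no x≢0  = sym (recip-unique (begin
  x * (y * recip (x * y))  ≡⟨ *-assoc x y _ ⟨
  x * y * recip (x * y)    ≡⟨ recip-inverseʳ (*-≢0 x≢0 y≢0) ⟩
  1ℚ                       ∎))

÷-recip : ∀ x y .{{_ : NonZero y}} → x ÷ y ≡ x * recip y
÷-recip x y = cong (x *_) (recip-unique {y} (*-inverseʳ y))

-- Pochhammer symbols, factorials and their reciprocals.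

pochhammer-left : ∀ x k → pochhammer x (suc k) ≡ x * pochhammer (x + 1ℚ) k
pochhammer-left x zero    = trans (*-identityˡ (x + 0ℚ)) (trans (+-identityʳ x) (sym (*-identityʳ x)))
pochhammer-left x (suc k) = begin
  pochhammer x (suc k) * (x + fromℕ (suc k))                 ≡⟨ cong₂ (λ u v → u * (x + v)) (pochhammer-left x k) (fromℕ-suc k) ⟩
  x * pochhammer (x + 1ℚ) k * (x + (1ℚ + fromℕ k))           ≡⟨ rearrange x (pochhammer (x + 1ℚ) k) (fromℕ k) ⟩
  x * (pochhammer (x + 1ℚ) k * (x + 1ℚ + fromℕ k))           ∎
  where
  rearrange : ∀ x P t → x * P * (x + (1ℚ + t)) ≡ x * (P * (x + 1ℚ + t))
  rearrange = solve-∀ ringℚ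

invFact : ℕ → ℚ
invFact n = recip (fromℕ (n !))

invFact-zero : invFact 0 ≡ 1ℚ
invFact-zero = sym (recip-unique {1ℚ} refl)

invFact-suc : ∀ n → invFact n ≡ fromℕ (suc n) * invFact (suc n)
invFact-suc n = begin
  recip (fromℕ (n !))                                         ≡⟨ recip-cancel (fromℕ (n !)) (fromℕ≢0 (suc n)) ⟩
  fromℕ (suc n) * recip (fromℕ (n !) * fromℕ (suc n))         ≡⟨ cong (λ t → fromℕ (suc n) * recip t) (trans (*-comm (fromℕ (n !)) (fromℕ (suc n))) (sym (fromℕ-* (suc n) (n !)))) ⟩
  fromℕ (suc n) * invFact (suc n)                             ∎

invPoch : ℚ → ℕ → ℚ
invPoch x k = recip (pochhammer x k)

invPoch-suc : ∀ x k → x + fromℕ k ≢ 0ℚ → invPoch x k ≡ (x + fromℕ k) * invPoch x (suc k)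
invPoch-suc x k = recip-cancel (pochhammer x k)

invPoch-left : ∀ x k → x ≢ 0ℚ → invPoch (x + 1ℚ) k ≡ x * invPoch x (suc k)
invPoch-left x k x≢0 = trans (recip-cancel (pochhammer (x + 1ℚ) k) x≢0)
  (cong (λ t → x * recip t) (trans (*-comm (pochhammer (x + 1ℚ) k) x) (sym (pochhammer-left x k))))

-- Sums over antidiagonals.

-- Δ n f = ∑ f m k over m + k = n.
Δ : ℕ → (ℕ → ℕ → ℚ) → ℚ
Δ zero    f = f 0 0
Δ (suc n) f = f 0 (suc n) + Δ n (f ∘ suc)

Δ-cong : ∀ n {f g} → (∀ m k → m ℕ.+ k ≡ n → f m k ≡ g m k) → Δ n f ≡ Δ n g
Δ-cong zero    f≡g = f≡g 0 0 refl
Δ-cong (suc n) f≡g = cong₂ _+_ (f≡g 0 (suc n) refl) (Δ-cong n (λ m k e → f≡g (suc m) k (cong suc e)))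

Δ-last : ∀ n f → Δ (suc n) f ≡ f (suc n) 0 + Δ n (λ m k → f m (suc k))
Δ-last zero    f = +-comm (f 0 1) (f 1 0)
Δ-last (suc n) f = trans (cong (λ t → f 0 (suc (suc n)) + t) (Δ-last n (f ∘ suc)))
  (swap (f 0 (suc (suc n))) (f (suc (suc n)) 0) (Δ n (λ m k → f (suc m) (suc k))))
  where
  swap : ∀ x y z → x + (y + z) ≡ y + (x + z)
  swap = solve-∀ ringℚ

Δ-flip : ∀ n f → Δ n f ≡ Δ n (flip f)
Δ-flip zero    f = refl
Δ-flip (suc n) f = trans (cong (f 0 (suc n) +_) (Δ-flip n (f ∘ suc))) (sym (Δ-last n (flip f)))

Δ-+ : ∀ n f g → Δ n (λ m k → f m k + g m k) ≡ Δ n f + Δ n g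
Δ-+ zero    f g = refl
Δ-+ (suc n) f g = trans (cong (λ t → f 0 (suc n) + g 0 (suc n) + t) (Δ-+ n (f ∘ suc) (g ∘ suc))) (swap (f 0 (suc n)) (g 0 (suc n)) _ _)
  where
  swap : ∀ x y z t → (x + y) + (z + t) ≡ (x + z) + (y + t)
  swap = solve-∀ ringℚ

Δ-*ˡ : ∀ n c f → Δ n (λ m k → c * f m k) ≡ c * Δ n f
Δ-*ˡ zero    c f = refl
Δ-*ˡ (suc n) c f = trans (cong (λ t → c * f 0 (suc n) + t) (Δ-*ˡ n c (f ∘ suc))) (sym (*-distribˡ-+ c (f 0 (suc n)) (Δ n (f ∘ suc))))

∑≡Δ : ∀ n (f : ℕ → ℚ) → ∑[ k ≤ n ] f (toℕ k) ≡ Δ n (λ k _ → f k)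
∑≡Δ zero    f = +-identityʳ (f 0)
∑≡Δ (suc n) f = cong (λ t → f 0 + t) (∑≡Δ n (f ∘ suc))

-- A terminating well-poised sum.

-- A summand of the terminating well-poised ₄F₃(−1) with c = α + 1 − b.
poised : ℚ → ℚ → ℚ → ℕ → ℕ → ℚ
poised α b c m k = (α + fromℕ 2 * fromℕ m) * pochhammer b m * pochhammer (c + fromℕ m) k
  * invFact m * invFact k * invPoch (α + fromℕ m) (suc (m ℕ.+ k))

-- The factor is the distance of the node m + 1 from the node 0 and so removes node 0. The remaining
-- nodes (m + 1)(m + 1 + α) are a translate of the nodes m (m + α + 2), which explains the shift of
-- `α` by 2.
poised-lower : ∀ α b c m k → (∀ j → α + fromℕ j ≢ 0ℚ) →
  fromℕ (suc m) * (α + fromℕ (suc m)) * poised α b c (suc m) k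
    ≡ b * poised (α + fromℕ 2) (b + 1ℚ) (c + 1ℚ) m k
poised-lower α b c m k α≢0 = begin
  s * (α + s) * ((α + fromℕ 2 * s) * pochhammer b (suc m) * pochhammer (c + s) k * invFact (suc m) * invFact k * J)
    ≡⟨ cong (λ t → s * (α + s) * ((α + fromℕ 2 * s) * t * pochhammer (c + s) k * invFact (suc m) * invFact k * J)) (pochhammer-left b m) ⟩
  s * (α + s) * ((α + fromℕ 2 * s) * (b * pochhammer (b + 1ℚ) m) * pochhammer (c + s) k * invFact (suc m) * invFact k * J)
    ≡⟨ rearrange s α b (fromℕ 2 * s) (pochhammer (b + 1ℚ) m) (pochhammer (c + s) k) (invFact (suc m)) (invFact k) J ⟩
  b * ((α + fromℕ 2 * s) * pochhammer (b + 1ℚ) m * pochhammer (c + s) k * (s * invFact (suc m)) * invFact k * ((α + s) * J))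
    ≡⟨ cong₂ (λ u v → b * ((α + fromℕ 2 * s) * pochhammer (b + 1ℚ) m * pochhammer (c + s) k * u * invFact k * v))
         (sym (invFact-suc m)) (sym (invPoch-left (α + s) (suc (m ℕ.+ k)) (α≢0 (suc m)))) ⟩
  b * ((α + fromℕ 2 * s) * pochhammer (b + 1ℚ) m * pochhammer (c + s) k * invFact m * invFact k * invPoch (α + s + 1ℚ) (suc (m ℕ.+ k)))
    ≡⟨ cong (λ t → b * ((α + fromℕ 2 * s) * pochhammer (b + 1ℚ) m * t * invFact m * invFact k * invPoch (α + s + 1ℚ) (suc (m ℕ.+ k))))
         (cong (λ t → pochhammer t k) (sym (fromℕ-shift c m))) ⟩
  b * ((α + fromℕ 2 * s) * pochhammer (b + 1ℚ) m * pochhammer (c + 1ℚ + fromℕ m) k * invFact m * invFact k * invPoch (α + s + 1ℚ) (suc (m ℕ.+ k)))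
    ≡⟨ cong₂ (λ u v → b * (u * pochhammer (b + 1ℚ) m * pochhammer (c + 1ℚ + fromℕ m) k * invFact m * invFact k * invPoch v (suc (m ℕ.+ k))))
         (trans (cong (λ t → α + fromℕ 2 * t) (fromℕ-suc m)) (double α (fromℕ m)))
         (trans (cong (λ t → α + t + 1ℚ) (fromℕ-suc m)) (shift α (fromℕ m))) ⟩
  b * poised (α + fromℕ 2) (b + 1ℚ) (c + 1ℚ) m k ∎
  where
  s = fromℕ (suc m)
  J = invPoch (α + s) (suc (suc m ℕ.+ k))
  rearrange : ∀ s α b t P Q F G J → s * (α + s) * ((α + t) * (b * P) * Q * F * G * J) ≡ b * ((α + t) * P * Q * (s * F) * G * ((α + s) * J))
  rearrange = solve-∀ ringℚ
  double : ∀ α t → α + fromℕ 2 * (1ℚ + t) ≡ α + fromℕ 2 + fromℕ 2 * t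
  double = solve-∀ ringℚ
  shift : ∀ α t → α + (1ℚ + t) + 1ℚ ≡ α + fromℕ 2 + t
  shift = solve-∀ ringℚ

-- With N = m + k + 1 the factor is N (N + α) - m (m + α), the distance to the last node, and so
-- removes that node.
poised-upper : ∀ α b c m k → (∀ j → α + fromℕ j ≢ 0ℚ) →
  fromℕ (suc k) * (α + fromℕ m + fromℕ (suc (m ℕ.+ k))) * poised α b c m (suc k)
    ≡ (c + fromℕ (m ℕ.+ k)) * poised α b c m k
poised-upper α b c m k α≢0 = begin
  s * (α + μ + r) * ((α + fromℕ 2 * μ) * pochhammer b m * (pochhammer (c + μ) k * (c + μ + fromℕ k)) * invFact m * invFact (suc k) * invPoch (α + μ) (suc (m ℕ.+ suc k)))
    ≡⟨ cong (λ t → s * (α + μ + r) * ((α + fromℕ 2 * μ) * pochhammer b m * (pochhammer (c + μ) k * (c + μ + fromℕ k)) * invFact m * invFact (suc k) * invPoch (α + μ) (suc t))) (ℕ.+-suc m k) ⟩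
  s * (α + μ + r) * ((α + fromℕ 2 * μ) * pochhammer b m * (pochhammer (c + μ) k * (c + μ + fromℕ k)) * invFact m * invFact (suc k) * J)
    ≡⟨ rearrange s (α + μ + r) (α + fromℕ 2 * μ) (pochhammer b m) (pochhammer (c + μ) k) (c + μ + fromℕ k) (invFact m) (invFact (suc k)) J ⟩
  (c + μ + fromℕ k) * ((α + fromℕ 2 * μ) * pochhammer b m * pochhammer (c + μ) k * invFact m * (s * invFact (suc k)) * ((α + μ + r) * J))
    ≡⟨ cong₂ (λ u v → (c + μ + fromℕ k) * ((α + fromℕ 2 * μ) * pochhammer b m * pochhammer (c + μ) k * invFact m * u * v))
         (sym (invFact-suc k)) (sym (invPoch-suc (α + μ) (suc (m ℕ.+ k)) nonzero)) ⟩
  (c + μ + fromℕ k) * poised α b c m k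
    ≡⟨ cong (_* poised α b c m k) (trans (+-assoc c μ (fromℕ k)) (cong (c +_) (sym (fromℕ-+ m k)))) ⟩
  (c + fromℕ (m ℕ.+ k)) * poised α b c m k ∎
  where
  s = fromℕ (suc k)
  μ = fromℕ m
  r = fromℕ (suc (m ℕ.+ k))
  J = invPoch (α + μ) (suc (suc (m ℕ.+ k)))
  nonzero : α + μ + r ≢ 0ℚ
  nonzero = subst (_≢ 0ℚ) (trans (cong (α +_) (fromℕ-+ m (suc (m ℕ.+ k)))) (sym (+-assoc α μ r))) (α≢0 (m ℕ.+ suc (m ℕ.+ k)))
  rearrange : ∀ s q a P Q z F G J → s * q * (a * P * (Q * z) * F * G * J) ≡ z * (a * P * Q * F * (s * G) * (q * J))
  rearrange = solve-∀ ringℚ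

-- The splitting is the recursion for divided differences at the nodes m (m + α).
Δ-poised : ∀ n α b c → b + c ≡ α + 1ℚ → (∀ j → α + fromℕ j ≢ 0ℚ) → Δ n (poised α b c) ≡ invFact n
Δ-poised zero    α b c b+c α≢0 = begin
  (α + fromℕ 2 * 0ℚ) * 1ℚ * 1ℚ * invFact 0 * invFact 0 * invPoch (α + 0ℚ) 1
    ≡⟨ cong (λ t → (α + fromℕ 2 * 0ℚ) * 1ℚ * 1ℚ * t * invFact 0 * invPoch (α + 0ℚ) 1) invFact-zero ⟩
  (α + fromℕ 2 * 0ℚ) * 1ℚ * 1ℚ * 1ℚ * invFact 0 * invPoch (α + 0ℚ) 1
    ≡⟨ rearrange α (invFact 0) (invPoch (α + 0ℚ) 1) ⟩
  invFact 0 * (1ℚ * (α + 0ℚ + 0ℚ) * invPoch (α + 0ℚ) 1)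
    ≡⟨ cong (invFact 0 *_) (recip-inverseʳ (*-≢0 {1ℚ} (λ ()) (subst (_≢ 0ℚ) (sym (+-identityʳ (α + 0ℚ))) (α≢0 0)))) ⟩
  invFact 0 * 1ℚ
    ≡⟨ *-identityʳ (invFact 0) ⟩
  invFact 0 ∎
  where
  rearrange : ∀ α F J → (α + fromℕ 2 * 0ℚ) * 1ℚ * 1ℚ * 1ℚ * F * J ≡ F * (1ℚ * (α + 0ℚ + 0ℚ) * J)
  rearrange = solve-∀ ringℚ
Δ-poised (suc n) α b c b+c α≢0 = *-cancelˡ-≡ (*-≢0 (fromℕ≢0 (suc n)) (α≢0 (suc n))) (begin
  N * (α + N) * Δ (suc n) v
    ≡⟨ Δ-*ˡ (suc n) (N * (α + N)) v ⟨
  Δ (suc n) (λ m k → N * (α + N) * v m k)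
    ≡⟨ Δ-cong (suc n) split ⟩
  Δ (suc n) (λ m k → x m k + y m k)
    ≡⟨ Δ-+ (suc n) x y ⟩
  Δ (suc n) x + Δ (suc n) y
    ≡⟨ cong (_+ Δ (suc n) y) (Δ-last n x) ⟩
  0ℚ * (α + fromℕ (suc n) + fromℕ (suc n ℕ.+ 0)) * v (suc n) 0 + Δ n (λ m k → x m (suc k)) + (0ℚ * (α + fromℕ 0) * v 0 (suc n) + Δ n (λ m k → y (suc m) k))
    ≡⟨ drop (α + fromℕ (suc n) + fromℕ (suc n ℕ.+ 0)) (v (suc n) 0) (α + fromℕ 0) (v 0 (suc n)) _ _ ⟩
  Δ n (λ m k → x m (suc k)) + Δ n (λ m k → y (suc m) k)
    ≡⟨ cong₂ _+_ (Δ-cong n upper) (Δ-cong n (λ m k _ → poised-lower α b c m k α≢0)) ⟩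
  Δ n (λ m k → (c + fromℕ n) * v m k) + Δ n (λ m k → b * poised (α + fromℕ 2) (b + 1ℚ) (c + 1ℚ) m k)
    ≡⟨ cong₂ _+_ (Δ-*ˡ n (c + fromℕ n) v) (Δ-*ˡ n b (poised (α + fromℕ 2) (b + 1ℚ) (c + 1ℚ))) ⟩
  (c + fromℕ n) * Δ n v + b * Δ n (poised (α + fromℕ 2) (b + 1ℚ) (c + 1ℚ))
    ≡⟨ cong₂ (λ t u → (c + fromℕ n) * t + b * u) (Δ-poised n α b c b+c α≢0)
         (Δ-poised n (α + fromℕ 2) (b + 1ℚ) (c + 1ℚ) sum-shift (λ j → subst (_≢ 0ℚ) (shift j) (α≢0 (2 ℕ.+ j)))) ⟩
  (c + fromℕ n) * invFact n + b * invFact n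
    ≡⟨ collect c b (fromℕ n) (invFact n) ⟩
  (b + c + fromℕ n) * invFact n
    ≡⟨ cong₂ (λ t u → (t + fromℕ n) * u) b+c (invFact-suc n) ⟩
  (α + 1ℚ + fromℕ n) * (N * invFact (suc n))
    ≡⟨ cong (_* (N * invFact (suc n))) (fromℕ-shift α n) ⟩
  (α + N) * (N * invFact (suc n))
    ≡⟨ commute (α + N) N (invFact (suc n)) ⟩
  N * (α + N) * invFact (suc n) ∎)
  where
  N = fromℕ (suc n)
  v x y : ℕ → ℕ → ℚ
  v = poised α b c
  x m k = fromℕ k * (α + fromℕ m + fromℕ (m ℕ.+ k)) * v m k
  y m k = fromℕ m * (α + fromℕ m) * v m k
  collect : ∀ c b n F → (c + n) * F + b * F ≡ (b + c + n) * F
  collect = solve-∀ ringℚ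
  commute : ∀ p q r → p * (q * r) ≡ q * p * r
  commute = solve-∀ ringℚ
  drop : ∀ p q r s t u → 0ℚ * p * q + t + (0ℚ * r * s + u) ≡ t + u
  drop = solve-∀ ringℚ
  nodes : ∀ α m k v → (m + k) * (α + (m + k)) * v ≡ k * (α + m + (m + k)) * v + m * (α + m) * v
  nodes = solve-∀ ringℚ
  split : ∀ m k → m ℕ.+ k ≡ suc n → N * (α + N) * v m k ≡ x m k + y m k
  split m k e = begin
    N * (α + N) * v m k
      ≡⟨ cong (λ t → t * (α + t) * v m k) (trans (cong fromℕ (sym e)) (fromℕ-+ m k)) ⟩
    (fromℕ m + fromℕ k) * (α + (fromℕ m + fromℕ k)) * v m k
      ≡⟨ nodes α (fromℕ m) (fromℕ k) (v m k) ⟩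
    fromℕ k * (α + fromℕ m + (fromℕ m + fromℕ k)) * v m k + y m k
      ≡⟨ cong (λ t → fromℕ k * (α + fromℕ m + t) * v m k + y m k) (fromℕ-+ m k) ⟨
    x m k + y m k ∎
  upper : ∀ m k → m ℕ.+ k ≡ n → x m (suc k) ≡ (c + fromℕ n) * v m k
  upper m k refl = trans (cong (λ t → fromℕ (suc k) * (α + fromℕ m + fromℕ t) * v m (suc k)) (ℕ.+-suc m k)) (poised-upper α b c m k α≢0)
  sum-shift : b + 1ℚ + (c + 1ℚ) ≡ α + fromℕ 2 + 1ℚ
  sum-shift = trans (gather b c) (trans (cong (_+ fromℕ 2) b+c) (swap α))
    where
    gather : ∀ b c → b + 1ℚ + (c + 1ℚ) ≡ b + c + fromℕ 2
    gather = solve-∀ ringℚ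
    swap : ∀ α → α + 1ℚ + fromℕ 2 ≡ α + fromℕ 2 + 1ℚ
    swap = solve-∀ ringℚ
  shift : ∀ j → α + fromℕ (2 ℕ.+ j) ≡ α + fromℕ 2 + fromℕ j
  shift j = trans (cong (α +_) (fromℕ-+ 2 j)) (sym (+-assoc α (fromℕ 2) (fromℕ j)))

-- The interpolation formula at x = 0.

cube : ℚ → ℚ
cube x = x * x * x

-- The product (y - 1)(y - 2)⋯(y - n), built in the order of `pochhammer (y + 1ℚ) n`, so that y - j
-- and y + j can be compared factor by factor.
descending : ℚ → ℕ → ℚ
descending y zero    = 1ℚ
descending y (suc n) = descending y n * (y - fromℕ (suc n))

pochhammer-sub : ∀ y n →
  pochhammer (y - fromℕ (suc n)) (suc n) ≡ (y - fromℕ (suc n)) * pochhammer (y - fromℕ n) n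
pochhammer-sub y n = trans (pochhammer-left (y - fromℕ (suc n)) n)
  (cong (λ t → (y - fromℕ (suc n)) * pochhammer t n) (trans (cong (λ t → y - t + 1ℚ) (fromℕ-suc n)) (cancel y (fromℕ n))))
  where
  cancel : ∀ y n → y - (1ℚ + n) + 1ℚ ≡ y - n
  cancel = solve-∀ ringℚ

pochhammer-descending : ∀ y n → pochhammer (y - fromℕ n) n ≡ descending y n
pochhammer-descending y zero    = refl
pochhammer-descending y (suc n) = begin
  pochhammer (y - N) (suc n)             ≡⟨ pochhammer-sub y n ⟩
  (y - N) * pochhammer (y - fromℕ n) n   ≡⟨ cong ((y - N) *_) (pochhammer-descending y n) ⟩
  (y - N) * descending y n               ≡⟨ *-comm (y - N) (descending y n) ⟩
  descending y n * (y - N)               ∎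
  where
  N = fromℕ (suc n)

pochhammer-≢0 : ∀ x k → (∀ j → x + fromℕ j ≢ 0ℚ) → pochhammer x k ≢ 0ℚ
pochhammer-≢0 x zero    x≢0 = λ ()
pochhammer-≢0 x (suc k) x≢0 = *-≢0 (pochhammer-≢0 x k x≢0) (x≢0 k)

module _ (a : ℚ) (a≢0 : ∀ j → a + fromℕ j ≢ 0ℚ) (2a≢0 : ∀ j → a + a + fromℕ j ≢ 0ℚ) where

  -- The summand of node x = a + m, with m + i = n, in the interpolation formula for F(0).
  node : ℕ → ℕ → ℕ → ℚ
  node n m i = fromℕ 2 * (- 1ℚ) ^ n * pochhammer (a - fromℕ i) i * cube (pochhammer a (suc n))
    * pochhammer (a + fromℕ (suc n)) m * (invFact n * invFact n) * invFact m * invFact i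
    * recip (a + fromℕ m) * invPoch (a + a + fromℕ m) (suc n)

  weight : ℕ → ℕ → ℚ
  weight m i = node (m ℕ.+ i) m i

  term : ℕ → ℚ
  term n = (- 1ℚ) ^ n * (a + fromℕ 2 * fromℕ n) * cube (pochhammer a n * invFact n)

  -- The share of `term n` that falls to the node a + m. It uses `poised` with α = 2a because then m
  -- (m + α) = (a + m)² - a², so the nodes are the interpolation points x² = (a + m)² up to a
  -- translation.
  increment : ℕ → ℕ → ℕ → ℚ
  increment n m i = (- 1ℚ) ^ n * (a + fromℕ 2 * fromℕ n) * cube (pochhammer a n) * (invFact n * invFact n)
    * poised (a + a) (a + fromℕ n) (1ℚ + a - fromℕ n) m i

  private
    x*x*recip : ∀ {x} → x ≢ 0ℚ → x * (x * recip x) ≡ x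
    x*x*recip {x} x≢0 = trans (cong (x *_) (recip-inverseʳ x≢0)) (*-identityʳ x)

  Δ-increment : ∀ n → Δ n (increment n) ≡ term n
  Δ-increment n = begin
    Δ n (increment n)
      ≡⟨ Δ-*ˡ n (s * q * cube P * (F * F)) (poised (a + a) (a + fromℕ n) (1ℚ + a - fromℕ n)) ⟩
    s * q * cube P * (F * F) * Δ n (poised (a + a) (a + fromℕ n) (1ℚ + a - fromℕ n))
      ≡⟨ cong (s * q * cube P * (F * F) *_) (Δ-poised n (a + a) (a + fromℕ n) (1ℚ + a - fromℕ n) (balance a (fromℕ n)) 2a≢0) ⟩
    s * q * cube P * (F * F) * F
      ≡⟨ collect s q P F ⟩
    term n ∎
    where
    s = (- 1ℚ) ^ n
    q = a + fromℕ 2 * fromℕ n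
    P = pochhammer a n
    F = invFact n
    balance : ∀ a n → a + n + (1ℚ + a - n) ≡ a + a + 1ℚ
    balance = solve-∀ ringℚ
    collect : ∀ s q P F → s * q * (P * P * P) * (F * F) * F ≡ s * q * (P * F * (P * F) * (P * F))
    collect = solve-∀ ringℚ

  -- The node a + n takes part for the first time at the n-th term, so its product starts as a
  -- single share.
  weight-zero : ∀ n → weight n 0 ≡ increment n n 0
  weight-zero n = begin
    node (n ℕ.+ 0) n 0
      ≡⟨ cong (λ t → node t n 0) (ℕ.+-identityʳ n) ⟩
    fromℕ 2 * s * 1ℚ * cube (P * (a + ν)) * K′ * (F * F) * F * F₀ * A * D
      ≡⟨ rearrange s P (a + ν) K′ F F₀ A D ⟩
    s * cube P * (F * F) * (fromℕ 2 * ((a + ν) * ((a + ν) * A)) * ((a + ν) * K′) * F * F₀ * D)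
      ≡⟨ cong₂ (λ t u → s * cube P * (F * F) * (fromℕ 2 * t * u * F * F₀ * D)) (x*x*recip (a≢0 n)) shift ⟩
    s * cube P * (F * F) * (fromℕ 2 * (a + ν) * (K * (a + ν + ν)) * F * F₀ * D)
      ≡⟨ rearrange′ s P F F₀ D K a ν ⟩
    s * (a + fromℕ 2 * ν) * cube P * (F * F) * ((a + a + fromℕ 2 * ν) * K * 1ℚ * F * F₀ * D)
      ≡⟨ cong (λ t → s * (a + fromℕ 2 * ν) * cube P * (F * F) * ((a + a + fromℕ 2 * ν) * K * 1ℚ * F * F₀ * invPoch (a + a + ν) (suc t))) (ℕ.+-identityʳ n) ⟨
    increment n n 0 ∎
    where
    s = (- 1ℚ) ^ n
    ν = fromℕ n
    P = pochhammer a n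
    K = pochhammer (a + ν) n
    K′ = pochhammer (a + fromℕ (suc n)) n
    F = invFact n
    F₀ = invFact 0
    A = recip (a + ν)
    D = invPoch (a + a + ν) (suc n)
    shift : (a + ν) * K′ ≡ K * (a + ν + ν)
    shift = trans (cong (λ t → (a + ν) * pochhammer t n) (trans (sym (fromℕ-shift a n)) (swap a ν))) (sym (pochhammer-left (a + ν) n))
      where
      swap : ∀ a n → a + 1ℚ + n ≡ a + n + 1ℚ
      swap = solve-∀ ringℚ
    rearrange : ∀ s P x K F G A D → fromℕ 2 * s * 1ℚ * (P * x * (P * x) * (P * x)) * K * (F * F) * F * G * A * D
      ≡ s * (P * P * P) * (F * F) * (fromℕ 2 * (x * (x * A)) * (x * K) * F * G * D)
    rearrange = solve-∀ ringℚ
    rearrange′ : ∀ s P F G D K a n → s * (P * P * P) * (F * F) * (fromℕ 2 * (a + n) * (K * (a + n + n)) * F * G * D)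
      ≡ s * (a + fromℕ 2 * n) * (P * P * P) * (F * F) * ((a + a + fromℕ 2 * n) * K * 1ℚ * F * G * D)
    rearrange′ = solve-∀ ringℚ

  -- This is the telescoping in n at a fixed node: adding one more term of F(0) changes the product
  -- by exactly one share.
  weight-suc : ∀ m i → weight m (suc i) ≡ weight m i + increment (m ℕ.+ suc i) m (suc i)
  weight-suc m i = begin
    node (m ℕ.+ suc i) m (suc i)
      ≡⟨ cong (λ t → node t m (suc i)) (ℕ.+-suc m i) ⟩
    fromℕ 2 * (- 1ℚ * s) * pochhammer (a - I) (suc i) * cube (R * (a + N)) * K′ * (F * F) * M * G * A * D
      ≡⟨ cong (λ t → fromℕ 2 * (- 1ℚ * s) * t * cube (R * (a + N)) * K′ * (F * F) * M * G * A * D) (pochhammer-sub a i) ⟩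
    fromℕ 2 * (- 1ℚ * s) * ((a - I) * Q) * cube (R * (a + N)) * K′ * (F * F) * M * G * A * D
      ≡⟨ rearrange s (a - I) Q R (a + N) K′ F M G A D ⟩
    - 1ℚ * s * Q * cube R * (F * F) * M * G * D * (fromℕ 2 * (a - I) * ((a + N) * (a + N)) * ((a + N) * K′) * A)
      ≡⟨ cong₂ (λ t u → - 1ℚ * s * Q * cube R * (F * F) * M * G * D * (fromℕ 2 * (a - t) * ((a + N) * (a + N)) * u * A)) I≡ shift ⟩
    - 1ℚ * s * Q * cube R * (F * F) * M * G * D * (fromℕ 2 * (a - (N - μ)) * ((a + N) * (a + N)) * (K * (a + N + μ)) * A)
      -- Without the common factors this reads -(a - N + μ)(a + N)²(a + N + μ) = N²(N - μ)(2a + μ +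
      -- N) - a (a + 2N)(a + μ)².
      ≡⟨ key s Q R K F M G A D a N μ ⟩
    fromℕ 2 * s * Q * cube R * K * (N * F * (N * F)) * M * ((N - μ) * G) * A * ((a + a + μ + N) * D)
      + - 1ℚ * s * (a + fromℕ 2 * N) * cube R * (F * F) * (fromℕ 2 * ((a + μ) * ((a + μ) * A)) * K * (Q * a) * M * G * D)
      ≡⟨ cong₂ (λ t u → fromℕ 2 * s * Q * cube R * K * (t * t) * M * ((N - μ) * G) * A * u
           + - 1ℚ * s * (a + fromℕ 2 * N) * cube R * (F * F) * (fromℕ 2 * ((a + μ) * ((a + μ) * A)) * K * (Q * a) * M * G * D))
           (sym (invFact-suc n)) (sym (invPoch-suc (a + a + μ) (suc n) nonzero)) ⟩
    fromℕ 2 * s * Q * cube R * K * (invFact n * invFact n) * M * ((N - μ) * G) * A * invPoch (a + a + μ) (suc n)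
      + - 1ℚ * s * (a + fromℕ 2 * N) * cube R * (F * F) * (fromℕ 2 * ((a + μ) * ((a + μ) * A)) * K * (Q * a) * M * G * D)
      ≡⟨ cong₂ (λ t u → fromℕ 2 * s * Q * cube R * K * (invFact n * invFact n) * M * t * A * invPoch (a + a + μ) (suc n)
           + - 1ℚ * s * (a + fromℕ 2 * N) * cube R * (F * F) * (fromℕ 2 * u * K * (Q * a) * M * G * D))
           (trans (cong (_* G) (sym I≡)) (sym (invFact-suc i))) (x*x*recip (a≢0 m)) ⟩
    weight m i + - 1ℚ * s * (a + fromℕ 2 * N) * cube R * (F * F) * (fromℕ 2 * (a + μ) * K * (Q * a) * M * G * D)
      ≡⟨ cong₂ (λ t u → weight m i + - 1ℚ * s * (a + fromℕ 2 * N) * cube R * (F * F) * (t * K * u * M * G * D))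
           (double a μ) upper ⟩
    weight m i + - 1ℚ * s * (a + fromℕ 2 * N) * cube R * (F * F) * ((a + a + fromℕ 2 * μ) * K * pochhammer (1ℚ + a - N + μ) (suc i) * M * G * D)
      ≡⟨ cong (λ t → weight m i + - 1ℚ * s * (a + fromℕ 2 * N) * cube R * (F * F)
           * ((a + a + fromℕ 2 * μ) * K * pochhammer (1ℚ + a - N + μ) (suc i) * M * G * invPoch (a + a + μ) (suc t))) (ℕ.+-suc m i) ⟨
    weight m i + increment (suc n) m (suc i)
      ≡⟨ cong (λ t → weight m i + increment t m (suc i)) (ℕ.+-suc m i) ⟨
    weight m i + increment (m ℕ.+ suc i) m (suc i) ∎
    where
    n = m ℕ.+ i
    s = (- 1ℚ) ^ n
    N = fromℕ (suc n)
    μ = fromℕ m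
    I = fromℕ (suc i)
    Q = pochhammer (a - fromℕ i) i
    R = pochhammer a (suc n)
    K = pochhammer (a + N) m
    K′ = pochhammer (a + fromℕ (suc (suc n))) m
    F = invFact (suc n)
    M = invFact m
    G = invFact (suc i)
    A = recip (a + μ)
    D = invPoch (a + a + μ) (suc (suc n))
    I≡ : I ≡ N - μ
    I≡ = begin
      fromℕ (suc i)                          ≡⟨ cancel (fromℕ (suc i)) μ ⟩
      fromℕ (suc i) + fromℕ m - fromℕ m      ≡⟨ cong (_- μ) (fromℕ-+ (suc i) m) ⟨
      fromℕ (suc (i ℕ.+ m)) - fromℕ m        ≡⟨ cong (λ t → fromℕ (suc t) - μ) (ℕ.+-comm i m) ⟩
      N - μ                                  ∎
      where
      cancel : ∀ x y → x ≡ x + y - y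
      cancel = solve-∀ ringℚ
    nonzero : a + a + μ + N ≢ 0ℚ
    nonzero = subst (_≢ 0ℚ) (trans (cong (a + a +_) (fromℕ-+ m (suc n))) (sym (+-assoc (a + a) μ N))) (2a≢0 (m ℕ.+ suc n))
    upper : Q * a ≡ pochhammer (1ℚ + a - N + μ) (suc i)
    upper = trans (cong (Q *_) (cancel a (fromℕ i))) (cong (λ t → pochhammer t (suc i)) (begin
      a - fromℕ i                ≡⟨ expand a (fromℕ i) ⟩
      1ℚ + a - (1ℚ + fromℕ i)    ≡⟨ cong (λ t → 1ℚ + a - t) (fromℕ-suc i) ⟨
      1ℚ + a - I                 ≡⟨ cong (λ t → 1ℚ + a - t) I≡ ⟩
      1ℚ + a - (N - μ)           ≡⟨ regroup a N μ ⟩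
      1ℚ + a - N + μ             ∎))
      where
      cancel : ∀ a i → a ≡ a - i + i
      cancel = solve-∀ ringℚ
      expand : ∀ a i → a - i ≡ 1ℚ + a - (1ℚ + i)
      expand = solve-∀ ringℚ
      regroup : ∀ a N μ → 1ℚ + a - (N - μ) ≡ 1ℚ + a - N + μ
      regroup = solve-∀ ringℚ
    shift : (a + N) * K′ ≡ K * (a + N + μ)
    shift = trans (cong (λ t → (a + N) * pochhammer t m) (trans (sym (fromℕ-shift a (suc n))) (swap a N))) (sym (pochhammer-left (a + N) m))
      where
      swap : ∀ a n → a + 1ℚ + n ≡ a + n + 1ℚ
      swap = solve-∀ ringℚ
    double : ∀ a μ → fromℕ 2 * (a + μ) ≡ a + a + fromℕ 2 * μ
    double = solve-∀ ringℚ
    rearrange : ∀ s z Q R x K F M G A D → fromℕ 2 * (- 1ℚ * s) * (z * Q) * (R * x * (R * x) * (R * x)) * K * (F * F) * M * G * A * D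
      ≡ - 1ℚ * s * Q * (R * R * R) * (F * F) * M * G * D * (fromℕ 2 * z * (x * x) * (x * K) * A)
    rearrange = solve-∀ ringℚ
    key : ∀ s Q R K F M G A D a N μ →
      - 1ℚ * s * Q * (R * R * R) * (F * F) * M * G * D * (fromℕ 2 * (a - (N - μ)) * ((a + N) * (a + N)) * (K * (a + N + μ)) * A)
      ≡ fromℕ 2 * s * Q * (R * R * R) * K * (N * F * (N * F)) * M * ((N - μ) * G) * A * ((a + a + μ + N) * D)
      + - 1ℚ * s * (a + fromℕ 2 * N) * (R * R * R) * (F * F) * (fromℕ 2 * ((a + μ) * ((a + μ) * A)) * K * (Q * a) * M * G * D)
    key = solve-∀ ringℚ

  -- The double sum of all shares read in two ways: for a fixed term the shares add up by
  -- `Δ-increment`, for a fixed node they telescope by `weight-suc`.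
  Δ-term : ∀ n → Δ n (λ k _ → term k) ≡ Δ n weight
  Δ-term zero    = trans (sym (Δ-increment 0)) (sym (weight-zero 0))
  Δ-term (suc n) = begin
    Δ (suc n) (λ k _ → term k)
      ≡⟨ Δ-last n (λ k _ → term k) ⟩
    term (suc n) + Δ n (λ k _ → term k)
      ≡⟨ cong₂ _+_ (trans (sym (Δ-increment (suc n))) (Δ-last n (increment (suc n)))) (Δ-term n) ⟩
    increment (suc n) (suc n) 0 + Δ n (λ m i → increment (suc n) m (suc i)) + Δ n weight
      ≡⟨ rearrange (increment (suc n) (suc n) 0) (Δ n (λ m i → increment (suc n) m (suc i))) (Δ n weight) ⟩
    increment (suc n) (suc n) 0 + (Δ n weight + Δ n (λ m i → increment (suc n) m (suc i)))
      ≡⟨ cong (λ t → increment (suc n) (suc n) 0 + t) (Δ-+ n weight (λ m i → increment (suc n) m (suc i))) ⟨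
    increment (suc n) (suc n) 0 + Δ n (λ m i → weight m i + increment (suc n) m (suc i))
      ≡⟨ cong₂ _+_ (sym (weight-zero (suc n))) (Δ-cong n step) ⟩
    weight (suc n) 0 + Δ n (λ m i → weight m (suc i))
      ≡⟨ Δ-last n weight ⟨
    Δ (suc n) weight ∎
    where
    step : ∀ m i → m ℕ.+ i ≡ n → weight m i + increment (suc n) m (suc i) ≡ weight m (suc i)
    step m i refl = sym (trans (weight-suc m i) (cong (λ t → weight m i + increment t m (suc i)) (ℕ.+-suc m i)))
    rearrange : ∀ x y z → x + y + z ≡ x + (z + y)
    rearrange = solve-∀ ringℚ

  -- The ratio of neighbouring products, left cross-multiplied because for a = 1/3 factors on either
  -- side may be divisible by p; each use divides only by what is known to be invertible there.
  node-step : ∀ n m i →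
    (a + fromℕ (suc m)) * fromℕ (suc m) * (a + a + fromℕ m + fromℕ (suc n)) * (fromℕ (suc i) - a) * node n (suc m) i
      ≡ - ((a + fromℕ m) * (a + fromℕ (suc n) + fromℕ m) * fromℕ (suc i) * (a + a + fromℕ m) * node n m (suc i))
  node-step n m i = begin
    x′ * M * (α + N) * (I - a) * (fromℕ 2 * s * Q * R * (K * (a + N + μ)) * FF * invFact (suc m) * invFact i * recip x′ * invPoch (a + a + M) (suc n))
      ≡⟨ rearrange x′ M (α + N) I a s Q R K (a + N + μ) FF (invFact (suc m)) (invFact i) (recip x′) (invPoch (a + a + M) (suc n)) ⟩
    - (fromℕ 2 * s * ((a - I) * Q) * R * K * (a + N + μ) * FF * (M * invFact (suc m)) * invFact i * (x′ * recip x′) * ((α + N) * invPoch (a + a + M) (suc n)))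
      ≡⟨ cong₂ (λ t u → - (fromℕ 2 * s * ((a - I) * Q) * R * K * (a + N + μ) * FF * t * u * (x′ * recip x′) * ((α + N) * invPoch (a + a + M) (suc n))))
           (sym (invFact-suc m)) (invFact-suc i) ⟩
    - (fromℕ 2 * s * ((a - I) * Q) * R * K * (a + N + μ) * FF * invFact m * (I * invFact (suc i)) * (x′ * recip x′) * ((α + N) * invPoch (a + a + M) (suc n)))
      ≡⟨ cong₂ (λ t u → - (fromℕ 2 * s * ((a - I) * Q) * R * K * (a + N + μ) * FF * invFact m * (I * invFact (suc i)) * t * u))
           (trans (recip-inverseʳ (a≢0 (suc m))) (sym (recip-inverseʳ (a≢0 m)))) shift ⟩
    - (fromℕ 2 * s * ((a - I) * Q) * R * K * (a + N + μ) * FF * invFact m * (I * invFact (suc i)) * (x * recip x) * (α * invPoch α (suc n)))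
      ≡⟨ cong (λ t → - (fromℕ 2 * s * t * R * K * (a + N + μ) * FF * invFact m * (I * invFact (suc i)) * (x * recip x) * (α * invPoch α (suc n)))) (pochhammer-sub a i) ⟨
    - (fromℕ 2 * s * pochhammer (a - I) (suc i) * R * K * (a + N + μ) * FF * invFact m * (I * invFact (suc i)) * (x * recip x) * (α * invPoch α (suc n)))
      ≡⟨ rearrange′ x (a + N + μ) I α s (pochhammer (a - I) (suc i)) R K FF (invFact m) (invFact (suc i)) (recip x) (invPoch α (suc n)) ⟩
    - (x * (a + N + μ) * I * α * node n m (suc i)) ∎
    where
    s = (- 1ℚ) ^ n
    μ = fromℕ m
    M = fromℕ (suc m)
    N = fromℕ (suc n)
    I = fromℕ (suc i)
    x = a + μ
    x′ = a + M
    α = a + a + μ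
    Q = pochhammer (a - fromℕ i) i
    R = cube (pochhammer a (suc n))
    K = pochhammer (a + N) m
    FF = invFact n * invFact n
    shift : (α + N) * invPoch (a + a + M) (suc n) ≡ α * invPoch α (suc n)
    shift = begin
      (α + N) * invPoch (a + a + M) (suc n)
        ≡⟨ cong (λ t → (α + N) * invPoch t (suc n)) (trans (cong (a + a +_) (trans (fromℕ-suc m) (+-comm 1ℚ μ))) (sym (+-assoc (a + a) μ 1ℚ))) ⟩
      (α + N) * invPoch (α + 1ℚ) (suc n)
        ≡⟨ cong ((α + N) *_) (invPoch-left α (suc n) (2a≢0 m)) ⟩
      (α + N) * (α * invPoch α (suc (suc n)))
        ≡⟨ swap (α + N) α (invPoch α (suc (suc n))) ⟩
      α * ((α + N) * invPoch α (suc (suc n)))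
        ≡⟨ cong (α *_) (invPoch-suc α (suc n) nonzero) ⟨
      α * invPoch α (suc n) ∎
      where
      swap : ∀ x y z → x * (y * z) ≡ y * (x * z)
      swap = solve-∀ ringℚ
      nonzero : α + N ≢ 0ℚ
      nonzero = subst (_≢ 0ℚ) (trans (cong (a + a +_) (fromℕ-+ m (suc n))) (sym (+-assoc (a + a) μ N))) (2a≢0 (m ℕ.+ suc n))
    rearrange : ∀ x M β I a s Q R K k FF F G A D → x * M * β * (I - a) * (fromℕ 2 * s * Q * R * (K * k) * FF * F * G * A * D)
      ≡ - (fromℕ 2 * s * ((a - I) * Q) * R * K * k * FF * (M * F) * G * (x * A) * (β * D))
    rearrange = solve-∀ ringℚ
    rearrange′ : ∀ x k I α s Q R K FF F G A D → - (fromℕ 2 * s * Q * R * K * k * FF * F * (I * G) * (x * A) * (α * D))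
      ≡ - (x * k * I * α * (fromℕ 2 * s * Q * R * K * FF * F * G * A * D))
    rearrange′ = solve-∀ ringℚ

  -- In terms of y = a + n the last product consists of the factors y ± j and 2y - j only. For y =
  -- 2p/3 these can be compared modulo powers of y.
  node-diagonal : ∀ n y → a + fromℕ n ≡ y →
    descending (fromℕ 2 * y) n * cube (fromℕ (n !)) * node n n 0
      ≡ (- 1ℚ) ^ n * y * (cube (descending y n) * pochhammer (y + 1ℚ) n)
  node-diagonal n y refl = begin
    D * cube f * (fromℕ 2 * s * 1ℚ * cube (pochhammer a n * y) * pochhammer (a + fromℕ (suc n)) n * (F * F) * F * invFact 0 * recip y * invPoch (a + a + fromℕ n) (suc n))
      ≡⟨ cong₂ (λ t u → D * cube f * (fromℕ 2 * s * 1ℚ * cube (t * y) * u * (F * F) * F * invFact 0 * recip y * invPoch (a + a + fromℕ n) (suc n)))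
           (trans (cong (λ t → pochhammer t n) (cancel a (fromℕ n))) (pochhammer-descending y n))
           (cong (λ t → pochhammer t n) (trans (sym (fromℕ-shift a n)) (swap a (fromℕ n)))) ⟩
    D * cube f * (fromℕ 2 * s * 1ℚ * cube (R * y) * S * (F * F) * F * invFact 0 * recip y * invPoch (a + a + fromℕ n) (suc n))
      ≡⟨ cong₂ (λ t u → D * cube f * (fromℕ 2 * s * 1ℚ * cube (R * y) * S * (F * F) * F * t * recip y * u)) invFact-zero (cong recip product) ⟩
    D * cube f * (fromℕ 2 * s * 1ℚ * cube (R * y) * S * (F * F) * F * 1ℚ * recip y * recip (D * (fromℕ 2 * y)))
      ≡⟨ rearrange D f s R y S F (recip y) (recip (D * (fromℕ 2 * y))) ⟩
    s * y * (cube R * S) * cube (f * F) * (y * recip y) * (D * (fromℕ 2 * y) * recip (D * (fromℕ 2 * y)))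
      ≡⟨ cong₂ (λ t u → s * y * (cube R * S) * cube t * u * (D * (fromℕ 2 * y) * recip (D * (fromℕ 2 * y)))) (recip-inverseʳ (fromℕ≢0 (n !) {{ℕ._!≢0 n}})) (recip-inverseʳ (a≢0 n)) ⟩
    s * y * (cube R * S) * cube 1ℚ * 1ℚ * (D * (fromℕ 2 * y) * recip (D * (fromℕ 2 * y)))
      ≡⟨ cong (λ t → s * y * (cube R * S) * cube 1ℚ * 1ℚ * t) (recip-inverseʳ (subst (_≢ 0ℚ) product product≢0)) ⟩
    s * y * (cube R * S) * cube 1ℚ * 1ℚ * 1ℚ
      ≡⟨ units (s * y * (cube R * S)) ⟩
    s * y * (cube R * S) ∎
    where
    s = (- 1ℚ) ^ n
    f = fromℕ (n !)
    F = invFact n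
    D = descending (fromℕ 2 * y) n
    R = descending y n
    S = pochhammer (y + 1ℚ) n
    cancel : ∀ a n → a ≡ a + n - n
    cancel = solve-∀ ringℚ
    swap : ∀ a n → a + 1ℚ + n ≡ a + n + 1ℚ
    swap = solve-∀ ringℚ
    units : ∀ x → x * (1ℚ * 1ℚ * 1ℚ) * 1ℚ * 1ℚ ≡ x
    units = solve-∀ ringℚ
    product≢0 : pochhammer (a + a + fromℕ n) (suc n) ≢ 0ℚ
    product≢0 = pochhammer-≢0 (a + a + fromℕ n) (suc n)
      (λ j → subst (_≢ 0ℚ) (trans (cong (a + a +_) (fromℕ-+ n j)) (sym (+-assoc (a + a) (fromℕ n) (fromℕ j)))) (2a≢0 (n ℕ.+ j)))
    product : pochhammer (a + a + fromℕ n) (suc n) ≡ D * (fromℕ 2 * y)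
    product = cong₂ _*_ (trans (cong (λ t → pochhammer t n) (low a (fromℕ n))) (pochhammer-descending (fromℕ 2 * y) n)) (high a (fromℕ n))
      where
      low : ∀ a n → a + a + n ≡ fromℕ 2 * (a + n) - n
      low = solve-∀ ringℚ
      high : ∀ a n → a + a + n + n ≡ fromℕ 2 * (a + n)
      high = solve-∀ ringℚ
    rearrange : ∀ D f s R y S F A B → D * (f * f * f) * (fromℕ 2 * s * 1ℚ * (R * y * (R * y) * (R * y)) * S * (F * F) * F * 1ℚ * A * B)
      ≡ s * y * (R * R * R * S) * (f * F * (f * F) * (f * F)) * (y * A) * (D * (fromℕ 2 * y) * B)
    rearrange = solve-∀ ringℚ

-- Euler polynomials: difference equation and alternating power sums.

-- Coefficientwise this is e^{xt} e^{yt} = e^{(x+y)t}. Multiplication by n + 1 = m + k acts as d/dt,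
-- and both sides solve f′ = (x + y) f.
Δ-binomial : ∀ n x y → Δ n (λ m k → (x ^ m * invFact m) * (y ^ k * invFact k)) ≡ (x + y) ^ n * invFact n
Δ-binomial zero    x y = trans (cong (λ t → (1ℚ * t) * (1ℚ * invFact 0)) invFact-zero) (drop (invFact 0))
  where
  drop : ∀ F → (1ℚ * 1ℚ) * (1ℚ * F) ≡ 1ℚ * F
  drop = solve-∀ ringℚ
Δ-binomial (suc n) x y = *-cancelˡ-≡ (fromℕ≢0 (suc n)) (begin
  N * Δ (suc n) v
    ≡⟨ Δ-*ˡ (suc n) N v ⟨
  Δ (suc n) (λ m k → N * v m k)
    ≡⟨ Δ-cong (suc n) (λ m k e → trans (cong (_* v m k) (trans (cong fromℕ (sym e)) (fromℕ-+ m k))) (*-distribʳ-+ (v m k) (fromℕ m) (fromℕ k))) ⟩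
  Δ (suc n) (λ m k → fromℕ m * v m k + fromℕ k * v m k)
    ≡⟨ Δ-+ (suc n) (λ m k → fromℕ m * v m k) (λ m k → fromℕ k * v m k) ⟩
  0ℚ * v 0 (suc n) + Δ n (λ m k → fromℕ (suc m) * v (suc m) k) + Δ (suc n) (λ m k → fromℕ k * v m k)
    ≡⟨ cong (λ t → 0ℚ * v 0 (suc n) + Δ n (λ m k → fromℕ (suc m) * v (suc m) k) + t) (Δ-last n (λ m k → fromℕ k * v m k)) ⟩
  0ℚ * v 0 (suc n) + Δ n (λ m k → fromℕ (suc m) * v (suc m) k) + (0ℚ * v (suc n) 0 + Δ n (λ m k → fromℕ (suc k) * v m (suc k)))
    ≡⟨ drop (v 0 (suc n)) (Δ n (λ m k → fromℕ (suc m) * v (suc m) k)) (v (suc n) 0) (Δ n (λ m k → fromℕ (suc k) * v m (suc k))) ⟩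
  Δ n (λ m k → fromℕ (suc m) * v (suc m) k) + Δ n (λ m k → fromℕ (suc k) * v m (suc k))
    ≡⟨ cong₂ _+_ (Δ-cong n left) (Δ-cong n right) ⟩
  Δ n (λ m k → x * v m k) + Δ n (λ m k → y * v m k)
    ≡⟨ cong₂ _+_ (Δ-*ˡ n x v) (Δ-*ˡ n y v) ⟩
  x * Δ n v + y * Δ n v
    ≡⟨ cong (λ t → x * t + y * t) (Δ-binomial n x y) ⟩
  x * ((x + y) ^ n * invFact n) + y * ((x + y) ^ n * invFact n)
    ≡⟨ cong (λ t → x * ((x + y) ^ n * t) + y * ((x + y) ^ n * t)) (invFact-suc n) ⟩
  x * ((x + y) ^ n * (N * invFact (suc n))) + y * ((x + y) ^ n * (N * invFact (suc n)))
    ≡⟨ collect x y ((x + y) ^ n) N (invFact (suc n)) ⟩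
  N * ((x + y) * (x + y) ^ n * invFact (suc n)) ∎)
  where
  N = fromℕ (suc n)
  v : ℕ → ℕ → ℚ
  v m k = (x ^ m * invFact m) * (y ^ k * invFact k)
  drop : ∀ p q r s → 0ℚ * p + q + (0ℚ * r + s) ≡ q + s
  drop = solve-∀ ringℚ
  collect : ∀ x y Z N F → x * (Z * (N * F)) + y * (Z * (N * F)) ≡ N * ((x + y) * Z * F)
  collect = solve-∀ ringℚ
  pull : ∀ s x X F t → s * (x * X * F * t) ≡ x * (X * (s * F) * t)
  pull = solve-∀ ringℚ
  pull′ : ∀ s x X F t → s * (t * (x * X * F)) ≡ x * (t * (X * (s * F)))
  pull′ = solve-∀ ringℚ
  left : ∀ m k → m ℕ.+ k ≡ n → fromℕ (suc m) * v (suc m) k ≡ x * v m k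
  left m k _ = trans (pull (fromℕ (suc m)) x (x ^ m) (invFact (suc m)) (y ^ k * invFact k))
    (cong (λ t → x * (x ^ m * t * (y ^ k * invFact k))) (sym (invFact-suc m)))
  right : ∀ m k → m ℕ.+ k ≡ n → fromℕ (suc k) * v m (suc k) ≡ y * v m k
  right m k _ = trans (pull′ (fromℕ (suc k)) y (y ^ k) (invFact (suc k)) (x ^ m * invFact m))
    (cong (λ t → y * (x ^ m * invFact m * (y ^ k * t))) (sym (invFact-suc k)))

⊛≡Δ : ∀ f g n → (f ⊛ g) n ≡ Δ n (λ m k → f m * g k)
⊛≡Δ f g n = convolution n (λ m k → f m * g k)
  where
  convolution : ∀ n h → ∑[ i ≤ n ] h (toℕ i) (n ∸ toℕ i) ≡ Δ n h
  convolution zero    h = +-identityʳ (h 0 0)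
  convolution (suc n) h = cong (λ t → h 0 (suc n) + t) (convolution n (h ∘ suc))

Δ-constant : ∀ n c (g : ℕ → ℚ) → Δ n (λ m k → constant c m * g k) ≡ c * g n
Δ-constant zero    c g = refl
Δ-constant (suc n) c g = begin
  c * g (suc n) + Δ n (λ m k → 0ℚ * g k)    ≡⟨ cong (λ t → c * g (suc n) + t) (Δ-*ˡ n 0ℚ (λ _ k → g k)) ⟩
  c * g (suc n) + 0ℚ * Δ n (λ _ k → g k)    ≡⟨ drop (c * g (suc n)) (Δ n (λ _ k → g k)) ⟩
  c * g (suc n)                             ∎
  where
  drop : ∀ x y → x + 0ℚ * y ≡ x
  drop = solve-∀ ringℚ

exp-coefficient : ∀ x n → exp x n ≡ x ^ n * invFact n
exp-coefficient x n = ÷-recip (x ^ n) (fromℕ (n !)) {{ℕ._!≢0 n}}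

1^ : ∀ n → 1ℚ ^ n ≡ 1ℚ
1^ zero    = refl
1^ (suc n) = trans (*-identityˡ (1ℚ ^ n)) (1^ n)

eulerSeries-recurrence : ∀ x n →
  Δ n (λ m k → eulerSeries x m * invFact k) + eulerSeries x n ≡ fromℕ 2 * (x ^ n * invFact n)
eulerSeries-recurrence x n = begin
  Δ n (λ m k → e m * invFact k) + e n
    ≡⟨ cong₂ _+_ (Δ-cong n (λ m k _ → cong (e m *_) (sym (exp-one k)))) (sym (trans (Δ-constant n 1ℚ e) (*-identityˡ (e n)))) ⟩
  Δ n (λ m k → e m * exp 1ℚ k) + Δ n (λ m k → constant 1ℚ m * e k)
    ≡⟨ cong (λ t → Δ n (λ m k → e m * exp 1ℚ k) + t) (trans (Δ-flip n (λ m k → constant 1ℚ m * e k)) (Δ-cong n (λ m k _ → *-comm (constant 1ℚ k) (e m)))) ⟩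
  Δ n (λ m k → e m * exp 1ℚ k) + Δ n (λ m k → e m * constant 1ℚ k)
    ≡⟨ Δ-+ n (λ m k → e m * exp 1ℚ k) (λ m k → e m * constant 1ℚ k) ⟨
  Δ n (λ m k → e m * exp 1ℚ k + e m * constant 1ℚ k)
    ≡⟨ Δ-cong n (λ m k _ → *-distribˡ-+ (e m) (exp 1ℚ k) (constant 1ℚ k)) ⟨
  Δ n (λ m k → e m * (exp 1ℚ ⊕ constant 1ℚ) k)
    ≡⟨ ⊛≡Δ e (exp 1ℚ ⊕ constant 1ℚ) n ⟨
  (e ⊛ (exp 1ℚ ⊕ constant 1ℚ)) n
    ≡⟨ eulerSeries-spec x n ⟩
  (constant (fromℕ 2) ⊛ exp x) n
    ≡⟨ trans (⊛≡Δ (constant (fromℕ 2)) (exp x) n) (Δ-constant n (fromℕ 2) (exp x)) ⟩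
  fromℕ 2 * exp x n
    ≡⟨ cong (fromℕ 2 *_) (exp-coefficient x n) ⟩
  fromℕ 2 * (x ^ n * invFact n) ∎
  where
  e = eulerSeries x
  exp-one : ∀ k → exp 1ℚ k ≡ invFact k
  exp-one k = trans (exp-coefficient 1ℚ k) (trans (cong (_* invFact k) (1^ k)) (*-identityˡ (invFact k)))

2≢0 : fromℕ 2 ≢ 0ℚ
2≢0 ()

-- The newest coefficient occurs twice in the product with e^t + 1, once for each summand. Solving
-- for it divides by 2 only, which is harmless modulo an odd prime.
doubled-coefficient : ∀ n (f : ℕ → ℚ) → Δ (suc n) (λ m k → f m * invFact k) + f (suc n)
  ≡ fromℕ 2 * f (suc n) + Δ n (λ m k → f m * invFact (suc k))
doubled-coefficient n f = trans (cong (_+ f (suc n)) (trans (Δ-last n (λ m k → f m * invFact k))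
  (cong (λ t → f (suc n) * t + Δ n (λ m k → f m * invFact (suc k))) invFact-zero)))
  (regroup (f (suc n)) (Δ n (λ m k → f m * invFact (suc k))))
  where
  regroup : ∀ x y → x * 1ℚ + y + x ≡ fromℕ 2 * x + y
  regroup = solve-∀ ringℚ

doubled-coefficient-zero : ∀ (f : ℕ → ℚ) → Δ 0 (λ m k → f m * invFact k) + f 0 ≡ fromℕ 2 * f 0
doubled-coefficient-zero f = trans (cong (λ t → f 0 * t + f 0) invFact-zero) (regroup (f 0))
  where
  regroup : ∀ x → x * 1ℚ + x ≡ fromℕ 2 * x
  regroup = solve-∀ ringℚ

-- The series e^t + 1 has the nonzero constant term 2 and can therefore be cancelled.
recurrence-unique : ∀ (f g : ℕ → ℚ) →
  (∀ n → Δ n (λ m k → f m * invFact k) + f n ≡ Δ n (λ m k → g m * invFact k) + g n) → ∀ n → f n ≡ g n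
recurrence-unique f g same = <-rec (λ n → f n ≡ g n) step
  where
  step : ∀ n → (∀ {m} → m ℕ.< n → f m ≡ g m) → f n ≡ g n
  step zero    _  = *-cancelˡ-≡ 2≢0 (trans (sym (doubled-coefficient-zero f)) (trans (same 0) (doubled-coefficient-zero g)))
  step (suc n) ih = *-cancelˡ-≡ 2≢0 (begin
    fromℕ 2 * f (suc n)                                            ≡⟨ cancel (fromℕ 2 * f (suc n)) (tail f) ⟩
    fromℕ 2 * f (suc n) + tail f - tail f                          ≡⟨ cong₂ _-_ equal tails ⟩
    fromℕ 2 * g (suc n) + tail g - tail g                          ≡⟨ cancel (fromℕ 2 * g (suc n)) (tail g) ⟨
    fromℕ 2 * g (suc n)                                            ∎)
    where
    tail : (ℕ → ℚ) → ℚ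
    tail h = Δ n (λ m k → h m * invFact (suc k))
    equal : fromℕ 2 * f (suc n) + tail f ≡ fromℕ 2 * g (suc n) + tail g
    equal = trans (sym (doubled-coefficient n f)) (trans (same (suc n)) (doubled-coefficient n g))
    tails : tail f ≡ tail g
    tails = Δ-cong n (λ m k e → cong (_* invFact (suc k)) (ih (ℕ.s≤s (subst (m ℕ.≤_) e (ℕ.m≤m+n m k)))))
    cancel : ∀ x y → x ≡ x + y - y
    cancel = solve-∀ ringℚ

-- Write E for the series at `x`. Since E (e^t + 1) = 2e^{xt}, the series 2e^{xt} - E times e^t + 1
-- is 2e^{(x+1)t}, which is the relation that characterises the series at x + 1.
eulerSeries-+1 : ∀ x n → eulerSeries (x + 1ℚ) n ≡ fromℕ 2 * (x ^ n * invFact n) - eulerSeries x n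
eulerSeries-+1 x = recurrence-unique (eulerSeries (x + 1ℚ)) g (λ n → trans (eulerSeries-recurrence (x + 1ℚ) n) (sym (recurrence n)))
  where
  e g X : ℕ → ℚ
  e = eulerSeries x
  X n = x ^ n * invFact n
  g n = fromℕ 2 * X n - e n
  expand : ∀ X e F → (fromℕ 2 * X - e) * F ≡ fromℕ 2 * (X * F) + - 1ℚ * (e * F)
  expand = solve-∀ ringℚ
  regroup : ∀ B E X e → fromℕ 2 * B + - 1ℚ * E + (fromℕ 2 * X - e) ≡ fromℕ 2 * B + fromℕ 2 * X - (E + e)
  regroup = solve-∀ ringℚ
  cancel : ∀ B X → fromℕ 2 * B + X - X ≡ fromℕ 2 * B
  cancel = solve-∀ ringℚ
  binomial : ∀ n → Δ n (λ m k → X m * invFact k) ≡ (x + 1ℚ) ^ n * invFact n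
  binomial n = trans (Δ-cong n (λ m k _ → cong (X m *_) (sym (trans (cong (_* invFact k) (1^ k)) (*-identityˡ (invFact k)))))) (Δ-binomial n x 1ℚ)
  recurrence : ∀ n → Δ n (λ m k → g m * invFact k) + g n ≡ fromℕ 2 * ((x + 1ℚ) ^ n * invFact n)
  recurrence n = begin
    Δ n (λ m k → g m * invFact k) + g n
      ≡⟨ cong (_+ g n) (trans (Δ-cong n (λ m k _ → expand (X m) (e m) (invFact k))) (Δ-+ n (λ m k → fromℕ 2 * (X m * invFact k)) (λ m k → - 1ℚ * (e m * invFact k)))) ⟩
    Δ n (λ m k → fromℕ 2 * (X m * invFact k)) + Δ n (λ m k → - 1ℚ * (e m * invFact k)) + g n
      ≡⟨ cong₂ (λ t u → t + u + g n) (Δ-*ˡ n (fromℕ 2) (λ m k → X m * invFact k)) (Δ-*ˡ n (- 1ℚ) (λ m k → e m * invFact k)) ⟩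
    fromℕ 2 * Δ n (λ m k → X m * invFact k) + - 1ℚ * Δ n (λ m k → e m * invFact k) + g n
      ≡⟨ regroup (Δ n (λ m k → X m * invFact k)) (Δ n (λ m k → e m * invFact k)) (X n) (e n) ⟩
    fromℕ 2 * Δ n (λ m k → X m * invFact k) + fromℕ 2 * X n - (Δ n (λ m k → e m * invFact k) + e n)
      ≡⟨ cong₂ (λ t u → fromℕ 2 * t + fromℕ 2 * X n - u) (binomial n) (eulerSeries-recurrence x n) ⟩
    fromℕ 2 * ((x + 1ℚ) ^ n * invFact n) + fromℕ 2 * X n - fromℕ 2 * X n
      ≡⟨ cancel ((x + 1ℚ) ^ n * invFact n) (fromℕ 2 * X n) ⟩
    fromℕ 2 * ((x + 1ℚ) ^ n * invFact n) ∎

factorial*invFact : ∀ n → fromℕ (n !) * invFact n ≡ 1ℚ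
factorial*invFact n = recip-inverseʳ (fromℕ≢0 (n !) {{ℕ._!≢0 n}})

euler-+1 : ∀ n x → euler n x + euler n (x + 1ℚ) ≡ fromℕ 2 * x ^ n
euler-+1 n x = begin
  N * e + N * eulerSeries (x + 1ℚ) n                    ≡⟨ cong (λ t → N * e + N * t) (eulerSeries-+1 x n) ⟩
  N * e + N * (fromℕ 2 * (x ^ n * invFact n) - e)       ≡⟨ collect N e (x ^ n) (invFact n) ⟩
  fromℕ 2 * x ^ n * (N * invFact n)                     ≡⟨ cong (fromℕ 2 * x ^ n *_) (factorial*invFact n) ⟩
  fromℕ 2 * x ^ n * 1ℚ                                  ≡⟨ *-identityʳ (fromℕ 2 * x ^ n) ⟩
  fromℕ 2 * x ^ n                                       ∎
  where
  N = fromℕ (n !)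
  e = eulerSeries x n
  collect : ∀ N e X F → N * e + N * (fromℕ 2 * (X * F) - e) ≡ fromℕ 2 * X * (N * F)
  collect = solve-∀ ringℚ

-- By `euler-+1` each doubled power is a sum of two neighbouring Euler values, and the alternating
-- signs leave only the two ends.
Δ-alternating-powers : ∀ m n → fromℕ 2 * Δ n (λ j _ → (- 1ℚ) ^ j * fromℕ (suc j) ^ m)
  ≡ euler m 1ℚ + (- 1ℚ) ^ n * euler m (fromℕ (suc (suc n)))
Δ-alternating-powers m zero    = trans (rearrange (1ℚ ^ m)) (trans (sym (euler-+1 m 1ℚ)) (cong (λ t → euler m 1ℚ + t) (sym (*-identityˡ (euler m (fromℕ 2))))))
  where
  rearrange : ∀ x → fromℕ 2 * (1ℚ * x) ≡ fromℕ 2 * x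
  rearrange = solve-∀ ringℚ
Δ-alternating-powers m (suc n) = begin
  fromℕ 2 * Δ (suc n) h
    ≡⟨ cong (fromℕ 2 *_) (Δ-last n h) ⟩
  fromℕ 2 * (- 1ℚ * s * z ^ m + Δ n h)
    ≡⟨ regroup s (z ^ m) (Δ n h) ⟩
  - 1ℚ * s * (fromℕ 2 * z ^ m) + fromℕ 2 * Δ n h
    ≡⟨ cong₂ (λ t u → - 1ℚ * s * t + u) (sym (euler-+1 m z)) (Δ-alternating-powers m n) ⟩
  - 1ℚ * s * (euler m z + euler m (z + 1ℚ)) + (euler m 1ℚ + s * euler m z)
    ≡⟨ cancel s (euler m z) (euler m (z + 1ℚ)) (euler m 1ℚ) ⟩
  euler m 1ℚ + - 1ℚ * s * euler m (z + 1ℚ)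
    ≡⟨ cong (λ t → euler m 1ℚ + - 1ℚ * s * euler m t) (trans (+-comm z 1ℚ) (sym (fromℕ-suc (suc (suc n))))) ⟩
  euler m 1ℚ + - 1ℚ * s * euler m (fromℕ (suc (suc (suc n)))) ∎
  where
  h : ℕ → ℕ → ℚ
  h j _ = (- 1ℚ) ^ j * fromℕ (suc j) ^ m
  s = (- 1ℚ) ^ n
  z = fromℕ (suc (suc n))
  regroup : ∀ s x y → fromℕ 2 * (- 1ℚ * s * x + y) ≡ - 1ℚ * s * (fromℕ 2 * x) + fromℕ 2 * y
  regroup = solve-∀ ringℚ
  cancel : ∀ s x y z → - 1ℚ * s * (x + y) + (z + s * x) ≡ z + - 1ℚ * s * y
  cancel = solve-∀ ringℚ

-- The outer terms are set apart because the factorials in the middle have arguments below q + 2.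
-- When q + 2 is the prime p they are prime to p, and the middle inherits the factor p of p!.
binomial-ends : ∀ q x → (x + 1ℚ) ^ suc (suc q) ≡ x ^ suc (suc q) + 1ℚ
  + fromℕ (suc (suc q) !) * Δ q (λ m k → (x ^ suc m * invFact (suc m)) * (1ℚ ^ suc k * invFact (suc k)))
binomial-ends q x = begin
  (x + 1ℚ) ^ r
    ≡⟨ unscale ((x + 1ℚ) ^ r) ⟨
  N * ((x + 1ℚ) ^ r * invFact r)
    ≡⟨ cong (N *_) (Δ-binomial r x 1ℚ) ⟨
  N * ((1ℚ * invFact 0) * (1ℚ ^ r * invFact r) + Δ (suc q) (λ m k → v (suc m) k))
    ≡⟨ cong (λ t → N * ((1ℚ * invFact 0) * (1ℚ ^ r * invFact r) + t)) (Δ-last q (λ m k → v (suc m) k)) ⟩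
  N * ((1ℚ * invFact 0) * (1ℚ ^ r * invFact r) + ((x ^ r * invFact r) * (1ℚ * invFact 0) + middle))
    ≡⟨ cong₂ (λ t u → N * ((1ℚ * t) * (u * invFact r) + ((x ^ r * invFact r) * (1ℚ * t) + middle))) invFact-zero (1^ r) ⟩
  N * ((1ℚ * 1ℚ) * (1ℚ * invFact r) + ((x ^ r * invFact r) * (1ℚ * 1ℚ) + middle))
    ≡⟨ distribute N (invFact r) (x ^ r) middle ⟩
  N * (x ^ r * invFact r) + N * (1ℚ * invFact r) + N * middle
    ≡⟨ cong₂ (λ t u → t + u + N * middle) (unscale (x ^ r)) (unscale 1ℚ) ⟩
  x ^ r + 1ℚ + N * middle ∎
  where
  r = suc (suc q)
  N = fromℕ (r !)
  v : ℕ → ℕ → ℚ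
  v m k = (x ^ m * invFact m) * (1ℚ ^ k * invFact k)
  middle = Δ q (λ m k → v (suc m) (suc k))
  unscale : ∀ t → N * (t * invFact r) ≡ t
  unscale t = trans (swap N t (invFact r)) (trans (cong (t *_) (factorial*invFact r)) (*-identityʳ t))
    where
    swap : ∀ N t F → N * (t * F) ≡ t * (N * F)
    swap = solve-∀ ringℚ
  distribute : ∀ N F X Y → N * ((1ℚ * 1ℚ) * (1ℚ * F) + ((X * F) * (1ℚ * 1ℚ) + Y)) ≡ N * (X * F) + N * (1ℚ * F) + N * Y
  distribute = solve-∀ ringℚ

Δ-split : ∀ m n (f : ℕ → ℚ) → Δ (m ℕ.+ suc n) (λ j _ → f j) ≡ Δ m (λ j _ → f j) + Δ n (λ j _ → f (suc m ℕ.+ j))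
Δ-split zero    n f = refl
Δ-split (suc m) n f = trans (cong (λ t → f 0 + t) (Δ-split m n (f ∘ suc))) (sym (+-assoc (f 0) (Δ m (λ j _ → f (suc j))) (Δ n (λ j _ → f (suc (suc m) ℕ.+ j)))))

-- Rationals that are integral at p, and congruences between them.

module PAdic (p : ℕ) (p-prime : Prime p) where

  -- The fraction need not be in lowest terms, so sums and products require no reduction.
  -- `Coprime-denominator` returns to the reduced denominator.
  record Integral (z : ℚ) : Set where
    constructor integral
    field
      scale         : ℕ
      value         : ℤ
      p∤scale       : ¬ p ∣ scale
      scale*z≡value : fromℕ scale * z ≡ fromℤ value

  p∤1 : ¬ p ∣ 1
  p∤1 p∣1 = ℕ.nonTrivial⇒≢1 {{prime⇒nonTrivial p-prime}} (∣1⇒≡1 p∣1)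

  p∤* : ∀ {m n} → ¬ p ∣ m → ¬ p ∣ n → ¬ p ∣ m ℕ.* n
  p∤* {m} {n} p∤m p∤n p∣mn = [ p∤m , p∤n ]′ (euclidsLemma m n p-prime p∣mn)

  Integral-ℤ : ∀ k → Integral (fromℤ k)
  Integral-ℤ k = integral 1 k p∤1 (*-identityˡ (fromℤ k))

  Integral-ℕ : ∀ n → Integral (fromℕ n)
  Integral-ℕ n = Integral-ℤ (ℤ.+ n)

  Integral-neg : ∀ {x} → Integral x → Integral (- x)
  Integral-neg {x} (integral d k p∤d dx≡k) = integral d (ℤ.- k) p∤d (begin
    fromℕ d * - x    ≡⟨ neg-distribʳ-* (fromℕ d) x ⟨
    - (fromℕ d * x)  ≡⟨ cong (λ t → - t) dx≡k ⟩
    - fromℤ k        ≡⟨ fromℤ-neg k ⟨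
    fromℤ (ℤ.- k)    ∎)

  Integral-* : ∀ {x y} → Integral x → Integral y → Integral (x * y)
  Integral-* {x} {y} (integral d k p∤d dx≡k) (integral e l p∤e ey≡l) = integral (d ℕ.* e) (k ℤ.* l) (p∤* p∤d p∤e) (begin
    fromℕ (d ℕ.* e) * (x * y)        ≡⟨ cong (_* (x * y)) (fromℕ-* d e) ⟩
    fromℕ d * fromℕ e * (x * y)      ≡⟨ interchange (fromℕ d) (fromℕ e) x y ⟩
    (fromℕ d * x) * (fromℕ e * y)    ≡⟨ cong₂ _*_ dx≡k ey≡l ⟩
    fromℤ k * fromℤ l                ≡⟨ fromℤ-* k l ⟨
    fromℤ (k ℤ.* l)                  ∎)
    where
    interchange : ∀ d e x y → d * e * (x * y) ≡ (d * x) * (e * y)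
    interchange = solve-∀ ringℚ

  Integral-+ : ∀ {x y} → Integral x → Integral y → Integral (x + y)
  Integral-+ {x} {y} (integral d k p∤d dx≡k) (integral e l p∤e ey≡l) =
    integral (d ℕ.* e) (ℤ.+ e ℤ.* k ℤ.+ ℤ.+ d ℤ.* l) (p∤* p∤d p∤e) (begin
    fromℕ (d ℕ.* e) * (x + y)                              ≡⟨ cong (_* (x + y)) (fromℕ-* d e) ⟩
    fromℕ d * fromℕ e * (x + y)                            ≡⟨ distribute (fromℕ d) (fromℕ e) x y ⟩
    fromℕ e * (fromℕ d * x) + fromℕ d * (fromℕ e * y)      ≡⟨ cong₂ (λ t u → fromℕ e * t + fromℕ d * u) dx≡k ey≡l ⟩
    fromℕ e * fromℤ k + fromℕ d * fromℤ l                  ≡⟨ cong₂ _+_ (fromℤ-* (ℤ.+ e) k) (fromℤ-* (ℤ.+ d) l) ⟨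
    fromℤ (ℤ.+ e ℤ.* k) + fromℤ (ℤ.+ d ℤ.* l)              ≡⟨ fromℤ-+ (ℤ.+ e ℤ.* k) (ℤ.+ d ℤ.* l) ⟨
    fromℤ (ℤ.+ e ℤ.* k ℤ.+ ℤ.+ d ℤ.* l)                    ∎)
    where
    distribute : ∀ d e x y → d * e * (x + y) ≡ e * (d * x) + d * (e * y)
    distribute = solve-∀ ringℚ

  Integral-^ : ∀ {x} n → Integral x → Integral (x ^ n)
  Integral-^ zero    ix = Integral-ℕ 1
  Integral-^ (suc n) ix = Integral-* ix (Integral-^ n ix)

  Integral-Δ : ∀ n {f} → (∀ m k → m ℕ.+ k ≡ n → Integral (f m k)) → Integral (Δ n f)
  Integral-Δ zero    if = if 0 0 refl
  Integral-Δ (suc n) if = Integral-+ (if 0 (suc n) refl) (Integral-Δ n (λ m k e → if (suc m) k (cong suc e)))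

  infix 4 _≋_[_]
  -- The modulus may be any rational, such as `y * cube y`, and neither side has to be integral.
  -- Hence a factor can be moved from both sides into the modulus by `≋-scale`.
  record _≋_[_] (x y M : ℚ) : Set where
    constructor congruent
    field
      cofactor   : ℚ
      isIntegral : Integral cofactor
      difference : x - y ≡ M * cofactor

  ≋-reflexive : ∀ {x y M} → x ≡ y → x ≋ y [ M ]
  ≋-reflexive {x} {M = M} refl = congruent 0ℚ (Integral-ℕ 0) (trans (+-inverseʳ x) (sym (*-zeroʳ M)))

  ≋-refl : ∀ {x M} → x ≋ x [ M ]
  ≋-refl = ≋-reflexive refl

  ≋-sym : ∀ {x y M} → x ≋ y [ M ] → y ≋ x [ M ]
  ≋-sym {x} {y} {M} (congruent z iz e) = congruent (- z) (Integral-neg iz) (begin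
    y - x        ≡⟨ flip-sub x y ⟩
    - (x - y)    ≡⟨ cong (λ t → - t) e ⟩
    - (M * z)    ≡⟨ neg-distribʳ-* M z ⟩
    M * - z      ∎)
    where
    flip-sub : ∀ x y → y - x ≡ - (x - y)
    flip-sub = solve-∀ ringℚ

  ≋-trans : ∀ {x y t M} → x ≋ y [ M ] → y ≋ t [ M ] → x ≋ t [ M ]
  ≋-trans {x} {y} {t} {M} (congruent z iz e) (congruent w iw f) = congruent (z + w) (Integral-+ iz iw) (begin
    x - t              ≡⟨ telescope x y t ⟩
    (x - y) + (y - t)  ≡⟨ cong₂ _+_ e f ⟩
    M * z + M * w      ≡⟨ *-distribˡ-+ M z w ⟨
    M * (z + w)        ∎)
    where
    telescope : ∀ x y t → x - t ≡ (x - y) + (y - t)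
    telescope = solve-∀ ringℚ

  ≋-+ : ∀ {x y t u M} → x ≋ y [ M ] → t ≋ u [ M ] → x + t ≋ y + u [ M ]
  ≋-+ {x} {y} {t} {u} {M} (congruent z iz e) (congruent w iw f) = congruent (z + w) (Integral-+ iz iw) (begin
    x + t - (y + u)    ≡⟨ regroup x y t u ⟩
    (x - y) + (t - u)  ≡⟨ cong₂ _+_ e f ⟩
    M * z + M * w      ≡⟨ *-distribˡ-+ M z w ⟨
    M * (z + w)        ∎)
    where
    regroup : ∀ x y t u → x + t - (y + u) ≡ (x - y) + (t - u)
    regroup = solve-∀ ringℚ

  ≋-scale : ∀ {x y M} c → x ≋ y [ M ] → c * x ≋ c * y [ c * M ]
  ≋-scale {x} {y} {M} c (congruent z iz e) = congruent z iz (begin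
    c * x - c * y  ≡⟨ factor c x y ⟩
    c * (x - y)    ≡⟨ cong (c *_) e ⟩
    c * (M * z)    ≡⟨ *-assoc c M z ⟨
    c * M * z      ∎)
    where
    factor : ∀ c x y → c * x - c * y ≡ c * (x - y)
    factor = solve-∀ ringℚ

  ≋-weaken : ∀ {x y c M} → Integral c → x ≋ y [ c * M ] → x ≋ y [ M ]
  ≋-weaken {c = c} {M} ic (congruent z iz e) = congruent (c * z) (Integral-* ic iz)
    (trans e (trans (cong (_* z) (*-comm c M)) (*-assoc M c z)))

  ≋-*ˡ : ∀ {c x y M} → Integral c → x ≋ y [ M ] → c * x ≋ c * y [ M ]
  ≋-*ˡ {c} ic x≋y = ≋-weaken ic (≋-scale c x≋y)

  ≋-*ʳ : ∀ {c x y M} → Integral c → x ≋ y [ M ] → x * c ≋ y * c [ M ]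
  ≋-*ʳ {c} {x} {y} ic x≋y = subst₂ (λ s t → s ≋ t [ _ ]) (*-comm c x) (*-comm c y) (≋-*ˡ ic x≋y)

  ≋-* : ∀ {x y t u M} → Integral x → Integral u → x ≋ y [ M ] → t ≋ u [ M ] → x * t ≋ y * u [ M ]
  ≋-* ix iu x≋y t≋u = ≋-trans (≋-*ˡ ix t≋u) (≋-*ʳ iu x≋y)

  ≋-neg : ∀ {x y M} → x ≋ y [ M ] → - x ≋ - y [ M ]
  ≋-neg {x} {y} {M} (congruent z iz e) = congruent (- z) (Integral-neg iz) (begin
    - x - - y    ≡⟨ neg-sub x y ⟩
    - (x - y)    ≡⟨ cong (λ t → - t) e ⟩
    - (M * z)    ≡⟨ neg-distribʳ-* M z ⟩
    M * - z      ∎)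
    where
    neg-sub : ∀ x y → - x - - y ≡ - (x - y)
    neg-sub = solve-∀ ringℚ

  ≋-^ : ∀ {x y M} n → Integral x → Integral y → x ≋ y [ M ] → x ^ n ≋ y ^ n [ M ]
  ≋-^ zero    ix iy x≋y = ≋-refl
  ≋-^ (suc n) ix iy x≋y = ≋-* ix (Integral-^ n iy) x≋y (≋-^ n ix iy x≋y)

  ≋-Δ : ∀ n {f g M} → (∀ m k → m ℕ.+ k ≡ n → f m k ≋ g m k [ M ]) → Δ n f ≋ Δ n g [ M ]
  ≋-Δ zero    f≋g = f≋g 0 0 refl
  ≋-Δ (suc n) f≋g = ≋-+ (f≋g 0 (suc n) refl) (≋-Δ n (λ m k e → f≋g (suc m) k (cong suc e)))

  record Unit (u : ℚ) : Set where
    constructor unit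
    field
      inverse    : ℚ
      isIntegral : Integral inverse
      inverse*u  : inverse * u ≡ 1ℚ

  Unit-* : ∀ {x y} → Unit x → Unit y → Unit (x * y)
  Unit-* {x} {y} (unit v iv e) (unit w iw f) = unit (v * w) (Integral-* iv iw)
    (trans (interchange v w x y) (cong₂ _*_ e f))
    where
    interchange : ∀ v w x y → v * w * (x * y) ≡ (v * x) * (w * y)
    interchange = solve-∀ ringℚ

  Unit-ℤ : ∀ k → ¬ p ∣ ℤ.∣ k ∣ → Unit (fromℤ k)
  Unit-ℤ k p∤k = unit (recip (fromℤ k)) (inverse-integral k p∤k k≢0) (trans (*-comm (recip (fromℤ k)) (fromℤ k)) (recip-inverseʳ k≢0))
    where
    k≢0 : fromℤ k ≢ 0ℚ
    k≢0 e = p∤k (subst (λ t → p ∣ ℤ.∣ t ∣) (sym (fromℤ-injective {k} {ℤ.+ 0} e)) (p ∣0))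
    inverse-integral : ∀ k → ¬ p ∣ ℤ.∣ k ∣ → fromℤ k ≢ 0ℚ → Integral (recip (fromℤ k))
    inverse-integral (ℤ.+ n)    p∤k k≢0 = integral n (ℤ.+ 1) p∤k (recip-inverseʳ k≢0)
    inverse-integral -[1+ n ] p∤k k≢0 = integral (suc n) (ℤ.- ℤ.+ 1) p∤k (begin
      - fromℤ -[1+ n ] * recip (fromℤ -[1+ n ])    ≡⟨ neg-distribˡ-* (fromℤ -[1+ n ]) (recip (fromℤ -[1+ n ])) ⟨
      - (fromℤ -[1+ n ] * recip (fromℤ -[1+ n ]))  ≡⟨ cong (λ t → - t) (recip-inverseʳ k≢0) ⟩
      - 1ℚ                                       ∎)

  Unit-ℕ : ∀ n → ¬ p ∣ n → Unit (fromℕ n)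
  Unit-ℕ n = Unit-ℤ (ℤ.+ n)

  Unit-neg : ∀ {x} → Unit x → Unit (- x)
  Unit-neg {x} (unit v iv e) = unit (- v) (Integral-neg iv) (trans (neg-neg v x) e)
    where
    neg-neg : ∀ v x → - v * - x ≡ v * x
    neg-neg = solve-∀ ringℚ

  ≋-cancel : ∀ {u x y M} → Unit u → u * x ≋ u * y [ M ] → x ≋ y [ M ]
  ≋-cancel {u} {x} {y} {M} (unit v iv e) ux≋uy = subst₂ (λ s t → s ≋ t [ M ]) (undo x) (undo y) (≋-*ˡ iv ux≋uy)
    where
    undo : ∀ t → v * (u * t) ≡ t
    undo t = trans (sym (*-assoc v u t)) (trans (cong (_* t) e) (*-identityˡ t))

  P : ℚ
  P = fromℕ p

  1≋̸0 : ¬ 1ℚ ≋ 0ℚ [ P ]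
  1≋̸0 (congruent z (integral d k p∤d dz≡k) e) = p∤d (divides ℤ.∣ k ∣ (begin
    d                       ≡⟨ cong ℤ.∣_∣ (fromℤ-injective {ℤ.+ d} {k ℤ.* ℤ.+ p} scaled) ⟩
    ℤ.∣ k ℤ.* ℤ.+ p ∣       ≡⟨ ℤ.abs-* k (ℤ.+ p) ⟩
    ℤ.∣ k ∣ ℕ.* p           ∎))
    where
    scaled : fromℕ d ≡ fromℤ (k ℤ.* ℤ.+ p)
    scaled = begin
      fromℕ d                ≡⟨ *-identityʳ (fromℕ d) ⟨
      fromℕ d * (1ℚ - 0ℚ)    ≡⟨ cong (fromℕ d *_) e ⟩
      fromℕ d * (P * z)      ≡⟨ commute (fromℕ d) P z ⟩
      fromℕ d * z * P        ≡⟨ cong (_* P) dz≡k ⟩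
      fromℤ k * P            ≡⟨ fromℤ-* k (ℤ.+ p) ⟨
      fromℤ (k ℤ.* ℤ.+ p)    ∎
      where
      commute : ∀ d P z → d * (P * z) ≡ d * z * P
      commute = solve-∀ ringℚ

  -- Write x = k/d with d prime to p. If p divided k, then x, hence `u`, hence 1 would vanish modulo
  -- p; so k is prime to p and d/k is an integral inverse.
  Unit-resp-≋ : ∀ {x u} → Integral x → Unit u → x ≋ u [ P ] → Unit x
  Unit-resp-≋ {x} {u} ix@(integral d k p∤d dx≡k) (unit v iv vu≡1) x≋u with p ∣? ℤ.∣ k ∣
  ... | no p∤k = invert (Unit-ℤ k p∤k)
    where
    invert : Unit (fromℤ k) → Unit x
    invert (unit w iw wk≡1) = unit (w * fromℕ d) (Integral-* iw (Integral-ℕ d))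
      (trans (*-assoc w (fromℕ d) x) (trans (cong (w *_) dx≡k) wk≡1))
  ... | yes (divides q ∣k∣≡qp) = contradiction 1≋0 1≋̸0
    where
    k≋0 : fromℤ k ≋ 0ℚ [ P ]
    k≋0 = signed k ∣k∣≡qp
      where
      multiple : ∀ n → n ≡ q ℕ.* p → fromℕ n ≋ 0ℚ [ P ]
      multiple n n≡qp = congruent (fromℕ q) (Integral-ℕ q)
        (trans (+-identityʳ (fromℕ n)) (trans (cong fromℕ n≡qp) (trans (fromℕ-* q p) (*-comm (fromℕ q) P))))
      signed : ∀ k → ℤ.∣ k ∣ ≡ q ℕ.* p → fromℤ k ≋ 0ℚ [ P ]
      signed (ℤ.+ n)  = multiple n
      signed -[1+ n ] = ≋-neg ∘ multiple (suc n)
    x≋0 : x ≋ 0ℚ [ P ]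
    x≋0 = ≋-cancel (Unit-ℕ d p∤d) (subst₂ (λ s t → s ≋ t [ P ]) (sym dx≡k) (sym (*-zeroʳ (fromℕ d))) k≋0)
    1≋0 : 1ℚ ≋ 0ℚ [ P ]
    1≋0 = subst₂ (λ s t → s ≋ t [ P ]) vu≡1 (*-zeroʳ v) (≋-*ˡ iv (≋-trans (≋-sym x≋u) x≋0))

  P≋0 : P ≋ 0ℚ [ P ]
  P≋0 = congruent 1ℚ (Integral-ℕ 1) (trans (+-identityʳ P) (sym (*-identityʳ P)))

  -- The reduced denominator divides every admissible `scale`, and p divides none of these.
  Coprime-denominator : ∀ {z} → Integral z → Coprime p (↧ₙ z)
  Coprime-denominator {z@(mkℚ n e c)} (integral d k p∤d dz≡k) {j} (j∣p , j∣e) with prime⇒irreducible p-prime j∣p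
  ... | inj₁ j≡1  = j≡1
  ... | inj₂ refl = contradiction (∣-trans j∣e e∣d) p∤d
    where
    cross : ℤ.+ d ℤ.* n ℤ.* ℤ.+ 1 ≡ k ℤ.* ℤ.+ (1 ℕ.* suc e)
    cross = ℚᵘ.drop-*≡* (ℚᵘ.≃-trans (ℚᵘ.≃-sym (toℚᵘ-homo-* (fromℕ d) z)) (toℚᵘ-cong dz≡k))
    absolute : ℤ.∣ n ∣ ℕ.* d ≡ ℤ.∣ k ∣ ℕ.* suc e
    absolute = begin
      ℤ.∣ n ∣ ℕ.* d                      ≡⟨ ℕ.*-comm ℤ.∣ n ∣ d ⟩
      d ℕ.* ℤ.∣ n ∣                      ≡⟨ ℤ.abs-* (ℤ.+ d) n ⟨
      ℤ.∣ ℤ.+ d ℤ.* n ∣                  ≡⟨ cong ℤ.∣_∣ (ℤ.*-identityʳ (ℤ.+ d ℤ.* n)) ⟨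
      ℤ.∣ ℤ.+ d ℤ.* n ℤ.* ℤ.+ 1 ∣        ≡⟨ cong ℤ.∣_∣ cross ⟩
      ℤ.∣ k ℤ.* ℤ.+ (1 ℕ.* suc e) ∣      ≡⟨ ℤ.abs-* k (ℤ.+ (1 ℕ.* suc e)) ⟩
      ℤ.∣ k ∣ ℕ.* (1 ℕ.* suc e)          ≡⟨ cong (ℤ.∣ k ∣ ℕ.*_) (ℕ.*-identityˡ (suc e)) ⟩
      ℤ.∣ k ∣ ℕ.* suc e                  ∎
    e∣d : suc e ∣ d
    e∣d = coprime-divisor (Coprimality.sym (Coprimality.recompute c)) (divides ℤ.∣ k ∣ absolute)

  ≋⇒≈ : ∀ {x y} n → x ≋ y [ P ^ n ] → x ≈ y [mod p ^ n ]
  ≋⇒≈ n (congruent z iz e) = z , Coprime-denominator iz , e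

  -- Fermat's little theorem.

  p∤suc : ∀ {n} → suc n ℕ.< p → ¬ p ∣ suc n
  p∤suc n<p p∣n = ℕ.<⇒≱ n<p (∣⇒≤ p∣n)

  p∤! : ∀ n → n ℕ.< p → ¬ p ∣ n !
  p∤! zero    _   = p∤1
  p∤! (suc n) n<p = p∤* (p∤suc n<p) (p∤! n (ℕ.<-trans (ℕ.n<1+n n) n<p))

  Integral-invFact : ∀ n → n ℕ.< p → Integral (invFact n)
  Integral-invFact n n<p = integral (n !) (ℤ.+ 1) (p∤! n n<p) (factorial*invFact n)

  freshman : ∀ x → Integral x → (x + 1ℚ) ^ p ≋ x ^ p + 1ℚ [ P ]
  freshman x ix = congruent cofactor′ cofactor-integral (begin
    (x + 1ℚ) ^ p - (x ^ p + 1ℚ)                      ≡⟨ cong (λ r → (x + 1ℚ) ^ r - (x ^ r + 1ℚ)) p≡ ⟩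
    (x + 1ℚ) ^ r - (x ^ r + 1ℚ)                      ≡⟨ cong (_- (x ^ r + 1ℚ)) (binomial-ends q x) ⟩
    x ^ r + 1ℚ + fromℕ (r !) * middle - (x ^ r + 1ℚ) ≡⟨ cong (λ t → x ^ r + 1ℚ + t * middle - (x ^ r + 1ℚ)) (fromℕ-* r (suc q !)) ⟩
    x ^ r + 1ℚ + fromℕ r * fromℕ (suc q !) * middle - (x ^ r + 1ℚ) ≡⟨ cancel (x ^ r + 1ℚ) (fromℕ r) (fromℕ (suc q !)) middle ⟩
    fromℕ r * cofactor′                              ≡⟨ cong (λ t → fromℕ t * cofactor′) p≡ ⟨
    P * cofactor′                                    ∎)
    where
    p>1 : 1 ℕ.< p
    p>1 = ℕ.nonTrivial⇒n>1 p {{prime⇒nonTrivial p-prime}}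
    q = p ∸ 2
    r = suc (suc q)
    p≡ : p ≡ r
    p≡ = sym (ℕ.m+[n∸m]≡n p>1)
    middle = Δ q (λ m k → (x ^ suc m * invFact (suc m)) * (1ℚ ^ suc k * invFact (suc k)))
    cofactor′ = fromℕ (suc q !) * middle
    small : ∀ m → m ℕ.≤ q → suc m ℕ.< p
    small m m≤q = subst (suc m ℕ.<_) (sym p≡) (ℕ.s≤s (ℕ.s≤s m≤q))
    cofactor-integral : Integral cofactor′
    cofactor-integral = Integral-* (Integral-ℕ (suc q !)) (Integral-Δ q (λ m k e → Integral-*
      (Integral-* (Integral-^ (suc m) ix) (Integral-invFact (suc m) (small m (subst (m ℕ.≤_) e (ℕ.m≤m+n m k)))))
      (Integral-* (Integral-^ (suc k) (Integral-ℕ 1)) (Integral-invFact (suc k) (small k (subst (k ℕ.≤_) e (ℕ.m≤n+m k m)))))))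
    cancel : ∀ x a b c → x + a * b * c - x ≡ a * (b * c)
    cancel = solve-∀ ringℚ

  fermat : ∀ n → fromℕ n ^ p ≋ fromℕ n [ P ]
  fermat zero    = ≋-reflexive (trans (cong (0ℚ ^_) (sym (ℕ.suc-pred p {{prime⇒nonZero p-prime}}))) (*-zeroˡ (0ℚ ^ ℕ.pred p)))
  fermat (suc n) = subst (λ t → t ^ p ≋ t [ P ]) (trans (+-comm (fromℕ n) 1ℚ) (sym (fromℕ-suc n)))
    (≋-trans (freshman (fromℕ n) (Integral-ℕ n)) (≋-+ (fermat n) ≋-refl))

  -- In this form the power with exponent p - 3 is an inverse square modulo p.
  fermat-unit : ∀ n m → ¬ p ∣ n → p ≡ 3 ℕ.+ m → fromℕ n * fromℕ n * fromℕ n ^ m ≋ 1ℚ [ P ]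
  fermat-unit n m p∤n p≡3+m = ≋-cancel (Unit-ℕ n p∤n) (subst₂ (λ s t → s ≋ t [ P ])
    (trans (cong (fromℕ n ^_) p≡3+m) (regroup (fromℕ n) (fromℕ n ^ m))) (sym (*-identityʳ (fromℕ n))) (fermat n))
    where
    regroup : ∀ x X → x * (x * (x * X)) ≡ x * (x * x * X)
    regroup = solve-∀ ringℚ

  -- Euler polynomials and antisymmetric sums modulo p.

  module _ (p∤2 : ¬ p ∣ 2) where

    record EulerResp (n : ℕ) (x y : ℚ) : Set where
      field
        integrality : Integral (eulerSeries x n)
        congruence  : eulerSeries x n ≋ eulerSeries y n [ P ]

    open EulerResp

    private
      two = Unit-ℕ 2 p∤2

    Integral-half : ∀ {x} → Integral (fromℕ 2 * x) → Integral x
    Integral-half {x} (integral d k p∤d e) = integral (d ℕ.* 2) k (p∤* p∤d p∤2)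
      (trans (cong (_* x) (fromℕ-* d 2)) (trans (*-assoc (fromℕ d) (fromℕ 2) x) e))

    -- Strong induction along the recurrence for the coefficients. It divides only by 2 and by
    -- factorials of numbers at most n, which n < p keeps prime to p.
    eulerSeries-resp : ∀ {x y} → Integral x → Integral y → x ≋ y [ P ] → ∀ n → n ℕ.< p → EulerResp n x y
    eulerSeries-resp {x} {y} ix iy x≋y = <-rec (λ n → n ℕ.< p → EulerResp n x y) step
      where
      power-integral : ∀ n → n ℕ.< p → Integral (fromℕ 2 * (x ^ n * invFact n))
      power-integral n n<p = Integral-* (Integral-ℕ 2) (Integral-* (Integral-^ n ix) (Integral-invFact n n<p))
      power-congruence : ∀ n → n ℕ.< p → fromℕ 2 * (x ^ n * invFact n) ≋ fromℕ 2 * (y ^ n * invFact n) [ P ]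
      power-congruence n n<p = ≋-*ˡ (Integral-ℕ 2) (≋-*ʳ (Integral-invFact n n<p) (≋-^ n ix iy x≋y))
      doubled-zero : ∀ z → fromℕ 2 * (z ^ 0 * invFact 0) ≡ fromℕ 2 * eulerSeries z 0
      doubled-zero z = trans (sym (eulerSeries-recurrence z 0)) (doubled-coefficient-zero (eulerSeries z))
      doubled-suc : ∀ z n → fromℕ 2 * (z ^ suc n * invFact (suc n)) + - Δ n (λ m k → eulerSeries z m * invFact (suc k)) ≡ fromℕ 2 * eulerSeries z (suc n)
      doubled-suc z n = begin
        fromℕ 2 * (z ^ suc n * invFact (suc n)) + - D
          ≡⟨ cong (_+ - D) (eulerSeries-recurrence z (suc n)) ⟨
        Δ (suc n) (λ m k → eulerSeries z m * invFact k) + eulerSeries z (suc n) + - D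
          ≡⟨ cong (_+ - D) (doubled-coefficient n (eulerSeries z)) ⟩
        fromℕ 2 * eulerSeries z (suc n) + D + - D
          ≡⟨ cancel (fromℕ 2 * eulerSeries z (suc n)) D ⟩
        fromℕ 2 * eulerSeries z (suc n) ∎
        where
        D = Δ n (λ m k → eulerSeries z m * invFact (suc k))
        cancel : ∀ x y → x + y + - y ≡ x
        cancel = solve-∀ ringℚ
      step : ∀ n → (∀ {m} → m ℕ.< n → m ℕ.< p → EulerResp m x y) → n ℕ.< p → EulerResp n x y
      step zero ih n<p = record
        { integrality = Integral-half (subst Integral (doubled-zero x) (power-integral 0 n<p))
        ; congruence  = ≋-cancel two (subst₂ (λ s t → s ≋ t [ P ]) (doubled-zero x) (doubled-zero y) (power-congruence 0 n<p))
        }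
      step (suc n) ih n<p = record
        { integrality = Integral-half (subst Integral (doubled-suc x n) (Integral-+ (power-integral (suc n) n<p)
            (Integral-neg (Integral-Δ n (λ m k e → Integral-* (integrality (ih (m< m k e) (<p m k e))) (Integral-invFact (suc k) (k< m k e)))))))
        ; congruence  = ≋-cancel two (subst₂ (λ s t → s ≋ t [ P ]) (doubled-suc x n) (doubled-suc y n) (≋-+ (power-congruence (suc n) n<p)
            (≋-neg (≋-Δ n (λ m k e → ≋-*ʳ (Integral-invFact (suc k) (k< m k e)) (congruence (ih (m< m k e) (<p m k e))))))))
        }
        where
        m< : ∀ m k → m ℕ.+ k ≡ n → m ℕ.< suc n
        m< m k e = ℕ.s≤s (subst (m ℕ.≤_) e (ℕ.m≤m+n m k))
        <p : ∀ m k → m ℕ.+ k ≡ n → m ℕ.< p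
        <p m k e = ℕ.<-trans (m< m k e) n<p
        k< : ∀ m k → m ℕ.+ k ≡ n → suc k ℕ.< p
        k< m k e = ℕ.≤-<-trans (ℕ.s≤s (subst (k ℕ.≤_) e (ℕ.m≤n+m k m))) n<p

    euler-resp : ∀ {x y} n → n ℕ.< p → Integral x → Integral y → x ≋ y [ P ] → euler n x ≋ euler n y [ P ]
    euler-resp n n<p ix iy x≋y = ≋-*ˡ (Integral-ℕ (n !)) (congruence (eulerSeries-resp ix iy x≋y n n<p))

    self-negative : ∀ {x} → x ≋ - x [ P ] → x ≋ 0ℚ [ P ]
    self-negative {x} x≋-x = ≋-cancel two (subst₂ (λ s t → s ≋ t [ P ]) (double x) (cancel x) (≋-+ (≋-refl {x}) x≋-x))
      where
      double : ∀ x → x + x ≡ fromℕ 2 * x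
      double = solve-∀ ringℚ
      cancel : ∀ x → x + - x ≡ fromℕ 2 * 0ℚ
      cancel = solve-∀ ringℚ

    -- Reversing the order of summation turns the sum into its own negative modulo p, and 2 is
    -- invertible.
    Δ-antisymmetric : ∀ n (f : ℕ → ℚ) → (∀ m k → m ℕ.+ k ≡ n → f k ≋ - f m [ P ]) → Δ n (λ m _ → f m) ≋ 0ℚ [ P ]
    Δ-antisymmetric n f anti = self-negative (≋-trans (≋-reflexive (Δ-flip n (λ m _ → f m))) (≋-trans (≋-Δ n anti) (≋-reflexive negate)))
      where
      negate : Δ n (λ m _ → - f m) ≡ - Δ n (λ m _ → f m)
      negate = begin
        Δ n (λ m _ → - f m)          ≡⟨ Δ-cong n (λ m _ _ → neg-one (f m)) ⟩
        Δ n (λ m _ → - 1ℚ * f m)     ≡⟨ Δ-*ˡ n (- 1ℚ) (λ m _ → f m) ⟩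
        - 1ℚ * Δ n (λ m _ → f m)     ≡⟨ neg-one (Δ n (λ m _ → f m)) ⟨
        - Δ n (λ m _ → f m)          ∎
        where
        neg-one : ∀ x → - x ≡ - 1ℚ * x
        neg-one = solve-∀ ringℚ

  infix 4 _~_
  -- Carrying the integrality of both sides along lets residues of long products be computed without
  -- side conditions.
  record _~_ (x y : ℚ) : Set where
    constructor residue
    field
      integralˡ  : Integral x
      integralʳ  : Integral y
      congruence : x ≋ y [ P ]

  ~-refl : ∀ {x} → Integral x → x ~ x
  ~-refl ix = residue ix ix ≋-refl

  ~-ℕ : ∀ n → fromℕ n ~ fromℕ n
  ~-ℕ n = ~-refl (Integral-ℕ n)

  ~-reflexive : ∀ {x y} → Integral y → x ≡ y → x ~ y
  ~-reflexive iy refl = ~-refl iy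

  ~-trans : ∀ {x y z} → x ~ y → y ~ z → x ~ z
  ~-trans (residue ix _ x≋y) (residue _ iz y≋z) = residue ix iz (≋-trans x≋y y≋z)

  ~-+ : ∀ {x y t u} → x ~ y → t ~ u → x + t ~ y + u
  ~-+ (residue ix iy x≋y) (residue it iu t≋u) = residue (Integral-+ ix it) (Integral-+ iy iu) (≋-+ x≋y t≋u)

  ~-* : ∀ {x y t u} → x ~ y → t ~ u → x * t ~ y * u
  ~-* (residue ix iy x≋y) (residue it iu t≋u) = residue (Integral-* ix it) (Integral-* iy iu) (≋-* ix iu x≋y t≋u)

  ~-neg : ∀ {x y} → x ~ y → - x ~ - y
  ~-neg (residue ix iy x≋y) = residue (Integral-neg ix) (Integral-neg iy) (≋-neg x≋y)

  ~-minus : ∀ {x y t u} → x ~ y → t ~ u → x - t ~ y - u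
  ~-minus x~y t~u = ~-+ x~y (~-neg t~u)

  ~-cong : ∀ {x y} → x ~ y → x ≋ y [ P ]
  ~-cong = _~_.congruence

  Unit-resp-~ : ∀ {x u} → Unit u → x ~ u → Unit x
  Unit-resp-~ uu (residue ix _ x≋u) = Unit-resp-≋ ix uu x≋u

  -- Carries a known residue from one product to its neighbour. With the small factor `C` split off,
  -- the relation between `h` and `h′` is needed only modulo p, although the conclusion holds modulo
  -- `C * P`.
  transfer : ∀ {U V x x′ h h′} C → Unit U → Integral V → V * x ≡ - (U * x′) →
    x ≋ C * h [ C * P ] → V * h ≋ - (U * h′) [ P ] → x′ ≋ C * h′ [ C * P ]
  transfer {U} {V} {x} {x′} {h} {h′} C uU iV Vx≡ x≋ Vh≋ = ≋-cancel uU
    (subst₂ (λ s t → s ≋ t [ C * P ]) (trans (cong (λ t → - t) Vx≡) (involutive (U * x′))) (rearrange′ C U h′)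
      (≋-neg (≋-trans (≋-*ˡ iV x≋) (≋-trans (≋-reflexive (rearrange V C h)) (≋-scale C Vh≋)))))
    where
    involutive : ∀ x → - - x ≡ x
    involutive = solve-∀ ringℚ
    rearrange : ∀ V C h → V * (C * h) ≡ C * (V * h)
    rearrange = solve-∀ ringℚ
    rearrange′ : ∀ C U h → - (C * - (U * h)) ≡ U * (C * h)
    rearrange′ = solve-∀ ringℚ

  Integral-pochhammer : ∀ {x} k → Integral x → Integral (pochhammer x k)
  Integral-pochhammer zero    ix = Integral-ℕ 1
  Integral-pochhammer (suc k) ix = Integral-* (Integral-pochhammer k ix) (Integral-+ ix (Integral-ℕ k))

  Integral-descending : ∀ {y} k → Integral y → Integral (descending y k)
  Integral-descending zero    iy = Integral-ℕ 1
  Integral-descending (suc k) iy = Integral-* (Integral-descending k iy) (Integral-+ iy (Integral-neg (Integral-ℕ (suc k))))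

  Integral-cube : ∀ {x} → Integral x → Integral (cube x)
  Integral-cube ix = Integral-* (Integral-* ix ix) ix

  -- Factor by factor, (y − j)³ (y + j) − j³ (2y − j) = y³ (y − 2j).
  descending³*pochhammer : ∀ y n → Integral y →
    cube (descending y n) * pochhammer (y + 1ℚ) n ≋ cube (fromℕ (n !)) * descending (fromℕ 2 * y) n [ cube y ]
  descending³*pochhammer y zero    iy = ≋-refl
  descending³*pochhammer y (suc n) iy = subst₂ (λ s t → s ≋ t [ cube y ])
    (trans (cong (λ t → cube R * S * (cube (y - j) * t)) (sym (fromℕ-shift y n))) (merge R S (y - j) (y + 1ℚ + fromℕ n)))
    (trans (merge′ (fromℕ (n !)) D j (fromℕ 2 * y - j)) (cong (λ t → cube t * (D * (fromℕ 2 * y - j))) (sym (fromℕ-* (suc n) (n !)))))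
    (≋-* (Integral-* (Integral-cube (Integral-descending n iy)) (Integral-pochhammer n (Integral-+ iy (Integral-ℕ 1))))
      (Integral-* (Integral-cube (Integral-ℕ (suc n))) (Integral-+ (Integral-* (Integral-ℕ 2) iy) (Integral-neg (Integral-ℕ (suc n)))))
      (descending³*pochhammer y n iy)
      (congruent (y - fromℕ 2 * j) (Integral-+ iy (Integral-neg (Integral-* (Integral-ℕ 2) (Integral-ℕ (suc n))))) (difference y j)))
    where
    j = fromℕ (suc n)
    R = descending y n
    S = pochhammer (y + 1ℚ) n
    D = descending (fromℕ 2 * y) n
    merge : ∀ R S x t → R * R * R * S * (x * x * x * t) ≡ R * x * (R * x) * (R * x) * (S * t)
    merge = solve-∀ ringℚ
    merge′ : ∀ f D j t → f * f * f * D * (j * j * j * t) ≡ j * f * (j * f) * (j * f) * (D * t)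
    merge′ = solve-∀ ringℚ
    difference : ∀ y j → (y - j) * (y - j) * (y - j) * (y + j) - j * j * j * (fromℕ 2 * y - j) ≡ y * y * y * (y - fromℕ 2 * j)
    difference = solve-∀ ringℚ

  Unit-descending : ∀ {y} → y ~ 0ℚ → ∀ k → k ℕ.< p → Unit (descending y k)
  Unit-descending y~0 zero    _   = Unit-ℕ 1 p∤1
  Unit-descending y~0 (suc k) k<p = Unit-* (Unit-descending y~0 k (ℕ.<-trans (ℕ.n<1+n k) k<p))
    (Unit-resp-~ (Unit-neg (Unit-ℕ (suc k) (p∤suc k<p)))
      (~-trans (~-minus y~0 (~-ℕ (suc k))) (~-reflexive (Integral-neg (Integral-ℕ (suc k))) (+-identityˡ (- fromℕ (suc k))))))

-- The primes p = 6l + 5.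

module FiveModSix (l : ℕ) (p-prime : Prime (5 ℕ.+ 6 ℕ.* l)) where

  open PAdic (5 ℕ.+ 6 ℕ.* l) p-prime

  -- Here n = (2p - 1)/3, n′ = n - 1, and m₀ = p - 3 is the index of the Euler polynomial.
  p n n′ m₀ : ℕ
  p = 5 ℕ.+ 6 ℕ.* l
  n′ = 2 ℕ.+ 4 ℕ.* l
  n = suc n′
  m₀ = 2 ℕ.+ 6 ℕ.* l

  a y N ℓ : ℚ
  a = ℤ.+ 1 / 3
  N = fromℕ n
  ℓ = fromℕ l
  y = (ℤ.+ 2 / 3) * P

  third≢0 : ∀ j → a + fromℕ j ≢ 0ℚ
  third≢0 j e = fromℕ≢0 (suc (3 ℕ.* j)) (begin
    fromℕ (suc (3 ℕ.* j))        ≡⟨ trans (fromℕ-suc (3 ℕ.* j)) (cong (λ t → 1ℚ + t) (fromℕ-* 3 j)) ⟩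
    1ℚ + fromℕ 3 * fromℕ j       ≡⟨ factor (fromℕ j) ⟩
    fromℕ 3 * (a + fromℕ j)      ≡⟨ cong (fromℕ 3 *_) e ⟩
    fromℕ 3 * 0ℚ                 ≡⟨⟩
    0ℚ                           ∎)
    where
    factor : ∀ j → 1ℚ + fromℕ 3 * j ≡ fromℕ 3 * ((ℤ.+ 1 / 3) + j)
    factor = solve-∀ ringℚ

  two-thirds≢0 : ∀ j → a + a + fromℕ j ≢ 0ℚ
  two-thirds≢0 j e = fromℕ≢0 (suc (suc (3 ℕ.* j))) (begin
    fromℕ (2 ℕ.+ 3 ℕ.* j)            ≡⟨ trans (fromℕ-+ 2 (3 ℕ.* j)) (cong (λ t → fromℕ 2 + t) (fromℕ-* 3 j)) ⟩
    fromℕ 2 + fromℕ 3 * fromℕ j      ≡⟨ factor (fromℕ j) ⟩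
    fromℕ 3 * (a + a + fromℕ j)      ≡⟨ cong (fromℕ 3 *_) e ⟩
    fromℕ 3 * 0ℚ                     ≡⟨⟩
    0ℚ                               ∎)
    where
    factor : ∀ j → fromℕ 2 + fromℕ 3 * j ≡ fromℕ 3 * ((ℤ.+ 1 / 3) + (ℤ.+ 1 / 3) + j)
    factor = solve-∀ ringℚ

  fromℕ-linear : ∀ c d → fromℕ (c ℕ.+ d ℕ.* l) ≡ fromℕ c + fromℕ d * ℓ
  fromℕ-linear c d = trans (fromℕ-+ c (d ℕ.* l)) (cong (λ t → fromℕ c + t) (fromℕ-* d l))

  a+N≡y : a + N ≡ y
  a+N≡y = trans (cong (a +_) (fromℕ-linear 3 4)) (trans (expand ℓ) (cong ((ℤ.+ 2 / 3) *_) (sym (fromℕ-linear 5 6))))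
    where
    expand : ∀ x → (ℤ.+ 1 / 3) + (fromℕ 3 + fromℕ 4 * x) ≡ (ℤ.+ 2 / 3) * (fromℕ 5 + fromℕ 6 * x)
    expand = solve-∀ ringℚ

  4l≤6l : 4 ℕ.* l ℕ.≤ 6 ℕ.* l
  4l≤6l = ℕ.*-monoˡ-≤ l {4} {6} (ℕ.s≤s (ℕ.s≤s (ℕ.s≤s (ℕ.s≤s ℕ.z≤n))))

  small : ∀ c {x} → c ℕ.≤ 4 → x ℕ.≤ 6 ℕ.* l → c ℕ.+ x ℕ.< p
  small c c≤4 x≤ = ℕ.+-mono-≤ (ℕ.s≤s c≤4) x≤

  n+1<p : suc n ℕ.< p
  n+1<p = small 4 ℕ.≤-refl 4l≤6l

  p∤≤n+1 : ∀ {k} → suc k ℕ.≤ suc n → ¬ p ∣ suc k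
  p∤≤n+1 k≤ = p∤suc (ℕ.≤-<-trans k≤ n+1<p)

  p∤2 : ¬ p ∣ 2
  p∤2 = p∤≤n+1 (ℕ.s≤s (ℕ.s≤s ℕ.z≤n))

  p∤3 : ¬ p ∣ 3
  p∤3 = p∤≤n+1 (ℕ.s≤s (ℕ.s≤s (ℕ.s≤s ℕ.z≤n)))

  Integral-thirds : ∀ k → fromℕ 3 * (ℤ.+ k / 3) ≡ fromℕ k → Integral (ℤ.+ k / 3)
  Integral-thirds k e = integral 3 (ℤ.+ k) p∤3 e

  Integral-a : Integral a
  Integral-a = Integral-thirds 1 refl

  y~0 : y ~ 0ℚ
  y~0 = residue (Integral-* (Integral-thirds 2 refl) (Integral-ℕ p)) (Integral-ℕ 0)
    (≋-trans (≋-*ˡ (Integral-thirds 2 refl) P≋0) (≋-reflexive (*-zeroʳ (ℤ.+ 2 / 3))))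

  Integral-y : Integral y
  Integral-y = _~_.integralˡ y~0

  -- Alternating inverse squares modulo p.

  sign-even : ∀ k → (- 1ℚ) ^ (2 ℕ.* k) ≡ 1ℚ
  sign-even k = trans (sym (^-assocʳ (- 1ℚ) 2 k)) (1^ k)

  sign-other : ∀ j k c → (- 1ℚ) ^ (j ℕ.+ k) ≡ c → (- 1ℚ) ^ k ≡ (- 1ℚ) ^ j * c
  sign-other j k c e = begin
    (- 1ℚ) ^ k                                     ≡⟨ *-identityˡ ((- 1ℚ) ^ k) ⟨
    1ℚ * (- 1ℚ) ^ k                                ≡⟨ cong (_* (- 1ℚ) ^ k) square ⟨
    (- 1ℚ) ^ j * (- 1ℚ) ^ j * (- 1ℚ) ^ k           ≡⟨ *-assoc ((- 1ℚ) ^ j) ((- 1ℚ) ^ j) ((- 1ℚ) ^ k) ⟩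
    (- 1ℚ) ^ j * ((- 1ℚ) ^ j * (- 1ℚ) ^ k)         ≡⟨ cong ((- 1ℚ) ^ j *_) (^-homo-* (- 1ℚ) j k) ⟨
    (- 1ℚ) ^ j * (- 1ℚ) ^ (j ℕ.+ k)                ≡⟨ cong ((- 1ℚ) ^ j *_) e ⟩
    (- 1ℚ) ^ j * c                                 ∎
    where
    square : (- 1ℚ) ^ j * (- 1ℚ) ^ j ≡ 1ℚ
    square = trans (sym (^-homo-* (- 1ℚ) j j)) (trans (cong (λ t → (- 1ℚ) ^ (j ℕ.+ t)) (sym (ℕ.+-identityʳ j))) (sign-even j))

  even-power : ∀ x k → (- x) ^ (2 ℕ.* k) ≡ x ^ (2 ℕ.* k)
  even-power x k = trans (sym (^-assocʳ (- x) 2 k)) (trans (cong (_^ k) (square x)) (^-assocʳ x 2 k))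
    where
    square : ∀ x → - x * (- x * 1ℚ) ≡ x * (x * 1ℚ)
    square = solve-∀ ringℚ

  2*-distrib : ∀ c d → 2 ℕ.* c ℕ.+ 2 ℕ.* d ℕ.* l ≡ 2 ℕ.* (c ℕ.+ d ℕ.* l)
  2*-distrib c d = trans (cong (2 ℕ.* c ℕ.+_) (ℕ.*-assoc 2 d l)) (sym (ℕ.*-distribˡ-+ 2 c (d ℕ.* l)))

  sign-n : (- 1ℚ) ^ n ≡ - 1ℚ
  sign-n = cong (- 1ℚ *_) (trans (cong ((- 1ℚ) ^_) (2*-distrib 1 2)) (sign-even (1 ℕ.+ 2 ℕ.* l)))

  sign-p-2 : (- 1ℚ) ^ (suc m₀) ≡ - 1ℚ
  sign-p-2 = cong (- 1ℚ *_) (trans (cong ((- 1ℚ) ^_) (2*-distrib 1 3)) (sign-even (1 ℕ.+ 3 ℕ.* l)))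

  -- For j + 1 prime to p this is (-1)ʲ/(j + 1)² modulo p, by `fermat-unit`, written as a power to
  -- which `Δ-alternating-powers` applies.
  h : ℕ → ℚ
  h j = (- 1ℚ) ^ j * fromℕ (suc j) ^ m₀

  -- The bases j + 1 and k + 1 add up to p, so they are opposite modulo p and have the same even
  -- power. The alternating signs differ because j + k = p - 2 is odd.
  h-antisymmetric : ∀ j k → j ℕ.+ k ≡ suc m₀ → h k ≋ - h j [ P ]
  h-antisymmetric j k e = ≋-trans
    (≋-*ˡ (Integral-^ k (Integral-neg (Integral-ℕ 1))) (≋-^ m₀ (Integral-ℕ (suc k)) (Integral-neg (Integral-ℕ (suc j))) complement))
    (≋-reflexive (begin
      (- 1ℚ) ^ k * (- fromℕ (suc j)) ^ m₀        ≡⟨ cong₂ _*_ (sign-other j k (- 1ℚ) (trans (cong ((- 1ℚ) ^_) e) sign-p-2)) evenness ⟩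
      (- 1ℚ) ^ j * - 1ℚ * fromℕ (suc j) ^ m₀     ≡⟨ pull ((- 1ℚ) ^ j) (fromℕ (suc j) ^ m₀) ⟩
      - h j                                      ∎))
    where
    pull : ∀ s X → s * - 1ℚ * X ≡ - (s * X)
    pull = solve-∀ ringℚ
    evenness : (- fromℕ (suc j)) ^ m₀ ≡ fromℕ (suc j) ^ m₀
    evenness = subst (λ t → (- fromℕ (suc j)) ^ t ≡ fromℕ (suc j) ^ t) (sym (2*-distrib 1 3)) (even-power (fromℕ (suc j)) (1 ℕ.+ 3 ℕ.* l))
    complement : fromℕ (suc k) ≋ - fromℕ (suc j) [ P ]
    complement = congruent 1ℚ (Integral-ℕ 1) (begin
      fromℕ (suc k) - - fromℕ (suc j)    ≡⟨ flip-sub (fromℕ (suc k)) (fromℕ (suc j)) ⟩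
      fromℕ (suc j) + fromℕ (suc k)      ≡⟨ fromℕ-+ (suc j) (suc k) ⟨
      fromℕ (suc j ℕ.+ suc k)            ≡⟨ cong fromℕ (trans (ℕ.+-suc (suc j) k) (cong (2 ℕ.+_) e)) ⟩
      P                                  ≡⟨ *-identityʳ P ⟨
      P * 1ℚ                             ∎)
      where
      flip-sub : ∀ x y → x - - y ≡ y + x
      flip-sub = solve-∀ ringℚ

  m₀<p : m₀ ℕ.< p
  m₀<p = small 2 (ℕ.s≤s (ℕ.s≤s ℕ.z≤n)) ℕ.≤-refl

  -- The alternating power sum over 1, ..., p - 1 vanishes modulo p by antisymmetry, so the values
  -- at 1 and p agree, and p may be replaced by 0. But the difference equation at 0 makes the values
  -- at 0 and 1 opposite.
  euler-one : euler m₀ 1ℚ ≋ 0ℚ [ P ]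
  euler-one = self-negative p∤2 (≋-trans E1≋EP (≋-trans EP≋E0 (≋-reflexive E0≡-E1)))
    where
    E1≋EP : euler m₀ 1ℚ ≋ euler m₀ P [ P ]
    E1≋EP = ≋-trans (≋-reflexive (split (euler m₀ 1ℚ) (euler m₀ P)))
      (≋-trans (≋-+ (≋-trans (≋-reflexive telescoped) (≋-*ˡ (Integral-ℕ 2) (Δ-antisymmetric p∤2 (suc m₀) h h-antisymmetric))) ≋-refl)
        (≋-reflexive (drop (euler m₀ P))))
      where
      split : ∀ x y → x ≡ (x + - 1ℚ * y) + y
      split = solve-∀ ringℚ
      drop : ∀ y → fromℕ 2 * 0ℚ + y ≡ y
      drop = solve-∀ ringℚ
      telescoped : euler m₀ 1ℚ + - 1ℚ * euler m₀ P ≡ fromℕ 2 * Δ (suc m₀) (λ j _ → h j)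
      telescoped = trans (cong (λ t → euler m₀ 1ℚ + t * euler m₀ P) (sym sign-p-2)) (sym (Δ-alternating-powers m₀ (suc m₀)))
    EP≋E0 : euler m₀ P ≋ euler m₀ 0ℚ [ P ]
    EP≋E0 = euler-resp p∤2 m₀ m₀<p (Integral-ℕ p) (Integral-ℕ 0) P≋0
    E0≡-E1 : euler m₀ 0ℚ ≡ - euler m₀ 1ℚ
    E0≡-E1 = begin
      euler m₀ 0ℚ                                    ≡⟨ split (euler m₀ 0ℚ) (euler m₀ 1ℚ) ⟩
      euler m₀ 0ℚ + euler m₀ 1ℚ + - euler m₀ 1ℚ      ≡⟨ cong (_+ - euler m₀ 1ℚ) (euler-+1 m₀ 0ℚ) ⟩
      fromℕ 2 * 0ℚ ^ m₀ + - euler m₀ 1ℚ              ≡⟨ drop (0ℚ ^ suc (6 ℕ.* l)) (euler m₀ 1ℚ) ⟩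
      - euler m₀ 1ℚ                                  ∎
      where
      split : ∀ x y → x ≡ x + y + - y
      split = solve-∀ ringℚ
      drop : ∀ z y → fromℕ 2 * (0ℚ * z) + - y ≡ - y
      drop = solve-∀ ringℚ

  -- The summation stops just before 2l + 2 = (p + 1)/3, which is congruent to 1/3; the contribution
  -- of the lower end is `euler-one`.
  Δ-h : fromℕ 2 * Δ (2 ℕ.* l) (λ j _ → h j) ≋ euler m₀ a [ P ]
  Δ-h = ≋-trans (≋-reflexive (trans (Δ-alternating-powers m₀ (2 ℕ.* l)) (cong (λ t → euler m₀ 1ℚ + t * euler m₀ (fromℕ (2 ℕ.+ 2 ℕ.* l))) (sign-even l))))
    (≋-trans (≋-+ euler-one (≋-*ˡ (Integral-ℕ 1) (euler-resp p∤2 m₀ m₀<p (Integral-ℕ (2 ℕ.+ 2 ℕ.* l)) Integral-a near)))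
      (≋-reflexive (drop (euler m₀ a))))
    where
    drop : ∀ x → 0ℚ + 1ℚ * x ≡ x
    drop = solve-∀ ringℚ
    near : fromℕ (2 ℕ.+ 2 ℕ.* l) ≋ a [ P ]
    near = congruent a Integral-a (trans (cong (_- a) (fromℕ-linear 2 2)) (trans (expand ℓ) (cong (_* a) (sym (fromℕ-linear 5 6)))))
      where
      expand : ∀ x → fromℕ 2 + fromℕ 2 * x - (ℤ.+ 1 / 3) ≡ (fromℕ 5 + fromℕ 6 * x) * (ℤ.+ 1 / 3)
      expand = solve-∀ ringℚ

  -- The n + 1 products modulo p⁴.

  w : ℕ → ℕ → ℚ
  w = node a third≢0 two-thirds≢0 n

  -- The small factor common to all products except `w n 0`: one y comes from `w n 0` itself, and y
  -- · 2y from the two factors of `V₀ n′ 0` that vanish modulo p.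
  C : ℚ
  C = fromℕ 2 * (y * y * y)

  w-step = node-step a third≢0 two-thirds≢0 n

  -- The factors of `node-step` other than 2a + m and i + 1 - a. Those two are opposite modulo p and
  -- both divisible by p at one step, so they are handled apart.
  U₀ V₀ : ℕ → ℕ → ℚ
  U₀ m i = (a + fromℕ m) * (a + fromℕ (suc n) + fromℕ m) * fromℕ (suc i)
  V₀ m i = (a + fromℕ (suc m)) * fromℕ (suc m) * (a + a + fromℕ m + fromℕ (suc n))

  δ : ℕ → ℚ
  δ m = a + a + fromℕ m

  -- All residues are expressed through `K` and `I`, because a = y - n is congruent to -n = 1 - (K +
  -- I).
  module Step (m i : ℕ) (m+i : suc m ℕ.+ i ≡ n) where

    K I : ℚ
    K = fromℕ (suc m)
    I = fromℕ (suc i)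

    K+I≡ : fromℕ (suc n) ≡ K + I
    K+I≡ = trans (cong fromℕ (trans (cong suc (sym m+i)) (sym (ℕ.+-suc (suc m) i)))) (fromℕ-+ (suc m) (suc i))

    a~ : a ~ 1ℚ - (K + I)
    a~ = ~-trans (~-reflexive (Integral-+ Integral-y (Integral-+ (Integral-ℕ 1) (Integral-neg IKI))) (begin
      a                          ≡⟨ split a N ⟩
      a + N + (1ℚ - (1ℚ + N))    ≡⟨ cong₂ (λ t u → t + (1ℚ - u)) a+N≡y (trans (sym (fromℕ-suc n)) K+I≡) ⟩
      y + (1ℚ - (K + I))         ∎))
      (~-trans (~-+ y~0 (~-refl (Integral-+ (Integral-ℕ 1) (Integral-neg IKI)))) (~-reflexive (Integral-+ (Integral-ℕ 1) (Integral-neg IKI)) (+-identityˡ (1ℚ - (K + I)))))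
      where
      IKI = Integral-+ (Integral-ℕ (suc m)) (Integral-ℕ (suc i))
      split : ∀ a N → a ≡ a + N + (1ℚ - (1ℚ + N))
      split = solve-∀ ringℚ

    m~ : fromℕ m ~ K - 1ℚ
    m~ = ~-reflexive (Integral-+ (Integral-ℕ (suc m)) (Integral-neg (Integral-ℕ 1))) (trans (split (fromℕ m)) (cong (_- 1ℚ) (sym (fromℕ-suc m))))
      where
      split : ∀ m → m ≡ 1ℚ + m - 1ℚ
      split = solve-∀ ringℚ

    n~ : fromℕ (suc n) ~ K + I
    n~ = ~-reflexive (Integral-+ (Integral-ℕ (suc m)) (Integral-ℕ (suc i))) K+I≡

    U₀~ : U₀ m i ~ - (I * I * K)
    U₀~ = ~-trans (~-* (~-* (~-+ a~ m~) (~-+ (~-+ a~ n~) m~)) (~-ℕ (suc i)))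
      (~-reflexive (Integral-neg (Integral-* (Integral-* (Integral-ℕ (suc i)) (Integral-ℕ (suc i))) (Integral-ℕ (suc m)))) (simplify K I))
      where
      simplify : ∀ K I → (1ℚ - (K + I) + (K - 1ℚ)) * (1ℚ - (K + I) + (K + I) + (K - 1ℚ)) * I ≡ - (I * I * K)
      simplify = solve-∀ ringℚ

    V₀~ : V₀ m i ~ (1ℚ - I) * (1ℚ - I) * K
    V₀~ = ~-trans (~-* (~-* (~-+ a~ (~-ℕ (suc m))) (~-ℕ (suc m))) (~-+ (~-+ (~-+ a~ a~) m~) n~))
      (~-reflexive (Integral-* (Integral-* I1 I1) (Integral-ℕ (suc m))) (simplify K I))
      where
      I1 = Integral-+ (Integral-ℕ 1) (Integral-neg (Integral-ℕ (suc i)))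
      simplify : ∀ K I → (1ℚ - (K + I) + K) * K * (1ℚ - (K + I) + (1ℚ - (K + I)) + (K - 1ℚ) + (K + I)) ≡ (1ℚ - I) * (1ℚ - I) * K
      simplify = solve-∀ ringℚ

    δ~ : δ m ~ - fromℕ (n ℕ.+ suc i)
    δ~ = ~-trans (~-+ (~-+ a~ a~) m~) (~-reflexive (Integral-neg (Integral-ℕ (n ℕ.+ suc i))) (begin
      1ℚ - (K + I) + (1ℚ - (K + I)) + (K - 1ℚ)   ≡⟨ simplify K I ⟩
      - (K + I + I - 1ℚ)                         ≡⟨ cong (λ t → - (t + I - 1ℚ)) (trans (sym K+I≡) (fromℕ-suc n)) ⟩
      - (1ℚ + N + I - 1ℚ)                        ≡⟨ simplify′ N I ⟩
      - (N + I)                                  ≡⟨ cong (λ t → - t) (fromℕ-+ n (suc i)) ⟨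
      - fromℕ (n ℕ.+ suc i)                      ∎))
      where
      simplify : ∀ K I → 1ℚ - (K + I) + (1ℚ - (K + I)) + (K - 1ℚ) ≡ - (K + I + I - 1ℚ)
      simplify = solve-∀ ringℚ
      simplify′ : ∀ N I → - (1ℚ + N + I - 1ℚ) ≡ - (N + I)
      simplify′ = solve-∀ ringℚ

    η~ : I - a ~ fromℕ (n ℕ.+ suc i)
    η~ = ~-trans (~-minus (~-ℕ (suc i)) a~) (~-reflexive (Integral-ℕ (n ℕ.+ suc i)) (begin
      I - (1ℚ - (K + I))    ≡⟨ cong (λ t → I - (1ℚ - t)) (trans (sym K+I≡) (fromℕ-suc n)) ⟩
      I - (1ℚ - (1ℚ + N))   ≡⟨ simplify N I ⟩
      N + I                 ≡⟨ fromℕ-+ n (suc i) ⟨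
      fromℕ (n ℕ.+ suc i)   ∎))
      where
      simplify : ∀ N I → I - (1ℚ - (1ℚ + N)) ≡ N + I
      simplify = solve-∀ ringℚ

    m≤n′ : m ℕ.≤ n′
    m≤n′ = ℕ.s≤s⁻¹ (subst (suc m ℕ.≤_) m+i (ℕ.m≤m+n (suc m) i))

    i≤n′ : i ℕ.≤ n′
    i≤n′ = ℕ.s≤s⁻¹ (subst (suc i ℕ.≤_) (trans (ℕ.+-suc m i) m+i) (ℕ.m≤n+m (suc i) m))

    Unit-U₀ : Unit (U₀ m i)
    Unit-U₀ = Unit-resp-~ (Unit-neg (Unit-* (Unit-* uI uI) (Unit-ℕ (suc m) (p∤≤n+1 (ℕ.s≤s (ℕ.m≤n⇒m≤1+n m≤n′)))))) U₀~
      where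
      uI = Unit-ℕ (suc i) (p∤≤n+1 (ℕ.s≤s (ℕ.m≤n⇒m≤1+n i≤n′)))

  -- By `node-diagonal` the product is -y times a quotient that `descending³*pochhammer` shows to be
  -- 1 modulo y³; the outer y raises the precision to y⁴. The sign is that of (-1)ⁿ with n odd.
  w-zero : w n 0 ≋ - y [ y * cube y ]
  w-zero = ≋-cancel (Unit-* (Unit-descending 2y~0 n n<p) (Unit-* (Unit-* uf uf) uf))
    (≋-trans (≋-reflexive (trans (node-diagonal a third≢0 two-thirds≢0 n y a+N≡y) (trans (cong (λ t → t * y * (cube R * S)) sign-n) (sign y (cube R * S)))))
      (≋-trans (≋-neg (≋-scale y (descending³*pochhammer y n Integral-y))) (≋-reflexive (commute y (cube f) D))))
    where
    n<p : n ℕ.< p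
    n<p = ℕ.<-trans (ℕ.n<1+n n) n+1<p
    f = fromℕ (n !)
    R = descending y n
    S = pochhammer (y + 1ℚ) n
    D = descending (fromℕ 2 * y) n
    uf = Unit-ℕ (n !) (p∤! n n<p)
    2y~0 : fromℕ 2 * y ~ 0ℚ
    2y~0 = ~-* (~-ℕ 2) y~0
    sign : ∀ y x → - 1ℚ * y * x ≡ - (y * x)
    sign = solve-∀ ringℚ
    commute : ∀ y f D → - (y * (f * D)) ≡ D * f * - y
    commute = solve-∀ ringℚ

  w-zero-scaled : fromℕ 2 * y * y * w n 0 ≋ C * - 1ℚ [ C * P ]
  w-zero-scaled = ≋-weaken cofactor (subst₂ (λ s t → fromℕ 2 * y * y * w n 0 ≋ s [ t ]) (regroup y) (regroup′ P) (≋-scale (fromℕ 2 * y * y) w-zero))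
    where
    cofactor : Integral ((ℤ.+ 2 / 3) * y * y)
    cofactor = Integral-* (Integral-* (Integral-thirds 2 refl) Integral-y) Integral-y
    regroup : ∀ y → fromℕ 2 * y * y * - y ≡ fromℕ 2 * (y * y * y) * - 1ℚ
    regroup = solve-∀ ringℚ
    regroup′ : ∀ P → let y = (ℤ.+ 2 / 3) * P in fromℕ 2 * y * y * (y * (y * y * y)) ≡ (ℤ.+ 2 / 3) * y * y * (fromℕ 2 * (y * y * y) * P)
    regroup′ = solve-∀ ringℚ

  -- This step meets the factors a + n = y and 2a + n′ + n + 1 = 2y. They are moved from V to the
  -- known product, which is why `w-zero-scaled` carries 2y², and no precision is lost.
  w-first : w n′ 1 ≋ C * h 0 [ C * P ]
  w-first = transfer C Unit-U (Integral-* (Integral-ℕ n) (_~_.integralˡ η~)) relation w-zero-scaled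
    (≋-trans (≋-*ʳ (Integral-neg (Integral-ℕ 1)) (~-cong (~-* (~-ℕ n) η~)))
      (≋-trans (≋-reflexive balance) (≋-neg (≋-*ʳ (Integral-* (Integral-ℕ 1) (Integral-^ m₀ (Integral-ℕ 1))) (≋-sym (~-cong (~-* U₀~ δ~)))))))
    where
    open Step n′ 0 (cong suc (ℕ.+-identityʳ n′))
    Unit-U : Unit (U₀ n′ 0 * δ n′)
    Unit-U = Unit-* Unit-U₀ (Unit-resp-~ (Unit-neg (Unit-ℕ (n ℕ.+ 1) (subst (λ t → ¬ p ∣ t) (ℕ.+-comm 1 n) (p∤≤n+1 ℕ.≤-refl)))) δ~)
    relation : N * (fromℕ 1 - a) * (fromℕ 2 * y * y * w n 0) ≡ - (U₀ n′ 0 * δ n′ * w n′ 1)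
    relation = trans (trans (regroup N (fromℕ 1 - a) y (w n 0)) (cong₂ (λ t u → t * N * u * (fromℕ 1 - a) * w n 0) (sym a+N≡y) 2y≡)) (w-step n′ 0)
      where
      regroup : ∀ N η y w → N * η * (fromℕ 2 * y * y * w) ≡ y * N * (fromℕ 2 * y) * η * w
      regroup = solve-∀ ringℚ
      2y≡ : fromℕ 2 * y ≡ a + a + fromℕ n′ + fromℕ (suc n)
      2y≡ = begin
        fromℕ 2 * y                              ≡⟨ cong (fromℕ 2 *_) (trans (sym a+N≡y) (cong (a +_) (fromℕ-suc n′))) ⟩
        fromℕ 2 * (a + (1ℚ + fromℕ n′))          ≡⟨ spread a (fromℕ n′) ⟩
        a + a + fromℕ n′ + (fromℕ 2 + fromℕ n′)  ≡⟨ cong (λ t → a + a + fromℕ n′ + t) (fromℕ-+ 2 n′) ⟨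
        a + a + fromℕ n′ + fromℕ (suc n)         ∎
        where
        spread : ∀ a n → fromℕ 2 * (a + (1ℚ + n)) ≡ a + a + n + (fromℕ 2 + n)
        spread = solve-∀ ringℚ
    balance : N * fromℕ (n ℕ.+ 1) * - 1ℚ ≡ - (- (fromℕ 1 * fromℕ 1 * N) * - fromℕ (n ℕ.+ 1) * (1ℚ * fromℕ 1 ^ m₀))
    balance = trans (signs N (fromℕ (n ℕ.+ 1))) (cong (λ t → - (- (fromℕ 1 * fromℕ 1 * N) * - fromℕ (n ℕ.+ 1) * (1ℚ * t))) (sym (1^ m₀)))
      where
      signs : ∀ N M → N * M * - 1ℚ ≡ - (- (1ℚ * 1ℚ * N) * - M * (1ℚ * 1ℚ))
      signs = solve-∀ ringℚ

  -- Modulo p the quotient of `V₀` by `U₀` is -(j + 1)²/(j + 2)², which is also the ratio of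
  -- consecutive values of `h`.
  V₀h : ∀ m j → (m+j : suc m ℕ.+ suc j ≡ n) → V₀ m (suc j) * h j ≋ U₀ m (suc j) * h (suc j) [ P ]
  V₀h m j m+j = ≋-trans (≋-*ʳ Ih (~-cong V₀~)) (≋-trans (≋-reflexive left)
    (≋-trans (≋-*ˡ Iks (≋-trans (fermat-unit (suc j) m₀ p∤J refl) (≋-sym (fermat-unit (suc (suc j)) m₀ p∤I refl))))
      (≋-trans (≋-reflexive (right K s I (I ^ m₀))) (≋-*ʳ Ih′ (≋-sym (~-cong U₀~))))))
    where
    open Step m (suc j) m+j
    s = (- 1ℚ) ^ j
    J = fromℕ (suc j)
    Is : ∀ k → Integral ((- 1ℚ) ^ k)
    Is k = Integral-^ k (Integral-neg (Integral-ℕ 1))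
    Ih = Integral-* (Is j) (Integral-^ m₀ (Integral-ℕ (suc j)))
    Ih′ = Integral-* (Is (suc j)) (Integral-^ m₀ (Integral-ℕ (suc (suc j))))
    Iks = Integral-* (Integral-ℕ (suc m)) (Is j)
    p∤I : ¬ p ∣ suc (suc j)
    p∤I = p∤≤n+1 (ℕ.s≤s (ℕ.m≤n⇒m≤1+n i≤n′))
    p∤J : ¬ p ∣ suc j
    p∤J = p∤≤n+1 (ℕ.m≤n⇒m≤1+n (ℕ.m≤n⇒m≤1+n i≤n′))
    left : (1ℚ - I) * (1ℚ - I) * K * (s * J ^ m₀) ≡ K * s * (J * J * J ^ m₀)
    left = trans (cong (λ t → (1ℚ - t) * (1ℚ - t) * K * (s * J ^ m₀)) (fromℕ-suc (suc j))) (collect J K s (J ^ m₀))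
      where
      collect : ∀ J K s X → (1ℚ - (1ℚ + J)) * (1ℚ - (1ℚ + J)) * K * (s * X) ≡ K * s * (J * J * X)
      collect = solve-∀ ringℚ
    right : ∀ K s I X → K * s * (I * I * X) ≡ - (I * I * K) * (- 1ℚ * s * X)
    right = solve-∀ ringℚ

  -- Away from the crossing I - a and 2a + m are units congruent to n + I and -(n + I), so their
  -- quotient -1 absorbs the sign in `node-step`. The constant `c` is 1 before the crossing and -1
  -- after it.
  w-regular : ∀ m j c → suc m ℕ.+ suc j ≡ n → ¬ p ∣ n ℕ.+ suc (suc j) → Integral c →
    w (suc m) (suc j) ≋ C * (c * h j) [ C * P ] → w m (suc (suc j)) ≋ C * (c * h (suc j)) [ C * P ]
  w-regular m j c m+j p∤ ic hyp = transfer C (Unit-* Unit-U₀ (Unit-resp-~ (Unit-neg (Unit-ℕ _ p∤)) δ~))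
    (Integral-* (_~_.integralˡ V₀~) (_~_.integralˡ η~)) (w-step m (suc j)) hyp
    (≋-trans (≋-reflexive (regroup (V₀ m (suc j)) (I - a) c (h j)))
      (≋-trans (≋-*ˡ (Integral-* (_~_.integralˡ η~) ic) (V₀h m j m+j))
        (≋-trans (≋-reflexive (regroup″ (I - a) c (U₀ m (suc j)) (h (suc j))))
          (≋-trans (≋-*ʳ Icu (~-cong η~)) (≋-trans (≋-reflexive (regroup′ (U₀ m (suc j)) (fromℕ (n ℕ.+ suc (suc j))) c (h (suc j))))
            (≋-neg (≋-*ʳ (Integral-* ic Ih′) (≋-*ˡ (_~_.integralˡ U₀~) (≋-sym (~-cong δ~))))))))))
    where
    open Step m (suc j) m+j
    Ih′ : Integral (h (suc j))
    Ih′ = Integral-* (Integral-^ (suc j) (Integral-neg (Integral-ℕ 1))) (Integral-^ m₀ (Integral-ℕ (suc (suc j))))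
    Icu = Integral-* ic (Integral-* (_~_.integralˡ U₀~) Ih′)
    regroup : ∀ V η c h → V * η * (c * h) ≡ η * c * (V * h)
    regroup = solve-∀ ringℚ
    regroup″ : ∀ η c U h → η * c * (U * h) ≡ η * (c * (U * h))
    regroup″ = solve-∀ ringℚ
    regroup′ : ∀ U M c h → M * (c * (U * h)) ≡ - (U * - M * (c * h))
    regroup′ = solve-∀ ringℚ

  -- At n + (j + 2) = p the factors I − a and 2a + m are equal and divisible by p;
  -- cancelling them costs a sign.
  w-crossing : ∀ m → suc m ℕ.+ suc (2 ℕ.* l) ≡ n →
    w (suc m) (suc (2 ℕ.* l)) ≋ C * h (2 ℕ.* l) [ C * P ] → w m (suc (suc (2 ℕ.* l))) ≋ C * (- 1ℚ * h (suc (2 ℕ.* l))) [ C * P ]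
  w-crossing m m+j hyp = transfer C Unit-U₀ (_~_.integralˡ V₀~)
    (*-cancelˡ-≡ (two-thirds≢0 m) (trans (cong (_* (V₀ m (suc j) * w (suc m) (suc j))) (sym η≡δ)) (trans (swap (I - a) (V₀ m (suc j)) (w (suc m) (suc j)))
      (trans (w-step m (suc j)) (swap′ (U₀ m (suc j)) (δ m) (w m (suc (suc j)))))))) hyp
    (≋-trans (V₀h m j m+j) (≋-reflexive (signs (U₀ m (suc j)) (h (suc j)))))
    where
    j = 2 ℕ.* l
    open Step m (suc j) m+j
    swap : ∀ x V w → x * (V * w) ≡ V * x * w
    swap = solve-∀ ringℚ
    swap′ : ∀ U d w → - (U * d * w) ≡ d * - (U * w)
    swap′ = solve-∀ ringℚ
    signs : ∀ U h → U * h ≡ - (U * (- 1ℚ * h))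
    signs = solve-∀ ringℚ
    η≡δ : I - a ≡ δ m
    η≡δ = begin
      I - a                                              ≡⟨ shift I a (fromℕ m) ⟩
      a + a + fromℕ m + (I + I - (a + a + a) - (fromℕ m + I))  ≡⟨ cong₂ (λ t u → a + a + fromℕ m + (t + t - 1ℚ - u)) (fromℕ-linear 2 2) m+I ⟩
      a + a + fromℕ m + (fromℕ 2 + fromℕ 2 * ℓ + (fromℕ 2 + fromℕ 2 * ℓ) - 1ℚ - (fromℕ 3 + fromℕ 4 * ℓ))  ≡⟨ vanish (a + a + fromℕ m) ℓ ⟩
      δ m ∎
      where
      shift : ∀ I a m → I - a ≡ a + a + m + (I + I - (a + a + a) - (m + I))
      shift = solve-∀ ringℚ
      vanish : ∀ d x → d + (fromℕ 2 + fromℕ 2 * x + (fromℕ 2 + fromℕ 2 * x) - 1ℚ - (fromℕ 3 + fromℕ 4 * x)) ≡ d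
      vanish = solve-∀ ringℚ
      m+I : fromℕ m + I ≡ fromℕ 3 + fromℕ 4 * ℓ
      m+I = trans (sym (fromℕ-+ m (suc (suc j)))) (trans (cong fromℕ (trans (ℕ.+-suc m (suc j)) m+j)) (fromℕ-linear 3 4))

  -- Here n + j + 1 ≤ n + 2l + 1 = p - 1, so after the first step every step is regular.
  w-lower : ∀ j m → suc m ℕ.+ j ≡ n → j ℕ.≤ 2 ℕ.* l → w m (suc j) ≋ C * h j [ C * P ]
  w-lower zero    m e _  = subst (λ t → w t 1 ≋ C * h 0 [ C * P ]) (sym (ℕ.suc-injective (trans (sym (ℕ.+-identityʳ (suc m))) e))) w-first
  w-lower (suc j) m e j<2l = subst (λ t → w m (suc (suc j)) ≋ C * t [ C * P ]) (*-identityˡ (h (suc j)))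
    (w-regular m j 1ℚ e (p∤suc (subst (ℕ._< p) (sym (trans (ℕ.+-suc n (suc j)) (cong suc (ℕ.+-assoc 3 (4 ℕ.* l) (suc j))))) bound)) (Integral-ℕ 1)
      (subst (λ t → w (suc m) (suc j) ≋ C * t [ C * P ]) (sym (*-identityˡ (h j)))
        (w-lower j (suc m) (trans (sym (ℕ.+-suc (suc m) j)) e) (ℕ.≤-trans (ℕ.n≤1+n j) j<2l))))
    where
    bound : 4 ℕ.+ (4 ℕ.* l ℕ.+ suc j) ℕ.< p
    bound = small 4 ℕ.≤-refl (ℕ.≤-trans (ℕ.+-monoʳ-≤ (4 ℕ.* l) j<2l) (ℕ.≤-reflexive (sym (ℕ.*-distribʳ-+ l 4 2))))

  -- The case t = 0 is the crossing, where n + (2l + 2) = p. Later steps have p + t in place of p,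
  -- with 0 < t < p, and are regular again.
  w-upper : ∀ t m → suc m ℕ.+ (suc (2 ℕ.* l) ℕ.+ t) ≡ n →
    w m (suc (suc (2 ℕ.* l) ℕ.+ t)) ≋ C * (- 1ℚ * h (suc (2 ℕ.* l) ℕ.+ t)) [ C * P ]
  w-upper zero m e = subst (λ t → w m (suc t) ≋ C * (- 1ℚ * h t) [ C * P ]) (sym (ℕ.+-identityʳ (suc (2 ℕ.* l))))
    (w-crossing m e′ (w-lower (2 ℕ.* l) (suc m) (trans (sym (ℕ.+-suc (suc m) (2 ℕ.* l))) e′) ℕ.≤-refl))
    where
    e′ : suc m ℕ.+ suc (2 ℕ.* l) ≡ n
    e′ = trans (cong (suc m ℕ.+_) (sym (ℕ.+-identityʳ (suc (2 ℕ.* l))))) e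
  w-upper (suc t) m e = subst (λ t → w m (suc t) ≋ C * (- 1ℚ * h t) [ C * P ]) (sym (ℕ.+-suc (suc (2 ℕ.* l)) t))
    (w-regular m j (- 1ℚ) e′ p∤ (Integral-neg (Integral-ℕ 1)) (w-upper t (suc m) (trans (sym (ℕ.+-suc (suc m) j)) e′)))
    where
    j = suc (2 ℕ.* l) ℕ.+ t
    e′ : suc m ℕ.+ suc j ≡ n
    e′ = trans (cong (suc m ℕ.+_) (sym (ℕ.+-suc (suc (2 ℕ.* l)) t))) e
    n+j+2≡ : n ℕ.+ suc (suc j) ≡ p ℕ.+ suc t
    n+j+2≡ = begin
      3 ℕ.+ 4 ℕ.* l ℕ.+ (3 ℕ.+ (2 ℕ.* l ℕ.+ t))      ≡⟨ rearrange l t ⟩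
      p ℕ.+ suc t                                   ∎
      where
      rearrange : ∀ l t → 3 ℕ.+ 4 ℕ.* l ℕ.+ (3 ℕ.+ (2 ℕ.* l ℕ.+ t)) ≡ 5 ℕ.+ 6 ℕ.* l ℕ.+ suc t
      rearrange = solve 2 (λ l t → con 3 :+ con 4 :* l :+ (con 3 :+ (con 2 :* l :+ t)) := con 5 :+ con 6 :* l :+ (con 1 :+ t)) refl
    t<p : suc t ℕ.< p
    t<p = ℕ.<-trans (ℕ.s≤s (subst (suc t ℕ.≤_) e (ℕ.≤-trans (ℕ.m≤n+m (suc t) (suc (2 ℕ.* l))) (ℕ.m≤n+m _ (suc m))))) n+1<p
    p∤ : ¬ p ∣ n ℕ.+ suc (suc j)
    p∤ p∣ = p∤suc t<p (∣m+n∣m⇒∣n (subst (p ∣_) n+j+2≡ p∣) ∣-refl)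

  private
    P⁴ : ℚ
    P⁴ = P ^ 4

    two-thirds : Integral (ℤ.+ 2 / 3)
    two-thirds = Integral-thirds 2 refl

    weaken-y³P : ∀ {s t} → s ≋ t [ y * y * y * P ] → s ≋ t [ P⁴ ]
    weaken-y³P {s} {t} s≋t = ≋-weaken (Integral-* (Integral-* two-thirds two-thirds) two-thirds) (subst (λ M → s ≋ t [ M ]) (regroup P) s≋t)
      where
      regroup : ∀ P → (ℤ.+ 2 / 3) * P * ((ℤ.+ 2 / 3) * P) * ((ℤ.+ 2 / 3) * P) * P ≡ (ℤ.+ 2 / 3) * (ℤ.+ 2 / 3) * (ℤ.+ 2 / 3) * (P * (P * (P * (P * 1ℚ))))
      regroup = solve-∀ ringℚ

    weaken-y⁴ : ∀ {s t} → s ≋ t [ y * cube y ] → s ≋ t [ P⁴ ]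
    weaken-y⁴ {s} {t} s≋t = weaken-y³P (≋-weaken two-thirds (subst (λ M → s ≋ t [ M ]) (regroup P) s≋t))
      where
      regroup : ∀ P → let y = (ℤ.+ 2 / 3) * P in y * (y * y * y) ≡ (ℤ.+ 2 / 3) * (y * y * y * P)
      regroup = solve-∀ ringℚ

    weaken-CP : ∀ {s t} → s ≋ t [ C * P ] → s ≋ t [ P⁴ ]
    weaken-CP {s} {t} s≋t = weaken-y³P (≋-weaken (Integral-ℕ 2) (subst (λ M → s ≋ t [ M ]) (regroup y P) s≋t))
      where
      regroup : ∀ y P → fromℕ 2 * (y * y * y) * P ≡ fromℕ 2 * (y * y * y * P)
      regroup = solve-∀ ringℚ

  -- The indices beyond the crossing run from 2l + 1 to 4l + 2. These ends add up to p - 2, so by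
  -- `h-antisymmetric` this part of the sum vanishes modulo p, and `C` supplies the other p³.
  Δ-w : Δ n′ (λ j m → w m (suc j)) ≋ C * Δ (2 ℕ.* l) (λ j _ → h j) [ P⁴ ]
  Δ-w = ≋-trans (≋-reflexive (begin
      Δ n′ (λ j m → w m (suc j))
        ≡⟨ Δ-cong n′ (λ j m e → cong (λ t → w t (suc j)) (sym (trans (cong (_∸ j) (sym e)) (ℕ.m+n∸m≡n j m)))) ⟩
      Δ n′ (λ j _ → f j)
        ≡⟨ cong (λ t → Δ t (λ j _ → f j)) n′≡ ⟩
      Δ (2 ℕ.* l ℕ.+ suc (suc (2 ℕ.* l))) (λ j _ → f j)
        ≡⟨ Δ-split (2 ℕ.* l) (suc (2 ℕ.* l)) f ⟩
      Δ (2 ℕ.* l) (λ j _ → f j) + Δ (suc (2 ℕ.* l)) (λ t _ → f (suc (2 ℕ.* l) ℕ.+ t)) ∎))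
    (≋-trans (≋-+ (weaken-CP (≋-trans (≋-Δ (2 ℕ.* l) lower) (≋-reflexive (Δ-*ˡ (2 ℕ.* l) C (λ j _ → h j)))))
        (weaken-CP (≋-trans (≋-Δ (suc (2 ℕ.* l)) upper) (≋-trans (≋-reflexive (trans (Δ-*ˡ (suc (2 ℕ.* l)) C (λ t _ → - 1ℚ * h (suc (2 ℕ.* l) ℕ.+ t)))
            (cong (C *_) (Δ-*ˡ (suc (2 ℕ.* l)) (- 1ℚ) (λ t _ → h (suc (2 ℕ.* l) ℕ.+ t)))))) (≋-scale C (≋-*ˡ (Integral-neg (Integral-ℕ 1)) middle))))))
      (≋-reflexive (drop C (Δ (2 ℕ.* l) (λ j _ → h j)))))
    where
    f : ℕ → ℚ
    f j = w (n′ ∸ j) (suc j)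
    drop : ∀ C x → C * x + C * (- 1ℚ * 0ℚ) ≡ C * x
    drop = solve-∀ ringℚ
    4l≡ : 4 ℕ.* l ≡ 2 ℕ.* l ℕ.+ 2 ℕ.* l
    4l≡ = ℕ.*-distribʳ-+ l 2 2
    n′≡ : n′ ≡ 2 ℕ.* l ℕ.+ suc (suc (2 ℕ.* l))
    n′≡ = trans (cong (2 ℕ.+_) 4l≡) (sym (trans (ℕ.+-suc (2 ℕ.* l) (suc (2 ℕ.* l))) (cong suc (ℕ.+-suc (2 ℕ.* l) (2 ℕ.* l)))))
    index : ∀ j → j ℕ.≤ n′ → suc (n′ ∸ j) ℕ.+ j ≡ n
    index j j≤ = cong suc (ℕ.m∸n+n≡m j≤)
    2l≤n′ : 2 ℕ.* l ℕ.≤ n′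
    2l≤n′ = subst (2 ℕ.* l ℕ.≤_) (sym n′≡) (ℕ.m≤m+n (2 ℕ.* l) (suc (suc (2 ℕ.* l))))
    lower : ∀ j k → j ℕ.+ k ≡ 2 ℕ.* l → f j ≋ C * h j [ C * P ]
    lower j k e = w-lower j (n′ ∸ j) (index j (ℕ.≤-trans j≤ 2l≤n′)) j≤
      where
      j≤ : j ℕ.≤ 2 ℕ.* l
      j≤ = subst (j ℕ.≤_) e (ℕ.m≤m+n j k)
    upper : ∀ t k → t ℕ.+ k ≡ suc (2 ℕ.* l) → f (suc (2 ℕ.* l) ℕ.+ t) ≋ C * (- 1ℚ * h (suc (2 ℕ.* l) ℕ.+ t)) [ C * P ]
    upper t k e = w-upper t (n′ ∸ (suc (2 ℕ.* l) ℕ.+ t)) (index (suc (2 ℕ.* l) ℕ.+ t)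
      (subst (suc (2 ℕ.* l) ℕ.+ t ℕ.≤_) (sym (trans n′≡ (ℕ.+-suc (2 ℕ.* l) (suc (2 ℕ.* l))))) (ℕ.+-monoʳ-≤ (suc (2 ℕ.* l)) (subst (t ℕ.≤_) e (ℕ.m≤m+n t k)))))
    middle : Δ (suc (2 ℕ.* l)) (λ t _ → h (suc (2 ℕ.* l) ℕ.+ t)) ≋ 0ℚ [ P ]
    middle = Δ-antisymmetric p∤2 (suc (2 ℕ.* l)) (λ t → h (suc (2 ℕ.* l) ℕ.+ t))
      (λ t u e → h-antisymmetric (suc (2 ℕ.* l) ℕ.+ t) (suc (2 ℕ.* l) ℕ.+ u) (trans (rearrange l t u) (trans (cong (λ s → 2 ℕ.+ 4 ℕ.* l ℕ.+ s) e) (rearrange′ l))))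
      where
      rearrange : ∀ l t u → suc (2 ℕ.* l) ℕ.+ t ℕ.+ (suc (2 ℕ.* l) ℕ.+ u) ≡ 2 ℕ.+ 4 ℕ.* l ℕ.+ (t ℕ.+ u)
      rearrange = solve 3 (λ l t u → con 1 :+ con 2 :* l :+ t :+ (con 1 :+ con 2 :* l :+ u) := con 2 :+ con 4 :* l :+ (t :+ u)) refl
      rearrange′ : ∀ l → 2 ℕ.+ 4 ℕ.* l ℕ.+ suc (2 ℕ.* l) ≡ 3 ℕ.+ 6 ℕ.* l
      rearrange′ = solve 1 (λ l → con 2 :+ con 4 :* l :+ (con 1 :+ con 2 :* l) := con 3 :+ con 6 :* l) refl

  -- The sum up to (2p - 1)/3.

  cubicTerm : ℕ → ℚ
  cubicTerm = term a third≢0 two-thirds≢0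

  -- With E the Euler value, y = 2p/3 gives 3 (-y + y³ E) = -2p + (8/9) p³ E; the 2 in `C` is used
  -- up by the doubled sum in `Δ-h`.
  Δ-cubicTerm-n : fromℕ 3 * Δ n (λ k _ → cubicTerm k) ≋ - (fromℕ 2 * P) + (ℤ.+ 8 / 9) * P ^ 3 * euler m₀ a [ P⁴ ]
  Δ-cubicTerm-n = ≋-trans (≋-*ˡ (Integral-ℕ 3) (≋-trans (≋-reflexive expand)
      (≋-+ (weaken-y⁴ w-zero) (≋-trans Δ-w (≋-trans (≋-reflexive (regroup y (Δ (2 ℕ.* l) (λ j _ → h j)))) (weaken-y³P (≋-scale (y * y * y) Δ-h)))))))
    (≋-reflexive (collect P (euler m₀ a)))
    where
    weightₐ : ℕ → ℕ → ℚ
    weightₐ = weight a third≢0 two-thirds≢0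
    expand : Δ n (λ k _ → cubicTerm k) ≡ w n 0 + Δ n′ (λ j m → w m (suc j))
    expand = trans (Δ-term a third≢0 two-thirds≢0 n) (trans (Δ-flip n weightₐ) (cong₂ _+_ (cong (λ t → node a third≢0 two-thirds≢0 t n 0) (ℕ.+-identityʳ n))
      (Δ-cong n′ (λ j m e → cong (λ t → node a third≢0 two-thirds≢0 t m (suc j)) (trans (ℕ.+-suc m j) (cong suc (trans (ℕ.+-comm m j) e)))))))
    regroup : ∀ y x → fromℕ 2 * (y * y * y) * x ≡ y * y * y * (fromℕ 2 * x)
    regroup = solve-∀ ringℚ
    collect : ∀ P E → fromℕ 3 * (- ((ℤ.+ 2 / 3) * P) + (ℤ.+ 2 / 3) * P * ((ℤ.+ 2 / 3) * P) * ((ℤ.+ 2 / 3) * P) * E)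
      ≡ - (fromℕ 2 * P) + (ℤ.+ 8 / 9) * (P * (P * (P * 1ℚ))) * E
    collect = solve-∀ ringℚ

  -- The terms with (2p - 1)/3 < k < p.

  v : ℕ → ℚ
  v j = pochhammer a n * pochhammer (y + 1ℚ) j * invFact (suc n ℕ.+ j)

  Integral-v : ∀ j → j ℕ.≤ 2 ℕ.* l → Integral (v j)
  Integral-v j j≤ = Integral-* (Integral-* (Integral-pochhammer n Integral-a) (Integral-pochhammer j (Integral-+ Integral-y (Integral-ℕ 1))))
    (Integral-invFact (suc n ℕ.+ j) (small 4 ℕ.≤-refl (subst (4 ℕ.* l ℕ.+ j ℕ.≤_) (sym (ℕ.*-distribʳ-+ l 4 2)) (ℕ.+-monoʳ-≤ (4 ℕ.* l) j≤))))

  pochhammer-beyond : ∀ j → pochhammer a (suc n ℕ.+ j) ≡ pochhammer a n * y * pochhammer (y + 1ℚ) j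
  pochhammer-beyond zero    = begin
    pochhammer a (suc n ℕ.+ 0)   ≡⟨ cong (pochhammer a) (ℕ.+-identityʳ (suc n)) ⟩
    pochhammer a n * (a + N)     ≡⟨ cong (pochhammer a n *_) a+N≡y ⟩
    pochhammer a n * y           ≡⟨ *-identityʳ (pochhammer a n * y) ⟨
    pochhammer a n * y * 1ℚ      ∎
  pochhammer-beyond (suc j) = begin
    pochhammer a (suc n ℕ.+ suc j)
      ≡⟨ cong (pochhammer a) (ℕ.+-suc (suc n) j) ⟩
    pochhammer a (suc n ℕ.+ j) * (a + fromℕ (suc n ℕ.+ j))
      ≡⟨ cong₂ _*_ (pochhammer-beyond j) factor ⟩
    pochhammer a n * y * pochhammer (y + 1ℚ) j * (y + 1ℚ + fromℕ j)
      ≡⟨ *-assoc (pochhammer a n * y) (pochhammer (y + 1ℚ) j) (y + 1ℚ + fromℕ j) ⟩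
    pochhammer a n * y * pochhammer (y + 1ℚ) (suc j) ∎
    where
    factor : a + fromℕ (suc n ℕ.+ j) ≡ y + 1ℚ + fromℕ j
    factor = trans (cong (a +_) (trans (fromℕ-+ (suc n) j) (cong (_+ fromℕ j) (fromℕ-suc n)))) (trans (regroup a N (fromℕ j)) (cong (λ t → t + 1ℚ + fromℕ j) a+N≡y))
      where
      regroup : ∀ a N j → a + (1ℚ + N + j) ≡ a + N + 1ℚ + j
      regroup = solve-∀ ringℚ

  -- Modulo p the factors are -(2l - j) on the left and j + 1 on the right. So for j ≤ 2l, `v j` is
  -- congruent to (-1)ʲ `v 0` divided by the binomial coefficient of 2l over j, which is where the
  -- symmetry about j = l comes from.
  v-suc : ∀ j → fromℕ (suc (suc n ℕ.+ j)) * v (suc j) ≡ (y + 1ℚ + fromℕ j) * v j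
  v-suc j = begin
    fromℕ (suc (suc n ℕ.+ j)) * (A * (S * x) * invFact (suc n ℕ.+ suc j))
      ≡⟨ cong (λ t → fromℕ (suc (suc n ℕ.+ j)) * (A * (S * x) * invFact t)) (ℕ.+-suc (suc n) j) ⟩
    fromℕ (suc (suc n ℕ.+ j)) * (A * (S * x) * invFact (suc (suc n ℕ.+ j)))
      ≡⟨ rearrange (fromℕ (suc (suc n ℕ.+ j))) A S x (invFact (suc (suc n ℕ.+ j))) ⟩
    x * (A * S * (fromℕ (suc (suc n ℕ.+ j)) * invFact (suc (suc n ℕ.+ j))))
      ≡⟨ cong (λ t → x * (A * S * t)) (invFact-suc (suc n ℕ.+ j)) ⟨
    x * v j ∎
    where
    A = pochhammer a n
    S = pochhammer (y + 1ℚ) j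
    x = y + 1ℚ + fromℕ j
    rearrange : ∀ k A S x F → k * (A * (S * x) * F) ≡ x * (A * S * (k * F))
    rearrange = solve-∀ ringℚ

  2l≡l+l : 2 ℕ.* l ≡ l ℕ.+ l
  2l≡l+l = cong (l ℕ.+_) (ℕ.+-identityʳ l)

  -- The recursion v-suc read upwards from j = l and downwards from j = l gives the same factors mod p.
  v-reflect : ∀ d e → d ℕ.+ e ≡ l → v (l ℕ.+ d) ≋ v e [ P ]
  v-reflect zero    e refl = ≋-reflexive (cong v (ℕ.+-identityʳ e))
  v-reflect (suc d) e eq = ≋-cancel (Unit-neg (Unit-ℕ (suc e) p∤e)) (≋-trans
      (≋-*ʳ (Integral-v (l ℕ.+ suc d) (subst (l ℕ.+ suc d ℕ.≤_) (sym 2l≡l+l) (ℕ.+-monoʳ-≤ l d<l))) (≋-sym up))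
      (≋-trans (≋-reflexive (trans (cong (λ t → fromℕ (suc (suc n ℕ.+ (l ℕ.+ d))) * v t) (ℕ.+-suc l d)) (v-suc (l ℕ.+ d))))
        (≋-trans (≋-* Ix (Integral-v (suc e) e<) (≋-trans (~-cong y+) (≋-sym (≋-trans (≋-neg down) (≋-reflexive (involutive (fromℕ (suc (l ℕ.+ d)))))))) (v-reflect d (suc e) (trans (ℕ.+-suc d e) eq)))
          (≋-trans (≋-reflexive (trans (pull (fromℕ (suc (suc n ℕ.+ e))) (v (suc e))) (trans (cong (λ t → - t) (v-suc e)) (push (y + 1ℚ + fromℕ e) (v e)))))
            (≋-*ʳ (Integral-v e (ℕ.≤-trans (ℕ.n≤1+n e) e<)) (≋-neg (~-cong y+e)))))))
    where
    d<l : suc d ℕ.≤ l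
    d<l = subst (suc d ℕ.≤_) eq (ℕ.m≤m+n (suc d) e)
    e< : suc e ℕ.≤ 2 ℕ.* l
    e< = ℕ.≤-trans (subst (suc e ℕ.≤_) (trans (ℕ.+-suc d e) eq) (ℕ.m≤n+m (suc e) d)) (ℕ.m≤m+n l (l ℕ.+ 0))
    p∤e : ¬ p ∣ suc e
    p∤e = p∤suc (ℕ.≤-<-trans e< (small 0 ℕ.z≤n (ℕ.*-monoˡ-≤ l {2} {6} (ℕ.s≤s (ℕ.s≤s ℕ.z≤n)))))
    Ix : Integral (y + 1ℚ + fromℕ (l ℕ.+ d))
    Ix = Integral-+ (Integral-+ Integral-y (Integral-ℕ 1)) (Integral-ℕ (l ℕ.+ d))
    shift : ∀ k → y + 1ℚ + fromℕ k ~ fromℕ (suc k)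
    shift k = ~-trans (~-+ (~-+ y~0 (~-ℕ 1)) (~-ℕ k)) (~-reflexive (Integral-ℕ (suc k)) (trans (cong (_+ fromℕ k) (+-identityˡ 1ℚ)) (sym (fromℕ-suc k))))
    y+ : y + 1ℚ + fromℕ (l ℕ.+ d) ~ fromℕ (suc (l ℕ.+ d))
    y+ = shift (l ℕ.+ d)
    y+e : y + 1ℚ + fromℕ e ~ fromℕ (suc e)
    y+e = shift e
    opposite : ∀ i k → i ℕ.+ k ≡ p → fromℕ i ≋ - fromℕ k [ P ]
    opposite i k i+k≡p = congruent 1ℚ (Integral-ℕ 1) (trans (add (fromℕ i) (fromℕ k)) (trans (sym (fromℕ-+ i k)) (trans (cong fromℕ i+k≡p) (sym (*-identityʳ P)))))
      where
      add : ∀ x y → x - - y ≡ x + y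
      add = solve-∀ ringℚ
    up-sum : ∀ d e → suc d ℕ.+ e ≡ l → suc (suc n ℕ.+ (l ℕ.+ d)) ℕ.+ suc e ≡ p
    up-sum d e refl = solve 2 (λ d e → con 5 :+ con 4 :* (con 1 :+ (d :+ e)) :+ (con 1 :+ (d :+ e) :+ d) :+ (con 1 :+ e) := con 5 :+ con 6 :* (con 1 :+ (d :+ e))) refl d e
    down-sum : ∀ d e → suc d ℕ.+ e ≡ l → suc (suc n ℕ.+ e) ℕ.+ suc (l ℕ.+ d) ≡ p
    down-sum d e refl = solve 2 (λ d e → con 5 :+ con 4 :* (con 1 :+ (d :+ e)) :+ e :+ (con 1 :+ (con 1 :+ (d :+ e) :+ d)) := con 5 :+ con 6 :* (con 1 :+ (d :+ e))) refl d e
    up : fromℕ (suc (suc n ℕ.+ (l ℕ.+ d))) ≋ - fromℕ (suc e) [ P ]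
    up = opposite _ _ (up-sum d e eq)
    down : fromℕ (suc (suc n ℕ.+ e)) ≋ - fromℕ (suc (l ℕ.+ d)) [ P ]
    down = opposite _ _ (down-sum d e eq)
    involutive : ∀ x → - - x ≡ x
    involutive = solve-∀ ringℚ
    pull : ∀ x v → - x * v ≡ - (x * v)
    pull = solve-∀ ringℚ
    push : ∀ x v → - (x * v) ≡ - x * v
    push = solve-∀ ringℚ

  v-symmetric : ∀ j k → j ℕ.+ k ≡ 2 ℕ.* l → v j ≋ v k [ P ]
  v-symmetric j k e with ℕ.≤-total l j
  ... | inj₁ l≤j = subst (λ t → v t ≋ v k [ P ]) (ℕ.m+[n∸m]≡n l≤j) (v-reflect (j ∸ l) k (ℕ.+-cancelˡ-≡ l (j ∸ l ℕ.+ k) l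
    (trans (sym (ℕ.+-assoc l (j ∸ l) k)) (trans (cong (ℕ._+ k) (ℕ.m+[n∸m]≡n l≤j)) (trans e 2l≡l+l)))))
  ... | inj₂ j≤l = ≋-sym (subst (λ t → v t ≋ v j [ P ]) l+d≡k (v-reflect (l ∸ j) j (ℕ.m∸n+n≡m j≤l)))
    where
    l+d≡k : l ℕ.+ (l ∸ j) ≡ k
    l+d≡k = ℕ.+-cancelˡ-≡ j (l ℕ.+ (l ∸ j)) k (begin
      j ℕ.+ (l ℕ.+ (l ∸ j))      ≡⟨ ℕ.+-comm j (l ℕ.+ (l ∸ j)) ⟩
      l ℕ.+ (l ∸ j) ℕ.+ j        ≡⟨ ℕ.+-assoc l (l ∸ j) j ⟩
      l ℕ.+ (l ∸ j ℕ.+ j)        ≡⟨ cong (l ℕ.+_) (ℕ.m∸n+n≡m j≤l) ⟩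
      l ℕ.+ l                    ≡⟨ trans e 2l≡l+l ⟨
      j ℕ.+ k                    ∎)

  reduced : ℕ → ℚ
  reduced j = (- 1ℚ) ^ (suc n ℕ.+ j) * (a + fromℕ 2 * fromℕ (suc n ℕ.+ j)) * cube (v j)

  cubicTerm-beyond : ∀ j → cubicTerm (suc n ℕ.+ j) ≡ y * y * y * reduced j
  cubicTerm-beyond j = trans (cong (λ t → s * q * cube (t * F)) (pochhammer-beyond j)) (rearrange s q (pochhammer a n) y (pochhammer (y + 1ℚ) j) F)
    where
    s = (- 1ℚ) ^ (suc n ℕ.+ j)
    q = a + fromℕ 2 * fromℕ (suc n ℕ.+ j)
    F = invFact (suc n ℕ.+ j)
    rearrange : ∀ s q A y S F → s * q * (A * y * S * F * (A * y * S * F) * (A * y * S * F)) ≡ y * y * y * (s * q * (A * S * F * (A * S * F) * (A * S * F)))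
    rearrange = solve-∀ ringℚ

  -- The alternating signs agree because j + k is even, and the cubes agree by `v-symmetric`. The
  -- minus sign is due to the linear factors, whose sum is 2a + 4(n + 1) + 4l = 10p/3.
  reduced-antisymmetric : ∀ j k → j ℕ.+ k ≡ 2 ℕ.* l → reduced k ≋ - reduced j [ P ]
  reduced-antisymmetric j k e = ≋-trans
    (≋-* (Integral-* (Is (suc n ℕ.+ k)) (Iq k)) (Integral-cube (Integral-v j j≤)) (≋-*ˡ (Is (suc n ℕ.+ k)) opposite)
      (≋-* (Integral-* Ivk Ivk) (Integral-v j j≤) (≋-* Ivk (Integral-v j j≤) vk≋vj vk≋vj) vk≋vj))
    (≋-reflexive (trans (cong (λ t → t * - q j * cube (v j)) same-sign) (pull ((- 1ℚ) ^ (suc n ℕ.+ j)) (q j) (cube (v j)))))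
    where
    q : ℕ → ℚ
    q j = a + fromℕ 2 * fromℕ (suc n ℕ.+ j)
    Is : ∀ k → Integral ((- 1ℚ) ^ k)
    Is k = Integral-^ k (Integral-neg (Integral-ℕ 1))
    Iq : ∀ k → Integral (q k)
    Iq k = Integral-+ Integral-a (Integral-* (Integral-ℕ 2) (Integral-ℕ (suc n ℕ.+ k)))
    j≤ : j ℕ.≤ 2 ℕ.* l
    j≤ = subst (j ℕ.≤_) e (ℕ.m≤m+n j k)
    Ivk : Integral (v k)
    Ivk = Integral-v k (subst (k ℕ.≤_) e (ℕ.m≤n+m k j))
    vk≋vj : v k ≋ v j [ P ]
    vk≋vj = ≋-sym (v-symmetric j k e)
    pull : ∀ s q c → s * - q * c ≡ - (s * q * c)
    pull = solve-∀ ringℚ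
    same-sign : (- 1ℚ) ^ (suc n ℕ.+ k) ≡ (- 1ℚ) ^ (suc n ℕ.+ j)
    same-sign = trans (^-homo-* (- 1ℚ) (suc n) k) (trans (cong ((- 1ℚ) ^ suc n *_) (trans (sign-other j k 1ℚ (trans (cong ((- 1ℚ) ^_) e) (sign-even l))) (*-identityʳ ((- 1ℚ) ^ j))))
      (sym (^-homo-* (- 1ℚ) (suc n) j)))
    opposite : q k ≋ - q j [ P ]
    opposite = congruent (ℤ.+ 10 / 3) (Integral-thirds 10 refl) (begin
      q k - - q j
        ≡⟨ cong₂ (λ t u → a + fromℕ 2 * t - - (a + fromℕ 2 * u)) (fromℕ-+ (suc n) k) (fromℕ-+ (suc n) j) ⟩
      a + fromℕ 2 * (fromℕ (suc n) + fromℕ k) - - (a + fromℕ 2 * (fromℕ (suc n) + fromℕ j))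
        ≡⟨ gather (fromℕ (suc n)) (fromℕ j) (fromℕ k) ⟩
      (ℤ.+ 2 / 3) + fromℕ 4 * fromℕ (suc n) + fromℕ 2 * (fromℕ j + fromℕ k)
        ≡⟨ cong₂ (λ t u → (ℤ.+ 2 / 3) + fromℕ 4 * t + fromℕ 2 * u) (fromℕ-linear 4 4) (trans (sym (fromℕ-+ j k)) (trans (cong fromℕ e) (fromℕ-* 2 l))) ⟩
      (ℤ.+ 2 / 3) + fromℕ 4 * (fromℕ 4 + fromℕ 4 * ℓ) + fromℕ 2 * (fromℕ 2 * ℓ)
        ≡⟨ factor ℓ ⟩
      (fromℕ 5 + fromℕ 6 * ℓ) * (ℤ.+ 10 / 3)
        ≡⟨ cong (_* (ℤ.+ 10 / 3)) (fromℕ-linear 5 6) ⟨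
      P * (ℤ.+ 10 / 3) ∎)
      where
      gather : ∀ N j k → (ℤ.+ 1 / 3) + fromℕ 2 * (N + k) - - ((ℤ.+ 1 / 3) + fromℕ 2 * (N + j)) ≡ (ℤ.+ 2 / 3) + fromℕ 4 * N + fromℕ 2 * (j + k)
      gather = solve-∀ ringℚ
      factor : ∀ x → (ℤ.+ 2 / 3) + fromℕ 4 * (fromℕ 4 + fromℕ 4 * x) + fromℕ 2 * (fromℕ 2 * x) ≡ (fromℕ 5 + fromℕ 6 * x) * (ℤ.+ 10 / 3)
      factor = solve-∀ ringℚ

  Δ-cubicTerm-p-1 : Δ (4 ℕ.+ 6 ℕ.* l) (λ k _ → cubicTerm k) ≋ Δ n (λ k _ → cubicTerm k) [ P⁴ ]
  Δ-cubicTerm-p-1 = ≋-trans (≋-reflexive (trans (cong (λ t → Δ t (λ k _ → cubicTerm k)) p-1≡)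
      (trans (Δ-split n (2 ℕ.* l) cubicTerm) (cong (λ t → Δ n (λ k _ → cubicTerm k) + t) (trans (Δ-cong (2 ℕ.* l) (λ j _ _ → cubicTerm-beyond j)) (Δ-*ˡ (2 ℕ.* l) (y * y * y) (λ j _ → reduced j)))))))
    (≋-trans (≋-+ (≋-refl {Δ n (λ k _ → cubicTerm k)}) (weaken-y³P (≋-scale (y * y * y) (Δ-antisymmetric p∤2 (2 ℕ.* l) reduced reduced-antisymmetric))))
      (≋-reflexive (trans (cong (λ t → Δ n (λ k _ → cubicTerm k) + t) (*-zeroʳ (y * y * y))) (+-identityʳ (Δ n (λ k _ → cubicTerm k))))))
    where
    p-1≡ : 4 ℕ.+ 6 ℕ.* l ≡ n ℕ.+ suc (2 ℕ.* l)
    p-1≡ = trans (cong (4 ℕ.+_) (ℕ.*-distribʳ-+ l 4 2)) (sym (ℕ.+-suc n (2 ℕ.* l)))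

  -- Return to the stated sum.

  summand≡ : ∀ k → summand k ≡ fromℕ 3 * cubicTerm k
  summand≡ k = begin
    s * fromℕ (6 ℕ.* k ℕ.+ 1) * (A ^ 3 ÷ fromℕ ((k !) ℕ.^ 3))
      ≡⟨ cong₂ (λ t u → s * t * u) (trans (fromℕ-+ (6 ℕ.* k) 1) (cong (_+ 1ℚ) (fromℕ-* 6 k))) (trans (÷-recip (A ^ 3) (fromℕ ((k !) ℕ.^ 3))) (cong (A ^ 3 *_) (sym (recip-unique inverse)))) ⟩
    s * (fromℕ 6 * fromℕ k + 1ℚ) * (A ^ 3 * (F * (F * F)))
      ≡⟨ rearrange s (fromℕ k) A F ⟩
    fromℕ 3 * cubicTerm k ∎
    where
    s = (- 1ℚ) ^ k
    A = pochhammer a k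
    F = invFact k
    f = fromℕ (k !)
    instance
      _ = ℕ.m^n≢0 (k !) 3 {{ℕ._!≢0 k}}
    inverse : fromℕ ((k !) ℕ.^ 3) * (F * (F * F)) ≡ 1ℚ
    inverse = begin
      fromℕ ((k !) ℕ.^ 3) * (F * (F * F))
        ≡⟨ cong (_* (F * (F * F))) (trans (fromℕ-* (k !) ((k !) ℕ.^ 2)) (cong (f *_) (trans (fromℕ-* (k !) ((k !) ℕ.^ 1)) (cong (f *_) (fromℕ-* (k !) 1))))) ⟩
      f * (f * (f * 1ℚ)) * (F * (F * F))
        ≡⟨ pair f F ⟩
      f * F * (f * F * (f * F))
        ≡⟨ cong (λ t → t * (t * t)) (factorial*invFact k) ⟩
      1ℚ ∎
      where
      pair : ∀ f F → f * (f * (f * 1ℚ)) * (F * (F * F)) ≡ f * F * (f * F * (f * F))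
      pair = solve-∀ ringℚ
    rearrange : ∀ s k A F → s * (fromℕ 6 * k + 1ℚ) * (A * (A * (A * 1ℚ)) * (F * (F * F))) ≡ fromℕ 3 * (s * ((ℤ.+ 1 / 3) + fromℕ 2 * k) * (A * F * (A * F) * (A * F)))
    rearrange = solve-∀ ringℚ

  ∑-summand : ∀ M → ∑[ k ≤ M ] summand (toℕ k) ≡ fromℕ 3 * Δ M (λ k _ → cubicTerm k)
  ∑-summand M = trans (∑≡Δ M summand) (trans (Δ-cong M (λ k _ _ → summand≡ k)) (Δ-*ˡ M (fromℕ 3) (λ k _ → cubicTerm k)))

  supercongruence : ∀ M → M ≡ (2 ℕ.* p ∸ 1) ℕ./ 3 ⊎ M ≡ p ∸ 1 →
    (∑[ k ≤ M ] summand (toℕ k)) ≋ - (fromℕ 2 * P) + (ℤ.+ 8 / 9) * P ^ 3 * euler m₀ a [ P⁴ ]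
  supercongruence M (inj₁ refl) = ≋-trans (≋-reflexive (trans (∑-summand M) (cong (λ t → fromℕ 3 * Δ t (λ k _ → cubicTerm k)) M≡n))) Δ-cubicTerm-n
    where
    M≡n : (2 ℕ.* p ∸ 1) ℕ./ 3 ≡ n
    M≡n = trans (cong (λ t → (t ∸ 1) ℕ./ 3) (solve 1 (λ l → con 2 :* (con 5 :+ con 6 :* l) := con 1 :+ (con 3 :+ con 4 :* l) :* con 3) refl l)) (m*n/n≡m n 3)
  supercongruence M (inj₂ refl) = ≋-trans (≋-reflexive (∑-summand M)) (≋-trans (≋-*ˡ (Integral-ℕ 3) Δ-cubicTerm-p-1) Δ-cubicTerm-n)

-- In p = 3q + 2 the quotient q has the parity of p, and q = 2r + 1 gives p = 6r + 5.
odd∧2mod3⇒5mod6 : ∀ p → p % 2 ≡ 1 → p % 3 ≡ 2 → ∃[ l ] p ≡ 5 ℕ.+ 6 ℕ.* l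
odd∧2mod3⇒5mod6 p p%2≡1 p%3≡2 = by-parity (q % 2) (m%n<n q 2) (m≡m%n+[m/n]*n q 2)
  where
  q = p ℕ./ 3
  r = q ℕ./ 2
  p≡ : p ≡ 2 ℕ.+ q ℕ.* 3
  p≡ = trans (m≡m%n+[m/n]*n p 3) (cong (ℕ._+ q ℕ.* 3) p%3≡2)
  by-parity : ∀ b → b ℕ.< 2 → q ≡ b ℕ.+ r ℕ.* 2 → ∃[ l ] p ≡ 5 ℕ.+ 6 ℕ.* l
  by-parity 0 _ q≡ = contradiction (trans (sym p%2≡1) (trans (cong (_% 2) even) ([m+kn]%n≡m%n 0 (1 ℕ.+ 3 ℕ.* r) 2))) λ ()
    where
    even : p ≡ 0 ℕ.+ (1 ℕ.+ 3 ℕ.* r) ℕ.* 2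
    even = trans p≡ (trans (cong (λ t → 2 ℕ.+ t ℕ.* 3) q≡)
      (solve 1 (λ r → con 2 :+ (r :* con 2) :* con 3 := (con 1 :+ con 3 :* r) :* con 2) refl r))
  by-parity 1 _ q≡ = r , trans p≡ (trans (cong (λ t → 2 ℕ.+ t ℕ.* 3) q≡)
    (solve 1 (λ r → con 2 :+ (con 1 :+ r :* con 2) :* con 3 := con 5 :+ con 6 :* r) refl r))
  by-parity (suc (suc _)) (ℕ.s≤s (ℕ.s≤s ())) _

open import Data.Integer.Base using (+_)

theorem1p3 : ∀ (p : ℕ) → Prime p → p % 2 ≡ 1 → p % 3 ≡ 2 →
    ∀ (M : ℕ) → M ≡ (2 ℕ.* p ∸ 1) ℕ./ 3 ⊎ M ≡ p ∸ 1 →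
    (∑[ k ≤ M ] summand (toℕ k))
    ≈ - (fromℕ 2 * fromℕ p) + (+ 8 / 9) * fromℕ p ^ 3 * euler (p ∸ 3) (+ 1 / 3)
    [mod p ^ 4 ]
theorem1p3 p p-prime p%2≡1 p%3≡2 M M≡ with odd∧2mod3⇒5mod6 p p%2≡1 p%3≡2
-- With p replaced by 5 + 6l, the truncated differences p ∸ 1 and p ∸ 3 compute to 4 + 6l and `m₀`.
... | l , refl = ≋⇒≈ 4 (supercongruence M M≡)
  where
  open PAdic p p-prime
  open FiveModSix l p-prime
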